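{- For every $v\in\{3^n,\ 2\cdot 7^n+1,\ 2\cdot 13^n+1 : n\ge 1\}$ there exist a GLS$(2,(3,\{3,6\},\{3\},\{6\}),2v)$ and a GLS*$(1,2;2,(3,\{3,6\},\{3\},\{6\}),2v)$.
   Context: An S$(\lambda;2,K,v)$ is a pair $(X,\mathcal{B})$, $|X|=v$, $\mathcal{B}$ a multiset of subsets (blocks) of $X$ with sizes in $K$, each 2-subset of $X$ in exactly $\lambda$ blocks. An S$(3,K,v)$ is a pair $(X,\mathcal{B})$ with $\mathcal{B}$ a set of subsets of sizes in $K$, each 3-subset in exactly one block. An LS$(1,\lambda;2,(3,K),v)$ is a collection $(X,\mathcal{B}_r)_{r\in R}$ of S$(\lambda;2,K,v)$ on a common $X$ such that $(X,\bigcup_r\mathcal{B}_r)$ (ordinary union) is an S$(3,K,v)$ and each block $B$ of that union occurs exactly $|B|-2$ times in the multiset $\{B: B\in\mathcal{B}_r, r\in R\}$; it is an LS* if moreover each $B\in\mathcal{B}_r$ with $|B|\ge4$ occurs exactly $\lambda$ times in $\mathcal{B}_r$. An S$(\lambda;2,(K_0,K_1,K_2),v)$ is a quadruple $(S,\infty_1,\infty_2,\mathcal{B})$ with $|S|=v-2$, $\infty_1\ne\infty_2$, $\infty_1,\infty_2\notin S$, such that $(S\cup\{\infty_1,\infty_2\},\mathcal{B})$ is an S$(\lambda;2,K_0\cup K_1\cup K_2,v)$ and $|B|\in K_i$ for each block $B$ with $|B\cap\{\infty_1,\infty_2\}|=i$. An LS$(1,\lambda;2,(3,K_0,K_1,K_2),v)$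 is a collection $(S,\infty_1,\infty_2,\mathcal{B}_r)_{r\in R}$ of such designs with $(S\cup\{\infty_1,\infty_2\},\mathcal{B}_r)_{r\in R}$ an LS$(1,\lambda;2,(3,K_0\cup K_1\cup K_2),v)$ (LS* analogously). A good design GS$(\lambda;2,(K_0,\{3\},K_2),v)$ is a 5-tuple $(S,\infty_1,\infty_2,\mathcal{B},D)$ where $(S,\infty_1,\infty_2,\mathcal{B})$ is an S$(\lambda;2,(K_0,\{3\},K_2),v)$ and $D$ is an Eulerian digraph on $S$ (every vertex has equal in-degree and out-degree) whose underlying undirected graph has edge set $\{\{x,y\}: x,y\in S, \{\infty_i,x,y\}\in\mathcal{B}, i\in\{1,2\}\}$. A GLS$(1,\lambda;2,(3,K_0,\{3\},K_2),v)$ is a collection $(S,\infty_1,\infty_2,\mathcal{B}_r,D_r)_{r\in R}$ of such GS where $(S,\infty_1,\infty_2,\mathcal{B}_r)_{r\in R}$ is an LS$(1,\lambda;2,(3,K_0,\{3\},K_2),v)$ and every ordered pair $(x,y)$ of distinct elements of $S$ not contained in any block $B$ with $\{\infty_1,\infty_2\}\subset B$ is an arc of exactly one $D_r$. A GLS* is a GLS whose underlying LS is an LS*. GLS$(2,(3,K_0,\{3\},K_2),v)$ means GLS$(1,1;2,(3,K_0,\{3\},K_2),v)$. -}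

module Defs where

open import Data.Nat using (ℕ; zero; suc; _+_; _*_; _∸_; _^_; _≤_)
open import Data.Bool using (Bool; true; false; _∧_; if_then_else_)
open import Data.Fin using (Fin)
open import Data.Fin.Subset using (Subset; ⁅_⁆; _∪_; ∣_∣)
open import Data.Vec using (lookup)
open import Data.Vec.Properties using (≡-dec)
import Data.Bool.Properties as BP
open import Data.List using (List; []; _∷_; allFin; map)
open import Data.Nat.ListAction using (sum)
open import Data.List.Membership.Propositional using (_∈_)
open import Data.Product using (Σ; ∃; _×_; _,_)
open import Data.Sum using (_⊎_)
open import Relation.Nullary using (¬_; does)
open import Relation.Binary.PropositionalEquality using (_≡_; _≢_)

-- A block on the point set Fin N is a subset of Fin N (canonical representation,
-- so equality of blocks is propositional equality).
Block : ℕ → Set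
Block N = Subset N

_∈ᵇ_ : ∀ {N} → Fin N → Block N → Bool
x ∈ᵇ B = lookup B x

countB : ∀ {A : Set} → (A → Bool) → List A → ℕ
countB p [] = 0
countB p (a ∷ as) = if p a then suc (countB p as) else countB p as

eqB : ∀ {N} → Block N → Block N → Bool
eqB B C = does (≡-dec BP._≟_ B C)

occ : ∀ {N} → Block N → List (Block N) → ℕ
occ B Bs = countB (eqB B) Bs

pairCount : ∀ {N} → List (Block N) → Fin N → Fin N → ℕ
pairCount Bs x y = countB (λ B → (x ∈ᵇ B) ∧ (y ∈ᵇ B)) Bs

triple : ∀ {N} → Fin N → Fin N → Fin N → Block N
triple a b c = ⁅ a ⁆ ∪ (⁅ b ⁆ ∪ ⁅ c ⁆)

IsPBD : ℕ → (ℕ → Set) → (N : ℕ) → List (Block N) → Set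
IsPBD λ' K N Bs =
  (∀ B → B ∈ Bs → K ∣ B ∣) ×
  (∀ (x y : Fin N) → x ≢ y → pairCount Bs x y ≡ λ')

InU : ∀ {N m} → (Fin m → List (Block N)) → Block N → Set
InU Bs B = ∃ λ r → B ∈ Bs r

totalOcc : ∀ {N m} → (Fin m → List (Block N)) → Block N → ℕ
totalOcc {m = m} Bs B = sum (map (λ r → occ B (Bs r)) (allFin m))

IsS3 : ℕ → (ℕ → Set) → (N : ℕ) → (Block N → Set) → Set
IsS3 _ K N U =
  (∀ B → U B → K ∣ B ∣) ×
  (∀ (x y z : Fin N) → x ≢ y → x ≢ z → y ≢ z →
     (∃ λ B → U B × (x ∈ᵇ B ≡ true) × (y ∈ᵇ B ≡ true) × (z ∈ᵇ B ≡ true)) ×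
     (∀ B C → U B → U C →
        (x ∈ᵇ B ≡ true) → (y ∈ᵇ B ≡ true) → (z ∈ᵇ B ≡ true) →
        (x ∈ᵇ C ≡ true) → (y ∈ᵇ C ≡ true) → (z ∈ᵇ C ≡ true) → B ≡ C))

IsLS : ℕ → (ℕ → Set) → (N m : ℕ) → (Fin m → List (Block N)) → Set
IsLS λ' K N m Bs =
  (∀ r → IsPBD λ' K N (Bs r)) ×
  IsS3 0 K N (InU Bs) ×
  (∀ B → InU Bs B → totalOcc Bs B ≡ ∣ B ∣ ∸ 2)

IsLSStar : ℕ → (N m : ℕ) → (Fin m → List (Block N)) → Set
IsLSStar λ' N m Bs = ∀ r B → B ∈ Bs r → 4 ≤ ∣ B ∣ → occ B (Bs r) ≡ λ'

nInf : ∀ {N} → Fin N → Fin N → Block N → ℕ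
nInf i₁ i₂ B = (if i₁ ∈ᵇ B then 1 else 0) + (if i₂ ∈ᵇ B then 1 else 0)

SizeCond : ∀ {N} → (K0 K1 K2 : ℕ → Set) → Fin N → Fin N → List (Block N) → Set
SizeCond K0 K1 K2 i₁ i₂ Bs = ∀ B → B ∈ Bs →
  (nInf i₁ i₂ B ≡ 0 → K0 ∣ B ∣) ×
  (nInf i₁ i₂ B ≡ 1 → K1 ∣ B ∣) ×
  (nInf i₁ i₂ B ≡ 2 → K2 ∣ B ∣)

_∪ᴷ_ : (ℕ → Set) → (ℕ → Set) → (ℕ → Set)
(K ∪ᴷ L) n = K n ⊎ L n

InS : ∀ {N} → Fin N → Fin N → Fin N → Set
InS i₁ i₂ x = x ≢ i₁ × x ≢ i₂

-- A (simple) digraph on Fin N given by its arc indicator D.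
-- Good-design condition: D is an Eulerian digraph on S whose underlying
-- undirected graph has edge set {{x,y} : x,y ∈ S, {∞ᵢ,x,y} ∈ Bs}.
IsGood : ∀ {N} → Fin N → Fin N → List (Block N) → (Fin N → Fin N → Bool) → Set
IsGood {N} i₁ i₂ Bs D =
  (∀ x y → D x y ≡ true → InS i₁ i₂ x × InS i₁ i₂ y × x ≢ y) ×
  (∀ x y → InS i₁ i₂ x → InS i₁ i₂ y → x ≢ y →
     ((D x y ≡ true ⊎ D y x ≡ true) →
        (triple i₁ x y ∈ Bs ⊎ triple i₂ x y ∈ Bs)) ×
     ((triple i₁ x y ∈ Bs ⊎ triple i₂ x y ∈ Bs) →
        (D x y ≡ true ⊎ D y x ≡ true))) ×
  (∀ x → InS i₁ i₂ x → countB (λ y → D x y) (allFin N) ≡ countB (λ y → D y x) (allFin N))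

record GLS (λ' : ℕ) (K0 K1 K2 : ℕ → Set) (N : ℕ) : Set₁ where
  field
    m      : ℕ
    blocks : Fin m → List (Block N)
    arcs   : Fin m → Fin N → Fin N → Bool
    ∞₁ ∞₂  : Fin N
    ∞₁≢∞₂  : ∞₁ ≢ ∞₂
    sizes  : ∀ r → SizeCond K0 K1 K2 ∞₁ ∞₂ (blocks r)
    isLS   : IsLS λ' (K0 ∪ᴷ (K1 ∪ᴷ K2)) N m blocks
    good   : ∀ r → IsGood ∞₁ ∞₂ (blocks r) (arcs r)
    arcCover : ∀ (x y : Fin N) → InS ∞₁ ∞₂ x → InS ∞₁ ∞₂ y → x ≢ y →
      ¬ (∃ λ B → InU blocks B × (∞₁ ∈ᵇ B ≡ true) × (∞₂ ∈ᵇ B ≡ true)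
                  × (x ∈ᵇ B ≡ true) × (y ∈ᵇ B ≡ true)) →
      countB (λ r → arcs r x y) (allFin m) ≡ 1

IsGLSStar : ∀ {λ' K0 K1 K2 N} → GLS λ' K0 K1 K2 N → Set
IsGLSStar {λ'} {N = N} G = IsLSStar λ' N (GLS.m G) (GLS.blocks G)

K36 : ℕ → Set
K36 n = n ≡ 3 ⊎ n ≡ 6

K3 : ℕ → Set
K3 n = n ≡ 3

K6 : ℕ → Set
K6 n = n ≡ 6

AdmissibleV : ℕ → Set
AdmissibleV v = ∃ λ n → 1 ≤ n ×
  (v ≡ 3 ^ n ⊎ v ≡ 2 * 7 ^ n + 1 ⊎ v ≡ 2 * 13 ^ n + 1)

{-# OPTIONS --safe #-}
-- The theorem follows from a "large set"-like structure on v points (`LRDesign`): v − 1 Steiner triple systems,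
-- each with a distinguished parallel class, such that the blocks of the parallel classes form one Steiner
-- triple system and every triple is a block of some system. Doubling the points, a block {x,y,z} of the r-th
-- parallel class becomes the 6-block {x,y,z} × {0,1}, and any other block of the r-th system the triples
-- {(x,a),(y,b),(z,c)} with a + b + c = ε; this gives one design for each (r , ε) when λ = 1, and one for each r
-- (taking both values of ε) when λ = 2. The two points over a fixed x∞ serve as ∞₁, ∞₂.
--
-- For v = 3^n, index the systems by the directions d ≠ 0 of the affine space 𝔽₃ⁿ: the d-th system consists of
-- the lines of direction d, its parallel class, and of the non-collinear triples of sum d.
--
-- For v = 2 q^n + 1 take {∞} ∪ V × {0,1} with V = 𝔽_q^n and the translates by V of two base systems B₀, B₁.
-- The system B_j contains the triples {(x,i),(y,k),(z,l)} with x + y + z = 0, i + k + l = j and x, y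
-- independent, and on each line through 0 a copy of a base system of order 2q + 1 having the block
-- {∞, (0,0), (0,1)}. Base systems for q = 7, 13 were found by a computer search for systems
-- invariant under a multiplier of order 3.
module Submission where

open import Defs
open import Level using (0ℓ)
open import Algebra.Bundles using (AbelianGroup)
open import Algebra.Structures using (IsAbelianGroup)
import Algebra.Properties.AbelianGroup
import Algebra.Solver.CommutativeMonoid
open import Data.Nat using (ℕ; zero; suc; _+_; _*_; _∸_; _^_; _≤_; s≤s; z≤n; _≡ᵇ_; _/_; NonZero)
import Data.Nat.Properties as ℕ
open import Data.Nat.DivMod using (_%_; _mod_; m%n<n; %-distribˡ-+; %-distribˡ-*; n%n≡0; m<n⇒m%n≡m; m*n%n≡0)
open import Data.Nat.ListAction using (sum)
open import Data.Bool using (Bool; true; false; _∧_; not; _xor_; if_then_else_)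
import Data.Bool.Properties as 𝔹
open import Data.Fin using (Fin; zero; suc; toℕ; punchIn; punchOut)
open import Data.Fin.Patterns using (0F; 1F; 2F)
import Data.Fin.Properties as Fin
open import Data.Fin.Subset using (∣_∣; ⁅_⁆; _∪_)
import Data.Fin.Subset.Properties as Subset
open import Data.Maybe using (Maybe; just; nothing) renaming (map to mapᴹ)
import Data.Maybe.Properties as Maybe
open import Data.Vec using (Vec; []; _∷_; lookup; tabulate; zipWith; replicate) renaming (map to mapⱽ)
import Data.Vec.Properties as Vec
open import Data.List using (List; []; _∷_; _++_; length; map; filter; allFin; deduplicate; cartesianProduct)
open import Data.List.Properties using (map-tabulate; map-cong)
open import Data.List.Membership.Propositional using (_∈_; _∉_)
open import Data.List.Membership.Propositional.Properties
  using (∈-allFin; ∈-filter⁺; ∈-filter⁻; ∈-map⁺; ∈-map⁻; ∈-deduplicate⁺; ∈-deduplicate⁻;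
         ∈-cartesianProduct⁺; ∈-cartesianProduct⁻; ∈-++⁻; ∈-++⁺ˡ; ∈-++⁺ʳ)
open import Data.List.Membership.Propositional.Properties.WithK using (unique∧set⇒bag)
open import Data.List.Relation.Binary.BagAndSetEquality using (∼bag⇒↭)
open import Data.List.Relation.Binary.Permutation.Propositional.Properties using (↭-length)
open import Data.List.Relation.Unary.Any using (here; there)
open import Data.List.Relation.Unary.All using ([]; _∷_)
open import Data.List.Relation.Unary.AllPairs using ([]; _∷_)
open import Data.List.Relation.Unary.Unique.Propositional using (Unique)
import Data.List.Relation.Unary.Unique.Propositional.Properties as Unique
open import Data.List.Relation.Unary.Unique.DecPropositional.Properties using (deduplicate-!)
open import Data.Product using (Σ; ∃; ∃₂; _×_; _,_; proj₁; proj₂)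
import Data.Product.Properties as Prod
open import Data.Product.Algebra using (×-comm)
open import Data.Product.Function.NonDependent.Propositional using (_×-↔_)
open import Data.Sum using (_⊎_; inj₁; inj₂; [_,_]′) renaming (map to map⊎)
open import Function.Base using (_∘_; _$_; id; case_of_)
open import Function.Bundles using (mk⇔; _↔_; mk↔ₛ′; module Inverse)
open import Function.Construct.Identity using (↔-id)
open import Function.Properties.Inverse using (↔-sym; ↔-trans)
open import Relation.Nullary using (¬_; Dec; yes; no; does; contradiction; ¬?)
open import Relation.Nullary.Decidable
  using (map′; _×-dec_; _⊎-dec_; _→-dec_; dec-true; dec-false; does-⇔; from-yes)
open import Relation.Binary.Definitions using (DecidableEquality; tri<; tri≈; tri>)
open import Relation.Binary.PropositionalEquality
  using (_≡_; _≢_; refl; sym; trans; cong; cong₂; subst; subst₂; isEquivalence; module ≡-Reasoning)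

-- The number v - 1 of systems matches the multiplicities |B| - 2. For fixed x ≠ y there are v - 2
-- possible third points and v - 1 systems. Every third point occurs, and the pair is parallel in
-- two systems, necessarily with the same third point; so that point occurs exactly twice and the
-- others once. A doubled block therefore lies in two systems, which makes four designs (r , ε), and
-- 6 - 2 = 4; a triple lies in one design, and 3 - 2 = 1. In 𝔽₃ⁿ the two systems are those of d and
-- -d; in the other family they are a translate of B₀ and a translate of B₁. In the second family
-- different lines through 0 share only ∞ and the two copies of 0. Since these three points form a
-- block of the parallel class in every copy, both the systems and their parallel classes glue along
-- it. A triple whose differences are independent gets sum zero by translating with its centroid, so
-- 3 must be invertible modulo q. This agrees with the divisibility needed for a parallel class on
-- 2q + 1 points: 3 divides 2q + 1 exactly when q ≡ 1 modulo 3.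

infix 4 _≟ᴮ_
_≟ᴮ_ : ∀ {N} → DecidableEquality (Block N)
_≟ᴮ_ = Vec.≡-dec 𝔹._≟_

does-true⇒ : ∀ {A : Set} (d : Dec A) → does d ≡ true → A
does-true⇒ (yes a) _ = a

-- Counting with duplicate-free lists; sizes and multiplicities of blocks.

countB-filter : ∀ {A : Set} (p : A → Bool) xs → countB p xs ≡ length (filter (λ x → p x 𝔹.≟ true) xs)
countB-filter p [] = refl
countB-filter p (x ∷ xs) with p x
... | true  = cong suc (countB-filter p xs)
... | false = countB-filter p xs

-- Duplicate-free lists with the same elements are permutations of each other, so a count can be
-- evaluated by listing the solutions. Block sizes, multiplicities and degrees are computed in this
-- way.
countB-unique : ∀ {A : Set} (p : A → Bool) {xs ys} → Unique xs → Unique ys →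
  (∀ {x} → x ∈ ys → x ∈ xs × p x ≡ true) → (∀ {x} → x ∈ xs → p x ≡ true → x ∈ ys) →
  countB p xs ≡ length ys
countB-unique p {xs} uxs uys ys⊆ ⊆ys = trans (countB-filter p xs)
  (↭-length (∼bag⇒↭ (unique∧set⇒bag (Unique.filter⁺ p? uxs) uys
    (mk⇔ (λ h → let x∈xs , px = ∈-filter⁻ p? h in ⊆ys x∈xs px)
         (λ h → let x∈xs , px = ys⊆ h in ∈-filter⁺ p? x∈xs px)))))
  where p? = λ x → p x 𝔹.≟ true

countB-allFin : ∀ {N} (p : Fin N → Bool) {ys} → Unique ys →
  (∀ {x} → x ∈ ys → p x ≡ true) → (∀ x → p x ≡ true → x ∈ ys) →
  countB p (allFin N) ≡ length ys
countB-allFin p uys ys⇒ ⇒ys =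
  countB-unique p (Unique.allFin⁺ _) uys (λ h → ∈-allFin _ , ys⇒ h) (λ _ → ⇒ys _)

countB-cong : ∀ {A : Set} {p p′ : A → Bool} → (∀ x → p x ≡ p′ x) → ∀ xs → countB p xs ≡ countB p′ xs
countB-cong e [] = refl
countB-cong {p = p} {p′} e (x ∷ xs) with p x | p′ x | e x
... | true  | .true  | refl = cong suc (countB-cong e xs)
... | false | .false | refl = countB-cong e xs

countB-++ : ∀ {A : Set} (p : A → Bool) xs ys → countB p (xs ++ ys) ≡ countB p xs + countB p ys
countB-++ p [] ys = refl
countB-++ p (x ∷ xs) ys with p x
... | true  = cong suc (countB-++ p xs ys)
... | false = countB-++ p xs ys

countB-map : ∀ {A B : Set} (p : B → Bool) (f : A → B) xs → countB p (map f xs) ≡ countB (p ∘ f) xs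
countB-map p f [] = refl
countB-map p f (x ∷ xs) with p (f x)
... | true  = cong suc (countB-map p f xs)
... | false = countB-map p f xs

∣_∣≡count : ∀ {N} (B : Block N) → ∣ B ∣ ≡ countB (lookup B) (allFin N)
∣ [] ∣≡count = refl
∣_∣≡count {suc N} (b ∷ B) = trans (step b) (cong (λ l → countB (lookup (b ∷ B)) (zero ∷ l)) (map-tabulate id suc))
  where
  rest : ∣ B ∣ ≡ countB (lookup (b ∷ B)) (map suc (allFin N))
  rest = trans ∣ B ∣≡count (sym (countB-map (lookup (b ∷ B)) suc (allFin N)))
  step : ∀ b → ∣ b ∷ B ∣ ≡ countB (lookup (b ∷ B)) (zero ∷ map suc (allFin N))
  step true  = cong suc (trans ∣ B ∣≡count (sym (countB-map (lookup (true ∷ B)) suc (allFin N))))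
  step false = trans ∣ B ∣≡count (sym (countB-map (lookup (false ∷ B)) suc (allFin N)))

size : ∀ {N} (B : Block N) {ys} → Unique ys →
  (∀ {x} → x ∈ ys → x ∈ᵇ B ≡ true) → (∀ x → x ∈ᵇ B ≡ true → x ∈ ys) → ∣ B ∣ ≡ length ys
size B u f g = trans ∣ B ∣≡count (countB-allFin (lookup B) u f g)

block-ext : ∀ {N} {B C : Block N} → (∀ x → x ∈ᵇ B ≡ true → x ∈ᵇ C ≡ true) →
  (∀ x → x ∈ᵇ C ≡ true → x ∈ᵇ B ≡ true) → B ≡ C
block-ext {B = B} {C} f g = Subset.⊆-antisym
  (λ h → Vec.lookup⇒[]= _ C (f _ (Vec.[]=⇒lookup h))) (λ h → Vec.lookup⇒[]= _ B (g _ (Vec.[]=⇒lookup h)))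

∈-triple⁺ : ∀ {N} {a b c x : Fin N} → x ≡ a ⊎ x ≡ b ⊎ x ≡ c → x ∈ᵇ triple a b c ≡ true
∈-triple⁺ {a = a} {b} {c} h = Vec.[]=⇒lookup (Subset.x∈p∪q⁺ {p = ⁅ a ⁆} {⁅ b ⁆ ∪ ⁅ c ⁆} (go h))
  where
  go : _ → _
  go (inj₁ refl) = inj₁ (Subset.x∈⁅x⁆ a)
  go (inj₂ (inj₁ refl)) = inj₂ (Subset.x∈p∪q⁺ (inj₁ (Subset.x∈⁅x⁆ b)))
  go (inj₂ (inj₂ refl)) = inj₂ (Subset.x∈p∪q⁺ {p = ⁅ b ⁆} (inj₂ (Subset.x∈⁅x⁆ c)))

∈-triple⁻ : ∀ {N} {a b c x : Fin N} → x ∈ᵇ triple a b c ≡ true → x ≡ a ⊎ x ≡ b ⊎ x ≡ c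
∈-triple⁻ {a = a} {b} {c} h with Subset.x∈p∪q⁻ ⁅ a ⁆ (⁅ b ⁆ ∪ ⁅ c ⁆) (Vec.lookup⇒[]= _ (triple a b c) h)
... | inj₁ h₁ = inj₁ (Subset.x∈⁅y⁆⇒x≡y a h₁)
... | inj₂ h₁ with Subset.x∈p∪q⁻ ⁅ b ⁆ ⁅ c ⁆ h₁
... | inj₁ h₂ = inj₂ (inj₁ (Subset.x∈⁅y⁆⇒x≡y b h₂))
... | inj₂ h₂ = inj₂ (inj₂ (Subset.x∈⁅y⁆⇒x≡y c h₂))

occ-unique-∈ : ∀ {N} {B : Block N} {Bs} → Unique Bs → B ∈ Bs → occ B Bs ≡ 1
occ-unique-∈ {B = B} u h = countB-unique (eqB B) {ys = B ∷ []} u ([] ∷ [])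
  (λ { (here refl) → h , dec-true (B ≟ᴮ B) refl })
  (λ _ e → here (sym (does-true⇒ (B ≟ᴮ _) e)))

occ-∉ : ∀ {N} {B : Block N} {Bs} → Unique Bs → B ∉ Bs → occ B Bs ≡ 0
occ-∉ {B = B} u B∉ = countB-unique (eqB B) {ys = []} u [] (λ ())
  (λ h e → contradiction (subst (_∈ _) (sym (does-true⇒ (B ≟ᴮ _) e)) h) B∉)

sum-indicator : ∀ {A : Set} {P : A → Set} (P? : ∀ a → Dec (P a)) (f : A → ℕ) →
  (∀ a → P a → f a ≡ 1) → (∀ a → ¬ P a → f a ≡ 0) → ∀ xs → sum (map f xs) ≡ countB (does ∘ P?) xs
sum-indicator P? f f₁ f₀ [] = refl
sum-indicator P? f f₁ f₀ (x ∷ xs) with P? x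
... | yes p = cong₂ _+_ (f₁ x p) (sum-indicator P? f f₁ f₀ xs)
... | no ¬p = cong₂ _+_ (f₀ x ¬p) (sum-indicator P? f f₁ f₀ xs)

sum-map-+ : ∀ {A : Set} (f g : A → ℕ) xs → sum (map (λ a → f a + g a) xs) ≡ sum (map f xs) + sum (map g xs)
sum-map-+ f g [] = refl
sum-map-+ f g (x ∷ xs) rewrite sum-map-+ f g xs = begin
  f x + g x + (F + G) ≡⟨ ℕ.+-assoc (f x) (g x) (F + G) ⟩
  f x + (g x + (F + G)) ≡⟨ cong (f x +_) (sym (ℕ.+-assoc (g x) F G)) ⟩
  f x + (g x + F + G) ≡⟨ cong (λ z → f x + (z + G)) (ℕ.+-comm (g x) F) ⟩
  f x + (F + g x + G) ≡⟨ cong (f x +_) (ℕ.+-assoc F (g x) G) ⟩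
  f x + (F + (g x + G)) ≡⟨ sym (ℕ.+-assoc (f x) F (g x + G)) ⟩
  f x + F + (g x + G) ∎
  where
  open ≡-Reasoning
  F = sum (map f xs)
  G = sum (map g xs)

totalOcc-unique : ∀ {N m} (Bs : Fin m → List (Block N)) (B : Block N) → (∀ r → Unique (Bs r)) → ∀ {ys} →
  Unique ys → (∀ {r} → r ∈ ys → B ∈ Bs r) → (∀ r → B ∈ Bs r → r ∈ ys) → totalOcc Bs B ≡ length ys
totalOcc-unique {m = m} Bs B u uys f g = trans
  (sum-indicator B∈? (λ r → occ B (Bs r)) (λ r → occ-unique-∈ (u r)) (λ r → occ-∉ (u r)) (allFin m))
  (countB-allFin (does ∘ B∈?) uys (λ h → dec-true (B∈? _) (f h)) (λ r e → g r (does-true⇒ (B∈? r) e)))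
  where
  open import Data.List.Membership.DecPropositional _≟ᴮ_ using (_∈?_)
  B∈? = λ r → B ∈? Bs r

-- Linear spaces as duplicate-free lists of blocks.

-- A linear space is given by the function sending two points to the block through them.
module LinearSpace {N : ℕ} (join : Fin N → Fin N → Block N)
  (left : ∀ x y → x ∈ᵇ join x y ≡ true) (right : ∀ x y → y ∈ᵇ join x y ≡ true)
  (coherent : ∀ {x y u w} → u ≢ w → u ∈ᵇ join x y ≡ true → w ∈ᵇ join x y ≡ true → join u w ≡ join x y)
  where

  private
    distinct? = λ (xy : Fin N × Fin N) → ¬? (proj₁ xy Fin.≟ proj₂ xy)
    pairs = cartesianProduct (allFin N) (allFin N)
    joins = map (λ (x , y) → join x y) (filter distinct? pairs)

  blockList : List (Block N)
  blockList = deduplicate _≟ᴮ_ joins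

  blockList-unique : Unique blockList
  blockList-unique = deduplicate-! _≟ᴮ_ joins

  join∈ : ∀ {x y} → x ≢ y → join x y ∈ blockList
  join∈ {x} {y} x≢y = ∈-deduplicate⁺ _≟ᴮ_ (∈-map⁺ (λ (x , y) → join x y)
    (∈-filter⁺ distinct? (∈-cartesianProduct⁺ (∈-allFin x) (∈-allFin y)) x≢y))

  ∈blockList : ∀ {B} → B ∈ blockList → ∃₂ λ x y → x ≢ y × B ≡ join x y
  ∈blockList B∈ with ∈-map⁻ (λ (x , y) → join x y) (∈-deduplicate⁻ _≟ᴮ_ joins B∈)
  ... | (x , y) , h , eq = x , y , proj₂ (∈-filter⁻ distinct? {xs = pairs} h) , eq

  through : ∀ {B u w} → B ∈ blockList → u ≢ w → u ∈ᵇ B ≡ true → w ∈ᵇ B ≡ true → B ≡ join u w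
  through B∈ u≢w u∈ w∈ with ∈blockList B∈
  ... | x , y , _ , refl = sym (coherent u≢w u∈ w∈)

  pairCount≡1 : ∀ x y → x ≢ y → pairCount blockList x y ≡ 1
  pairCount≡1 x y x≢y = countB-unique (λ B → (x ∈ᵇ B) ∧ (y ∈ᵇ B)) {ys = join x y ∷ []} blockList-unique ([] ∷ [])
    (λ { (here refl) → join∈ x≢y , cong₂ _∧_ (left x y) (right x y) })
    (λ {B} B∈ e → here (through B∈ x≢y (𝔹.∧-conicalˡ _ _ e) (𝔹.∧-conicalʳ (x ∈ᵇ B) _ e)))

-- If `j` were missed, punching it out would inject `Fin (suc m)` into `Fin m`.
injective⇒surjective : ∀ {m} (f : Fin m → Fin m) → (∀ {i j} → f i ≡ f j → i ≡ j) → ∀ j → ∃ λ i → f i ≡ j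
injective⇒surjective {suc m} f inj j with Fin.any? (λ i → f i Fin.≟ j)
... | yes h = h
... | no ¬h = contradiction (Fin.injective⇒≤ {f = λ i → punchOut {i = j} {f i} (λ e → ¬h (i , sym e))}
  (λ {i} {i′} e → inj (Fin.punchOut-injective (λ e → ¬h (i , sym e)) (λ e → ¬h (i′ , sym e)) e))) ℕ.1+n≰n

to-injective : ∀ {A B : Set} (iso : A ↔ B) {x y} → Inverse.to iso x ≡ Inverse.to iso y → x ≡ y
to-injective iso {x} {y} e = trans (sym (Inverse.strictlyInverseʳ iso x))
  (trans (cong (Inverse.from iso) e) (Inverse.strictlyInverseʳ iso y))

from-injective : ∀ {A B : Set} (iso : A ↔ B) {x y} → Inverse.from iso x ≡ Inverse.from iso y → x ≡ y
from-injective iso {x} {y} e = trans (sym (Inverse.strictlyInverseˡ iso x))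
  (trans (cong (Inverse.to iso) e) (Inverse.strictlyInverseˡ iso y))

-- Systems with parallel classes, and the counting that makes the covering exact.

-- |X| − 1 Steiner triple systems on X, the r-th one given by its Steiner quasigroup `third r`,
-- each with a parallel class, given by the equivalence relation `Parallel r`.
-- The blocks of the parallel classes form a single Steiner triple system (coherent), and every
-- triple is a block of some system.
record LRDesign (X R : Set) (m : ℕ) : Set₁ where
  field
    points  : X ↔ Fin (suc m)
    indices : R ↔ Fin m
    index₀  : R
    third   : R → X → X → X
    third-idem : ∀ r x → third r x x ≡ x
    third-comm : ∀ r x y → third r x y ≡ third r y x
    third-invol : ∀ r x y → third r x (third r x y) ≡ y
    Parallel : R → X → X → Set
    parallel? : ∀ r x y → Dec (Parallel r x y)
    ∥-refl  : ∀ r x → Parallel r x x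
    ∥-sym   : ∀ {r x y} → Parallel r x y → Parallel r y x
    ∥-trans : ∀ {r x y z} → Parallel r x y → Parallel r y z → Parallel r x z
    ∥-third : ∀ {r x y} → Parallel r x y → Parallel r x (third r x y)
    -- `∥-other` and `∥-third` give every class at least three points, `∥-three` at most three.
    ∥-other : ∀ r x → ∃ λ y → x ≢ y × Parallel r x y
    ∥-three : ∀ {r x y z} → x ≢ y → x ≢ z → y ≢ z → Parallel r x y → Parallel r x z → third r x y ≡ z
    coherent : ∀ {r r′ x y} → x ≢ y → Parallel r x y → Parallel r′ x y → third r x y ≡ third r′ x y
    cover∥  : ∀ {x y} → x ≢ y → ∃₂ λ r r′ → r ≢ r′ × Parallel r x y × Parallel r′ x y
    cover   : ∀ {x y z} → x ≢ y → x ≢ z → y ≢ z → ∃ λ r → third r x y ≡ z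

  infix 4 _≟_
  _≟_ : DecidableEquality X
  x ≟ y = map′ (to-injective points) (cong (Inverse.to points)) (Inverse.to points x Fin.≟ Inverse.to points y)

  third-swap : ∀ r {x y z} → third r x y ≡ z → third r x z ≡ y
  third-swap r {x} {y} refl = third-invol r x y

  third≢ˡ : ∀ r {x y} → x ≢ y → third r x y ≢ x
  third≢ˡ r {x} {y} x≢y e = x≢y (sym (trans (sym (third-swap r e)) (third-idem r x)))

  third≢ʳ : ∀ r {x y} → x ≢ y → third r x y ≢ y
  third≢ʳ r {x} {y} x≢y e = third≢ˡ r (x≢y ∘ sym) (trans (third-comm r y x) e)

  link : ∀ x y → ∃ λ r → Parallel r x y
  link x y with x ≟ y
  ... | yes refl = index₀ , ∥-refl index₀ x
  ... | no x≢y with cover∥ x≢y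
  ... | r , _ , _ , h , _ = r , h

  -- For fixed x ≠ y, the |X| − 1 indices r hit all |X| − 2 points as `third r x y`, the third point s of the
  -- parallel block twice; so by counting s is hit exactly twice and every other point once.
  module _ {x y : X} (x≢y : x ≢ y) where
    private
      r₁ r₂ : R
      r₁ = proj₁ (cover∥ x≢y)
      r₂ = proj₁ (proj₂ (cover∥ x≢y))
      r₁≢r₂ = proj₁ (proj₂ (proj₂ (cover∥ x≢y)))
      ∥₁ = proj₁ (proj₂ (proj₂ (proj₂ (cover∥ x≢y))))
      ∥₂ = proj₂ (proj₂ (proj₂ (proj₂ (cover∥ x≢y))))
      s = third r₁ x y
      s≡ = coherent x≢y ∥₁ ∥₂

      -- The point `x` is never a third point on the pair, so it is free to stand for the second
      -- index `r₂` of `s`. With this convention the `m` points other than `y` inject into the `m`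
      -- indices.
      Hit : X → R → Set
      Hit z r = (z ≡ x × r ≡ r₂) ⊎ (z ≢ x × z ≡ s × r ≡ r₁) ⊎ (z ≢ x × z ≢ s × third r x y ≡ z)

      hit : ∀ z → ∃ λ r → z ≢ y → Hit z r
      hit z with z ≟ x | z ≟ s | z ≟ y
      ... | yes z≡x | _ | _ = r₂ , λ _ → inj₁ (z≡x , refl)
      ... | no z≢x | yes z≡s | _ = r₁ , λ _ → inj₂ (inj₁ (z≢x , z≡s , refl))
      ... | no _ | no _ | yes z≡y = r₁ , contradiction z≡y
      ... | no z≢x | no z≢s | no z≢y with cover x≢y (z≢x ∘ sym) (z≢y ∘ sym)
      ... | r , e = r , λ _ → inj₂ (inj₂ (z≢x , z≢s , e))

      Hit-injective : ∀ {z w r} → Hit z r → Hit w r → z ≡ w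
      Hit-injective (inj₁ (z≡x , _)) (inj₁ (w≡x , _)) = trans z≡x (sym w≡x)
      Hit-injective (inj₁ (_ , e)) (inj₂ (inj₁ (_ , _ , e′))) = contradiction (trans (sym e′) e) r₁≢r₂
      Hit-injective (inj₁ (_ , refl)) (inj₂ (inj₂ (_ , w≢s , t))) = contradiction (sym (trans s≡ t)) w≢s
      Hit-injective (inj₂ (inj₁ (_ , _ , e))) (inj₁ (_ , e′)) = contradiction (trans (sym e) e′) r₁≢r₂
      Hit-injective (inj₂ (inj₁ (_ , z≡s , _))) (inj₂ (inj₁ (_ , w≡s , _))) = trans z≡s (sym w≡s)
      Hit-injective (inj₂ (inj₁ (_ , _ , refl))) (inj₂ (inj₂ (_ , w≢s , t))) = contradiction (sym t) w≢s
      Hit-injective (inj₂ (inj₂ (_ , z≢s , t))) (inj₁ (_ , refl)) = contradiction (sym (trans s≡ t)) z≢s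
      Hit-injective (inj₂ (inj₂ (_ , z≢s , t))) (inj₂ (inj₁ (_ , _ , refl))) = contradiction (sym t) z≢s
      Hit-injective (inj₂ (inj₂ (_ , _ , t))) (inj₂ (inj₂ (_ , _ , t′))) = trans (sym t) t′

      point : Fin m → X
      point i = Inverse.from points (punchIn (Inverse.to points y) i)

      point≢y : ∀ i → point i ≢ y
      point≢y i e = Fin.punchInᵢ≢i (Inverse.to points y) i
        (trans (sym (Inverse.strictlyInverseˡ points _)) (cong (Inverse.to points) e))

      pick : Fin m → R
      pick i = proj₁ (hit (point i))

      picked : ∀ i → Hit (point i) (pick i)
      picked i = proj₂ (hit (point i)) (point≢y i)

      pick-injective : ∀ {i j} → pick i ≡ pick j → i ≡ j
      pick-injective {i} {j} e = Fin.punchIn-injective (Inverse.to points y) i j (from-injective points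
        (Hit-injective (picked i) (subst (Hit (point j)) (sym e) (picked j))))

      Exact : R → Set
      Exact r = (r ≡ r₁ ⊎ r ≡ r₂) ⊎ (third r x y ≢ s × r ≡ proj₁ (hit (third r x y)))

      exact′ : ∀ i → Hit (point i) (pick i) → Exact (pick i)
      exact′ i (inj₁ (_ , e)) = inj₁ (inj₂ e)
      exact′ i (inj₂ (inj₁ (_ , _ , e))) = inj₁ (inj₁ e)
      exact′ i (inj₂ (inj₂ (_ , ≢s , e))) =
        inj₂ ((λ e′ → ≢s (trans (sym e) e′)) , cong (λ z → proj₁ (hit z)) (sym e))

      -- An injection between sets of size `m` is onto, so every index is the one picked by some
      -- point. Hence no third point other than `s` can arise from two indices, and `s` arises from
      -- `r₁` and `r₂` only.
      exact : ∀ r → Exact r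
      exact r = subst Exact (proj₂ every) (exact′ (proj₁ every) (picked (proj₁ every)))
        where
        every : ∃ λ i → pick i ≡ r
        every = let i , e = injective⇒surjective (Inverse.to indices ∘ pick)
                      (pick-injective ∘ to-injective indices) (Inverse.to indices r)
                in i , to-injective indices e

    abstract
      third-determines : ∀ {r r′} → third r x y ≡ third r′ x y → r ≡ r′ ⊎ (Parallel r x y × Parallel r′ x y)
      third-determines {r} {r′} e = go (exact r) (exact r′)
        where
        Parallel′ : ∀ {r} → r ≡ r₁ ⊎ r ≡ r₂ → Parallel r x y
        Parallel′ (inj₁ refl) = ∥₁
        Parallel′ (inj₂ refl) = ∥₂
        ≡s : ∀ {r} → r ≡ r₁ ⊎ r ≡ r₂ → third r x y ≡ s
        ≡s h = coherent x≢y (Parallel′ h) ∥₁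
        go : Exact r → Exact r′ → r ≡ r′ ⊎ (Parallel r x y × Parallel r′ x y)
        go (inj₁ h) (inj₁ h′) = inj₂ (Parallel′ h , Parallel′ h′)
        go (inj₁ h) (inj₂ (≢s , _)) = contradiction (trans (sym e) (≡s h)) ≢s
        go (inj₂ (≢s , _)) (inj₁ h) = contradiction (trans e (≡s h)) ≢s
        go (inj₂ (_ , h)) (inj₂ (_ , h′)) = inj₁ (trans h (trans (cong (λ z → proj₁ (hit z)) e) (sym h′)))

      exactly-two : ∃₂ λ r₁ r₂ → r₁ ≢ r₂ × Parallel r₁ x y × Parallel r₂ x y ×
        (∀ r → Parallel r x y → r ≡ r₁ ⊎ r ≡ r₂)
      exactly-two = r₁ , r₂ , r₁≢r₂ , ∥₁ , ∥₂ , λ r h →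
        [ id , (λ (≢s , _) → contradiction (coherent x≢y h ∥₁) ≢s) ]′ (exact r)

xor-cancelˡ : ∀ a {b c} → a xor b ≡ a xor c → b ≡ c
xor-cancelˡ false e = e
xor-cancelˡ true {b} {c} e = trans (sym (𝔹.not-involutive b)) (trans (cong not e) (𝔹.not-involutive c))

xor-invol : ∀ a b → a xor (a xor b) ≡ b
xor-invol false b = refl
xor-invol true b = 𝔹.not-involutive b

≢⇒≡ : ∀ {a b c : Bool} → a ≢ b → a ≢ c → b ≡ c
≢⇒≡ a≢b a≢c = trans (𝔹.¬-not (a≢b ∘ sym)) (sym (𝔹.¬-not (a≢c ∘ sym)))

-- The doubled designs: blocks, sizes, covering of triples and multiplicities.

module Doubling {X R : Set} {m : ℕ} (L : LRDesign X R m) where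
  open LRDesign L

  N : ℕ
  N = 2 * suc m

  Point Index : Set
  Point = X × Bool
  Index = R × Bool

  abstract
    Point↔Fin : Point ↔ Fin N
    Point↔Fin = ↔-trans (×-comm X Bool) (↔-trans (↔-sym Fin.2↔Bool ×-↔ points) (↔-sym Fin.*↔×))

    Index↔Fin : Index ↔ Fin (m * 2)
    Index↔Fin = ↔-trans (indices ×-↔ ↔-sym Fin.2↔Bool) (↔-sym Fin.*↔×)

  code : Point → Fin N
  code = Inverse.to Point↔Fin

  point : Fin N → Point
  point = Inverse.from Point↔Fin

  point-code : ∀ p → point (code p) ≡ p
  point-code = Inverse.strictlyInverseʳ Point↔Fin

  code-point : ∀ k → code (point k) ≡ k
  code-point = Inverse.strictlyInverseˡ Point↔Fin

  infix 4 _≟²_ _∥[_]_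
  _≟²_ : DecidableEquality Point
  p ≟² q = map′ (to-injective Point↔Fin) (cong code) (code p Fin.≟ code q)

  _∥[_]_ : Point → R → Point → Set
  (x , _) ∥[ r ] (y , _) = Parallel r x y

  third² : Index → Point → Point → Point
  third² (r , ε) (x , a) (y , b) = third r x y , (a xor b) xor ε

  -- The block through two points of the design with index (r , ε): a parallel block {x,y,z} is doubled to
  -- {x,y,z} × Bool, any other block carries the triples {(x,a),(y,b),(z,c)} with a + b + c = ε.
  Mem : Index → Point → Point → Point → Set
  Mem i@(r , _) p q u = (p ∥[ r ] q × p ∥[ r ] u) ⊎ (¬ p ∥[ r ] q × (u ≡ p ⊎ u ≡ q ⊎ u ≡ third² i p q))

  Mem? : ∀ i p q u → Dec (Mem i p q u)
  Mem? i@(r , _) p@(x , _) q@(y , _) u@(z , _) =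
    (parallel? r x y ×-dec parallel? r x z)
      ⊎-dec (¬? (parallel? r x y) ×-dec (u ≟² p ⊎-dec u ≟² q ⊎-dec u ≟² third² i p q))

  Mem-left : ∀ i p q → Mem i p q p
  Mem-left (r , _) (x , _) (y , _) with parallel? r x y
  ... | yes h = inj₁ (h , ∥-refl r x)
  ... | no ¬h = inj₂ (¬h , inj₁ refl)

  Mem-right : ∀ i p q → Mem i p q q
  Mem-right (r , _) (x , _) (y , _) with parallel? r x y
  ... | yes h = inj₁ (h , h)
  ... | no ¬h = inj₂ (¬h , inj₂ (inj₁ refl))

  -- A non-parallel block with its points in a chosen order. `triangle-swap` and `triangle-flip`
  -- generate all six orders, so `Mem-coherent` can rebuild the block from any two of its points.
  record Triangle (i : Index) (p q s : Point) : Set where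
    constructor △
    field
      not-parallel : ¬ p ∥[ proj₁ i ] q
      third≡ : third² i p q ≡ s

  triangle-swap : ∀ {i p q s} → Triangle i p q s → Triangle i q p s
  triangle-swap {r , ε} {x , a} {y , b} (△ ¬h refl) =
    △ (¬h ∘ ∥-sym) (cong₂ _,_ (third-comm r y x) (cong (_xor ε) (𝔹.xor-comm b a)))

  triangle-flip : ∀ {i p q s} → Triangle i p q s → Triangle i p s q
  triangle-flip {r , ε} {x , a} {y , b} (△ ¬h refl) =
    △ (λ h → ¬h (subst (Parallel r x) (third-invol r x y) (∥-third h))) $
    cong₂ _,_ (third-invol r x y) (begin
      (a xor ((a xor b) xor ε)) xor ε ≡⟨ cong (λ c → (a xor c) xor ε) (𝔹.xor-assoc a b ε) ⟩
      (a xor (a xor (b xor ε))) xor ε ≡⟨ cong (_xor ε) (xor-invol a (b xor ε)) ⟩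
      (b xor ε) xor ε                 ≡⟨ 𝔹.xor-comm (b xor ε) ε ⟩
      ε xor (b xor ε)                 ≡⟨ cong (ε xor_) (𝔹.xor-comm b ε) ⟩
      ε xor (ε xor b)                 ≡⟨ xor-invol ε b ⟩
      b                               ∎)
    where open ≡-Reasoning

  _⊑_ : (Point → Set) → (Point → Set) → Set
  P ⊑ Q = ∀ u → P u → Q u

  triangle⊑ : ∀ {i p q s i′ p′ q′} → Triangle i p q s →
    Mem i′ p′ q′ p → Mem i′ p′ q′ q → Mem i′ p′ q′ s → Mem i p q ⊑ Mem i′ p′ q′
  triangle⊑ (△ ¬h _) _ _ _ u (inj₁ (h , _)) = contradiction h ¬h
  triangle⊑ _ a _ _ u (inj₂ (_ , inj₁ refl)) = a
  triangle⊑ _ _ b _ u (inj₂ (_ , inj₂ (inj₁ refl))) = b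
  triangle⊑ (△ _ refl) _ _ c u (inj₂ (_ , inj₂ (inj₂ refl))) = c

  triangle-vertex : ∀ {i p q s} → Triangle i p q s → Mem i p q s
  triangle-vertex (△ ¬h refl) = inj₂ (¬h , inj₂ (inj₂ refl))

  triangle≈ : ∀ {i p q s p′ q′ s′} → Triangle i p q s → Triangle i p′ q′ s′ →
    (Mem i p q p′ × Mem i p q q′ × Mem i p q s′) → (Mem i p′ q′ p × Mem i p′ q′ q × Mem i p′ q′ s) →
    Mem i p q ⊑ Mem i p′ q′ × Mem i p′ q′ ⊑ Mem i p q
  triangle≈ t t′ (a , b , c) (a′ , b′ , c′) = triangle⊑ t a′ b′ c′ , triangle⊑ t′ a b c

  Mem-coherent : ∀ i {p q p′ q′} → p′ ≢ q′ → Mem i p q p′ → Mem i p q q′ →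
    Mem i p q ⊑ Mem i p′ q′ × Mem i p′ q′ ⊑ Mem i p q
  Mem-coherent i _ (inj₁ (h , _)) (inj₂ (¬h , _)) = contradiction h ¬h
  Mem-coherent i _ (inj₂ (¬h , _)) (inj₁ (h , _)) = contradiction h ¬h
  Mem-coherent i@(r , _) _ (inj₁ (h , h₁)) (inj₁ (_ , h₂)) =
    (λ { u (inj₁ (_ , h₃)) → inj₁ (∥-trans (∥-sym h₁) h₂ , ∥-trans (∥-sym h₁) h₃)
       ; u (inj₂ (¬h , _)) → contradiction h ¬h }) ,
    (λ { u (inj₁ (_ , h₃)) → inj₁ (h , ∥-trans h₁ h₃)
       ; u (inj₂ (¬h , _)) → contradiction (∥-trans (∥-sym h₁) h₂) ¬h })
  Mem-coherent i {p} {q} p′≢q′ (inj₂ (¬h , c)) (inj₂ (_ , d)) = go c d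
    where
    s = third² i p q
    t₁ : Triangle i p q s
    t₁ = △ ¬h refl
    t₂ = triangle-swap t₁
    t₃ = triangle-flip t₁
    t₄ = triangle-swap t₃
    t₅ = triangle-flip t₂
    t₆ = triangle-swap t₅
    P = Mem-left i p q
    Q = Mem-right i p q
    S = triangle-vertex t₁
    go : _ → _ → _
    go (inj₁ refl) (inj₁ refl) = contradiction refl p′≢q′
    go (inj₁ refl) (inj₂ (inj₁ refl)) = (λ _ → id) , (λ _ → id)
    go (inj₁ refl) (inj₂ (inj₂ refl)) = triangle≈ t₁ t₃ (P , S , Q) (Mem-left i _ _ , triangle-vertex t₃ , Mem-right i _ _)
    go (inj₂ (inj₁ refl)) (inj₁ refl) = triangle≈ t₁ t₂ (Q , P , S) (Mem-right i _ _ , Mem-left i _ _ , triangle-vertex t₂)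
    go (inj₂ (inj₁ refl)) (inj₂ (inj₁ refl)) = contradiction refl p′≢q′
    go (inj₂ (inj₁ refl)) (inj₂ (inj₂ refl)) = triangle≈ t₁ t₅ (Q , S , P) (triangle-vertex t₅ , Mem-left i _ _ , Mem-right i _ _)
    go (inj₂ (inj₂ refl)) (inj₁ refl) = triangle≈ t₁ t₄ (S , P , Q) (Mem-right i _ _ , triangle-vertex t₄ , Mem-left i _ _)
    go (inj₂ (inj₂ refl)) (inj₂ (inj₁ refl)) = triangle≈ t₁ t₆ (S , Q , P) (triangle-vertex t₆ , Mem-right i _ _ , Mem-left i _ _)
    go (inj₂ (inj₂ refl)) (inj₂ (inj₂ refl)) = contradiction refl p′≢q′

  class-cases : ∀ {r x y u} → x ≢ y → Parallel r x y → Parallel r x u → u ≡ x ⊎ u ≡ y ⊎ u ≡ third r x y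
  class-cases {x = x} {y} {u} x≢y hy hu with u ≟ x | u ≟ y
  ... | yes e | _ = inj₁ e
  ... | no _ | yes e = inj₂ (inj₁ e)
  ... | no u≢x | no u≢y = inj₂ (inj₂ (sym (∥-three x≢y (u≢x ∘ sym) (u≢y ∘ sym) hy hu)))

  -- By `coherent` two distinct points determine their class block, whichever index makes them
  -- parallel.
  class-unique : ∀ {r r′ x y u} → x ≢ y → Parallel r x y → Parallel r′ x y → Parallel r x u → Parallel r′ x u
  class-unique {r′ = r′} {x} x≢y h h′ hu with class-cases x≢y h hu
  ... | inj₁ refl = ∥-refl r′ x
  ... | inj₂ (inj₁ refl) = h′
  ... | inj₂ (inj₂ refl) = subst (Parallel r′ x) (sym (coherent x≢y h h′)) (∥-third h′)

  -- Otherwise the systems `r` and `r′` would have the same third point on the pair, so by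
  -- `third-determines` they would be equal or the pair would be parallel in both. Either way it
  -- would be parallel in `r`.
  no-mixing : ∀ {i r′ p q u} → ¬ p ∥[ proj₁ i ] q → u ≡ third² i p q → p ∥[ r′ ] q → ¬ p ∥[ r′ ] u
  no-mixing {r , _} {r′} {x , _} {y , _} ¬h refl h hu =
    [ (λ { refl → ¬h h }) , (λ (h′ , _) → ¬h h′) ]′
      (third-determines x≢y (sym (∥-three x≢y (third≢ˡ r x≢y ∘ sym) (third≢ʳ r x≢y ∘ sym) h hu)))
    where
    x≢y : x ≢ y
    x≢y refl = ¬h (∥-refl r x)

  -- The key to uniqueness in the S(3,K,v). A non-parallel block fixes `r` by `third-determines` and
  -- `ε` as the parity of its second coordinates; a parallel block fixes neither, but `no-mixing`
  -- keeps the two kinds apart.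
  same-kind : ∀ {i i′ p q u} → p ≢ u → q ≢ u → Mem i p q u → Mem i′ p q u →
    (p ∥[ proj₁ i ] q × p ∥[ proj₁ i′ ] q × p ∥[ proj₁ i ] u × p ∥[ proj₁ i′ ] u) ⊎ (i ≡ i′ × ¬ p ∥[ proj₁ i ] q)
  same-kind p≢u q≢u (inj₂ (_ , inj₁ e)) _ = contradiction (sym e) p≢u
  same-kind p≢u q≢u (inj₂ (_ , inj₂ (inj₁ e))) _ = contradiction (sym e) q≢u
  same-kind p≢u q≢u _ (inj₂ (_ , inj₁ e)) = contradiction (sym e) p≢u
  same-kind p≢u q≢u _ (inj₂ (_ , inj₂ (inj₁ e))) = contradiction (sym e) q≢u
  same-kind _ _ (inj₁ (h , hu)) (inj₁ (h′ , hu′)) = inj₁ (h , h′ , hu , hu′)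
  same-kind {i′ = i′} {p} {q} _ _ (inj₁ (h , hu)) (inj₂ (¬h , inj₂ (inj₂ e))) = contradiction hu (no-mixing {i′} {p = p} {q} ¬h e h)
  same-kind {i} {p = p} {q} _ _ (inj₂ (¬h , inj₂ (inj₂ e))) (inj₁ (h , hu)) = contradiction hu (no-mixing {i} {p = p} {q} ¬h e h)
  same-kind {r , ε} {r′ , ε′} {x , a} {y , b} _ _ (inj₂ (¬h , inj₂ (inj₂ e))) (inj₂ (_ , inj₂ (inj₂ e′)))
    with third-determines x≢y (cong proj₁ (trans (sym e) e′))
    where
    x≢y : x ≢ y
    x≢y refl = ¬h (∥-refl r x)
  ... | inj₂ (h , _) = contradiction h ¬h
  ... | inj₁ refl = inj₂ (cong (r ,_) (xor-cancelˡ (a xor b) (cong proj₂ (trans (sym e) e′))) , ¬h)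

  Mem-unique : ∀ {i i′ p q u} → p ≢ q → p ≢ u → q ≢ u → Mem i p q u → Mem i′ p q u → Mem i p q ⊑ Mem i′ p q
  Mem-unique {i} {i′} {p} {q} {u} p≢q p≢u q≢u M M′ v Mv with same-kind {i} {i′} {p} {q} {u} p≢u q≢u M M′
  ... | inj₂ (refl , _) = Mv
  ... | inj₁ (h , h′ , hu , hu′) with Mv
  ... | inj₂ (¬h , _) = contradiction h ¬h
  ... | inj₁ (_ , hv) with proj₁ p ≟ proj₁ q
  ... | no x≢y = inj₁ (h′ , class-unique x≢y h h′ hv)
  ... | yes refl = inj₁ (h′ , class-unique x≢z hu hu′ hv)
    where
    -- Only two points lie over each point of `X`, so when `p` and `q` share theirs, `u` must lie
    -- elsewhere and can replace `q`.
    x≢z : proj₁ p ≢ proj₁ u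
    x≢z refl = q≢u (cong (proj₁ p ,_) (≢⇒≡ {a = proj₂ p} (p≢q ∘ cong (_ ,_)) (p≢u ∘ cong (_ ,_))))

  Mem-cover : ∀ {p q u} → p ≢ q → p ≢ u → q ≢ u → ∃ λ i → Mem i p q u
  Mem-cover {x , a} {y , b} {z , c} p≢q p≢u q≢u with x ≟ y | x ≟ z | y ≟ z
  -- If two of the points lie over the same point of `X`, the triple is contained in a doubled
  -- block.
  ... | yes refl | _ | _ = let r , h = link x z in (r , false) , inj₁ (∥-refl r x , h)
  ... | no _ | yes refl | _ = let r , h = link x y in (r , false) , inj₁ (h , ∥-refl r x)
  ... | no _ | no _ | yes refl = let r , h = link x y in (r , false) , inj₁ (h , h)
  ... | no x≢y | no x≢z | no y≢z with cover x≢y x≢z y≢z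
  ... | r , refl with parallel? r x y
  ... | yes h = (r , false) , inj₁ (h , ∥-third h)
  ... | no ¬h = (r , (a xor b) xor c) ,
        inj₂ (¬h , inj₂ (inj₂ (cong (third r x y ,_) (sym (xor-invol (a xor b) c)))))

  abstract
    block : Index → Point → Point → Block N
    block i p q = tabulate (λ k → does (Mem? i p q (point k)))

    ∈block⁺ : ∀ {i p q k} → Mem i p q (point k) → k ∈ᵇ block i p q ≡ true
    ∈block⁺ {i} {p} {q} {k} h = trans (Vec.lookup∘tabulate (λ k → does (Mem? i p q (point k))) k) (dec-true (Mem? i p q (point k)) h)

    ∈block⁻ : ∀ {i p q k} → k ∈ᵇ block i p q ≡ true → Mem i p q (point k)
    ∈block⁻ {i} {p} {q} {k} e = does-true⇒ (Mem? i p q (point k)) (trans (sym (Vec.lookup∘tabulate (λ k → does (Mem? i p q (point k))) k)) e)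

  ∈block-code⁺ : ∀ {i p q u} → Mem i p q u → code u ∈ᵇ block i p q ≡ true
  ∈block-code⁺ {i} {p} {q} {u} h = ∈block⁺ {i} {p} {q} (subst (Mem i p q) (sym (point-code u)) h)

  ∈block-code⁻ : ∀ {i p q u} → code u ∈ᵇ block i p q ≡ true → Mem i p q u
  ∈block-code⁻ {i} {p} {q} {u} e = subst (Mem i p q) (point-code u) (∈block⁻ {i} {p} {q} e)

  block-≡ : ∀ i p q i′ p′ q′ → Mem i p q ⊑ Mem i′ p′ q′ → Mem i′ p′ q′ ⊑ Mem i p q → block i p q ≡ block i′ p′ q′
  block-≡ i p q i′ p′ q′ f g = block-ext
    (λ k h → ∈block⁺ {i′} {p′} {q′} (f (point k) (∈block⁻ {i} {p} {q} h)))
    (λ k h → ∈block⁺ {i} {p} {q} (g (point k) (∈block⁻ {i′} {p′} {q′} h)))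

  point-≢ : ∀ {k l} → k ≢ l → point k ≢ point l
  point-≢ k≢l e = k≢l (from-injective Point↔Fin e)

  join : Index → Fin N → Fin N → Block N
  join i k l = block i (point k) (point l)

  join-left : ∀ i k l → k ∈ᵇ join i k l ≡ true
  join-left i k l = ∈block⁺ {i} {point k} {point l} {k} (Mem-left i (point k) (point l))

  join-right : ∀ i k l → l ∈ᵇ join i k l ≡ true
  join-right i k l = ∈block⁺ {i} {point k} {point l} {l} (Mem-right i (point k) (point l))

  join-coherent : ∀ i {k l k′ l′} → k′ ≢ l′ → k′ ∈ᵇ join i k l ≡ true → l′ ∈ᵇ join i k l ≡ true →
    join i k′ l′ ≡ join i k l
  join-coherent i {k} {l} {k′} {l′} k′≢l′ h h′ =
    let f , g = Mem-coherent i {point k} {point l} {point k′} {point l′} (point-≢ k′≢l′)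
                  (∈block⁻ {i} {point k} {point l} {k′} h) (∈block⁻ {i} {point k} {point l} {l′} h′)
    in block-≡ i _ _ i _ _ g f

  private
    module Design (i : Index) = LinearSpace (join i) (join-left i) (join-right i) (join-coherent i)

  design : Index → List (Block N)
  design = Design.blockList

  design-unique : ∀ i → Unique (design i)
  design-unique = Design.blockList-unique

  design-pairCount : ∀ i x y → x ≢ y → pairCount (design i) x y ≡ 1
  design-pairCount = Design.pairCount≡1

  block∈ : ∀ i {p q} → p ≢ q → block i p q ∈ design i
  block∈ i {p} {q} p≢q = subst₂ (λ p′ q′ → block i p′ q′ ∈ design i) (point-code p) (point-code q)
    (Design.join∈ i (p≢q ∘ to-injective Point↔Fin))

  ∈design : ∀ {i B} → B ∈ design i → ∃₂ λ p q → p ≢ q × B ≡ block i p q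
  ∈design {i} B∈ = let x , y , x≢y , e = Design.∈blockList i B∈ in point x , point y , point-≢ x≢y , e

  through : ∀ {i B p q} → B ∈ design i → p ≢ q → code p ∈ᵇ B ≡ true → code q ∈ᵇ B ≡ true → B ≡ block i p q
  through {i} {p = p} {q} B∈ p≢q p∈ q∈ = trans
    (Design.through i B∈ (p≢q ∘ to-injective Point↔Fin) p∈ q∈)
    (cong₂ (block i) (point-code p) (point-code q))

  members : ∀ {ps} (B : Block N) → Unique ps →
    (∀ {p} → p ∈ ps → code p ∈ᵇ B ≡ true) → (∀ p → code p ∈ᵇ B ≡ true → p ∈ ps) → ∣ B ∣ ≡ length (map code ps)
  members {ps} B u f g = size B (Unique.map⁺ (to-injective Point↔Fin) u)
    (λ h → let p , p∈ , e = ∈-map⁻ code h in trans (cong (_∈ᵇ B) e) (f p∈))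
    (λ k e → subst (_∈ map code ps) (code-point k)
      (∈-map⁺ code (g (point k) (trans (cong (_∈ᵇ B) (code-point k)) e))))

  size-parallel : ∀ {i p q} → p ∥[ proj₁ i ] q → ∣ block i p q ∣ ≡ 6
  size-parallel {i@(r , _)} {p@(x , _)} {q} h =
    members {cartesianProduct (x ∷ y ∷ third r x y ∷ []) (false ∷ true ∷ [])} (block i p q)
      (Unique.cartesianProduct⁺
        ((x≢y ∷ (third≢ˡ r x≢y ∘ sym) ∷ []) ∷ ((third≢ʳ r x≢y ∘ sym) ∷ []) ∷ [] ∷ [])
        (((λ ()) ∷ []) ∷ [] ∷ []))
      (λ u∈ → ∈block-code⁺ {i} {p} {q} (inj₁ (h , into (proj₁ (∈-cartesianProduct⁻ (x ∷ y ∷ third r x y ∷ []) (false ∷ true ∷ []) u∈)))))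
      (λ u e → ∈-cartesianProduct⁺ (out (∈block-code⁻ {i} {p} {q} e)) (bool (proj₂ u)))
    where
    -- `q` may lie over the same point as `p`, so a second point of the class has to come from
    -- elsewhere.
    y = proj₁ (∥-other r x)
    x≢y = proj₁ (proj₂ (∥-other r x))
    x∥y = proj₂ (proj₂ (∥-other r x))
    bool : ∀ b → b ∈ (false ∷ true ∷ [])
    bool false = here refl
    bool true = there (here refl)
    into : ∀ {z} → z ∈ (x ∷ y ∷ third r x y ∷ []) → Parallel r x z
    into (here refl) = ∥-refl r x
    into (there (here refl)) = x∥y
    into (there (there (here refl))) = ∥-third x∥y
    out : ∀ {u} → Mem i p q u → proj₁ u ∈ (x ∷ y ∷ third r x y ∷ [])
    out (inj₂ (¬h , _)) = contradiction h ¬h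
    out (inj₁ (_ , hu)) with class-cases x≢y x∥y hu
    ... | inj₁ e = here e
    ... | inj₂ (inj₁ e) = there (here e)
    ... | inj₂ (inj₂ e) = there (there (here e))

  triangle-distinct : ∀ {i p q s} → Triangle i p q s → p ≢ q × p ≢ s × q ≢ s
  triangle-distinct {r , _} {x , _} {y , _} (△ ¬h refl) =
    x≢y ∘ cong proj₁ , third≢ˡ r x≢y ∘ sym ∘ cong proj₁ , third≢ʳ r x≢y ∘ sym ∘ cong proj₁
    where
    x≢y : x ≢ y
    x≢y refl = ¬h (∥-refl r x)

  size-triangle : ∀ {i p q} → ¬ p ∥[ proj₁ i ] q → ∣ block i p q ∣ ≡ 3
  size-triangle {i} {p} {q} ¬h = let p≢q , p≢s , q≢s = triangle-distinct {i} {p} {q} (△ ¬h refl) in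
    members {p ∷ q ∷ third² i p q ∷ []} (block i p q)
      ((p≢q ∷ p≢s ∷ []) ∷ (q≢s ∷ []) ∷ [] ∷ [])
      (λ u∈ → ∈block-code⁺ {i} {p} {q} (inj₂ (¬h , into u∈)))
      (λ u e → out (∈block-code⁻ {i} {p} {q} e))
    where
    into : ∀ {u} → u ∈ (p ∷ q ∷ third² i p q ∷ []) → u ≡ p ⊎ u ≡ q ⊎ u ≡ third² i p q
    into (here e) = inj₁ e
    into (there (here e)) = inj₂ (inj₁ e)
    into (there (there (here e))) = inj₂ (inj₂ e)
    out : ∀ {u} → Mem i p q u → u ∈ (p ∷ q ∷ third² i p q ∷ [])
    out (inj₁ (h , _)) = contradiction h ¬h
    out (inj₂ (_ , inj₁ e)) = here e
    out (inj₂ (_ , inj₂ (inj₁ e))) = there (here e)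
    out (inj₂ (_ , inj₂ (inj₂ e))) = there (there (here e))

  -- The multiplicity |B| - 2 in explicit form: a 6-block lies in the four designs with index in
  -- {`r₁`, `r₂`} × `Bool`, a triple in one design.
  data Occurrences (B : Block N) : Set where
    six : ∀ r₁ r₂ → r₁ ≢ r₂ → ∣ B ∣ ≡ 6 → (∀ ε → B ∈ design (r₁ , ε)) → (∀ ε → B ∈ design (r₂ , ε)) →
      (∀ r ε → B ∈ design (r , ε) → r ≡ r₁ ⊎ r ≡ r₂) → Occurrences B
    three : ∀ i → ∣ B ∣ ≡ 3 → B ∈ design i → (∀ j → B ∈ design j → j ≡ i) → Occurrences B

  occurrences : ∀ {i B} → B ∈ design i → Occurrences B
  occurrences {i@(r , _)} B∈ with ∈design B∈
  ... | p@(x , _) , q , p≢q , refl with parallel? r x (proj₁ q)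
  ... | no ¬h = three i (size-triangle {i} {p} {q} ¬h) B∈ only
    where
    only : ∀ j → block i p q ∈ design j → j ≡ i
    only j B∈′ with same-kind {j} {i} {p} {q} {third² i p q}
                      (proj₁ (proj₂ (triangle-distinct {i} {p} {q} (△ ¬h refl))))
                      (proj₂ (proj₂ (triangle-distinct {i} {p} {q} (△ ¬h refl))))
                      (∈block-code⁻ {j} {p} {q} (subst (λ C → code (third² i p q) ∈ᵇ C ≡ true)
                        (through {j} B∈′ p≢q (∈block-code⁺ {i} {p} {q} (Mem-left i p q)) (∈block-code⁺ {i} {p} {q} (Mem-right i p q)))
                        (∈block-code⁺ {i} {p} {q} (triangle-vertex {i} {p} {q} (△ ¬h refl)))))
                      (triangle-vertex {i} {p} {q} (△ ¬h refl))
    ... | inj₁ (_ , h , _) = contradiction h ¬h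
    ... | inj₂ (e , _) = e
  ... | yes h with ∥-other r x
  ... | y , x≢y , x∥y with exactly-two x≢y
  ... | r₁ , r₂ , r₁≢r₂ , h₁ , h₂ , only =
    six r₁ r₂ r₁≢r₂ (size-parallel {i} {p} {q} h) (λ ε → contains r₁ ε h₁) (λ ε → contains r₂ ε h₂)
      (λ r′ ε B∈′ → only r′ (parallel′ r′ ε B∈′))
    where
    xy≢ : ∀ {b c} → (x , b) ≢ (y , c)
    xy≢ e = x≢y (cong proj₁ e)
    contains : ∀ r′ ε → Parallel r′ x y → block i p q ∈ design (r′ , ε)
    contains r′ ε h′ = subst (_∈ design (r′ , ε))
      (block-≡ (r′ , ε) (x , false) (y , false) i p q
        (λ { u (inj₁ (_ , hu)) → inj₁ (h , class-unique x≢y h′ x∥y hu)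
           ; u (inj₂ (¬h′ , _)) → contradiction h′ ¬h′ })
        (λ { u (inj₁ (_ , hu)) → inj₁ (h′ , class-unique x≢y x∥y h′ hu)
           ; u (inj₂ (¬h′ , _)) → contradiction h ¬h′ }))
      (block∈ (r′ , ε) (xy≢ {false} {false}))
    -- The two points over `x` are parallel in every system, so the block through them in the design
    -- (`r′`, `ε`) is the whole doubled `r′`-class of `x`; that it contains `y` is the claim.
    parallel′ : ∀ r′ ε → block i p q ∈ design (r′ , ε) → Parallel r′ x y
    parallel′ r′ ε B∈′ with ∈block-code⁻ {r′ , ε} {x , false} {x , true} {y , false}
      (subst (λ C → code (y , false) ∈ᵇ C ≡ true)
        (through B∈′ (λ ()) (∈block-code⁺ {i} {p} {q} (inj₁ (h , ∥-refl r x))) (∈block-code⁺ {i} {p} {q} (inj₁ (h , ∥-refl r x))))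
        (∈block-code⁺ {i} {p} {q} (inj₁ (h , x∥y))))
    ... | inj₁ (_ , hy) = hy
    ... | inj₂ (¬h′ , _) = contradiction (∥-refl r′ x) ¬h′

-- The points ∞₁, ∞₂ and the Eulerian digraphs.

module GLSConstruction {X R : Set} {m : ℕ} (L : LRDesign X R m) where
  open LRDesign L
  open Doubling L

  K : ℕ → Set
  K = K36 ∪ᴷ (K3 ∪ᴷ K6)

  InDesign : Block N → Set
  InDesign B = ∃ λ i → B ∈ design i

  block-size : ∀ {i B} → B ∈ design i → K36 ∣ B ∣
  block-size {i} B∈ with ∈design B∈
  ... | p , q , _ , refl with parallel? (proj₁ i) (proj₁ p) (proj₁ q)
  ... | yes h = inj₂ (size-parallel {i} {p} {q} h)
  ... | no ¬h = inj₁ (size-triangle {i} {p} {q} ¬h)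

  throughᶠ : ∀ {i B} {x y : Fin N} → B ∈ design i → x ≢ y → x ∈ᵇ B ≡ true → y ∈ᵇ B ≡ true → B ≡ block i (point x) (point y)
  throughᶠ {B = B} {x} {y} B∈ x≢y x∈ y∈ = through B∈ (point-≢ x≢y)
    (trans (cong (_∈ᵇ B) (code-point x)) x∈) (trans (cong (_∈ᵇ B) (code-point y)) y∈)

  isS3 : ∀ {U : Block N → Set} → (∀ {B} → U B → InDesign B) → (∀ {B} → InDesign B → U B) → IsS3 0 K N U
  isS3 {U} U⇒ ⇒U = (λ B B∈ → inj₁ (block-size (proj₂ (U⇒ B∈)))) , λ x y z x≢y x≢z y≢z →
    (let i , z∈ = Mem-cover (point-≢ x≢y) (point-≢ x≢z) (point-≢ y≢z)
         p = point x ; q = point y in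
     block i p q , ⇒U (i , block∈ i (point-≢ x≢y)) ,
     ∈block⁺ {i} {p} {q} {x} (Mem-left i p q) , ∈block⁺ {i} {p} {q} {y} (Mem-right i p q) , ∈block⁺ {i} {p} {q} {z} z∈) ,
    (λ B C B∈ C∈ x∈B y∈B z∈B x∈C y∈C z∈C → unique x≢y x≢z y≢z (U⇒ B∈) (U⇒ C∈) x∈B y∈B z∈B x∈C y∈C z∈C)
    where
    unique : ∀ {x y z B C} → x ≢ y → x ≢ z → y ≢ z → InDesign B → InDesign C →
      x ∈ᵇ B ≡ true → y ∈ᵇ B ≡ true → z ∈ᵇ B ≡ true → x ∈ᵇ C ≡ true → y ∈ᵇ C ≡ true → z ∈ᵇ C ≡ true → B ≡ C
    unique {x} {y} {z} x≢y x≢z y≢z (i , B∈) (j , C∈) x∈B y∈B z∈B x∈C y∈C z∈C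
      with throughᶠ {i} B∈ x≢y x∈B y∈B | throughᶠ {j} C∈ x≢y x∈C y∈C
    ... | refl | refl = block-≡ i p q j p q (Mem-unique {i} {j} p≢q p≢u q≢u hB hC) (Mem-unique {j} {i} p≢q p≢u q≢u hC hB)
      where
      p = point x
      q = point y
      p≢q = point-≢ x≢y
      p≢u = point-≢ x≢z
      q≢u = point-≢ y≢z
      hB = ∈block⁻ {i} {p} {q} {z} z∈B
      hC = ∈block⁻ {j} {p} {q} {z} z∈C

  x∞ : X
  x∞ = Inverse.from points zero

  ∞ : Bool → Fin N
  ∞ b = code (x∞ , b)

  ∞₁≢∞₂′ : ∞ false ≢ ∞ true
  ∞₁≢∞₂′ e = contradiction (to-injective Point↔Fin e) (λ ())

  fibre-size : ∀ {i B} → B ∈ design i → ∞ false ∈ᵇ B ≡ true → ∞ true ∈ᵇ B ≡ true → ∣ B ∣ ≡ 6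
  fibre-size {i@(r , _)} B∈ h h′ = trans (cong ∣_∣ (through {i} B∈ (λ ()) h h′))
    (size-parallel {i} {x∞ , false} {x∞ , true} (∥-refl r x∞))

  -- A doubled block contains both points over `x∞` or neither.
  half-fibre-size : ∀ {i B} → B ∈ design i → ∞ false ∈ᵇ B ≢ ∞ true ∈ᵇ B → ∣ B ∣ ≡ 3
  half-fibre-size {i@(r , _)} B∈ ne with ∈design B∈
  ... | p , q , _ , refl with parallel? r (proj₁ p) (proj₁ q)
  ... | no ¬h = size-triangle {i} {p} {q} ¬h
  ... | yes h = contradiction (𝔹.⇔→≡ {z = true} (mk⇔ (move false true) (move true false))) ne
    where
    move : ∀ b c → ∞ b ∈ᵇ block i p q ≡ true → ∞ c ∈ᵇ block i p q ≡ true
    move b c e with ∈block-code⁻ {i} {p} {q} {x∞ , b} e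
    ... | inj₁ (_ , hu) = ∈block-code⁺ {i} {p} {q} {x∞ , c} (inj₁ (h , hu))
    ... | inj₂ (¬h , _) = contradiction h ¬h

  sizeCond : ∀ {Bs} → (∀ {B} → B ∈ Bs → InDesign B) → SizeCond K36 K3 K6 (∞ false) (∞ true) Bs
  sizeCond f B B∈ with f B∈
  ... | i , B∈′ = (λ _ → block-size {i} B∈′) , one , two
    where
    one : nInf (∞ false) (∞ true) B ≡ 1 → ∣ B ∣ ≡ 3
    one with ∞ false ∈ᵇ B in e | ∞ true ∈ᵇ B in e′
    ... | true | true = λ ()
    ... | false | false = λ ()
    ... | true | false = λ _ → half-fibre-size {i} B∈′ (λ h → contradiction (trans (sym e) (trans h e′)) (λ ()))
    ... | false | true = λ _ → half-fibre-size {i} B∈′ (λ h → contradiction (trans (sym e) (trans h e′)) (λ ()))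
    two : nInf (∞ false) (∞ true) B ≡ 2 → ∣ B ∣ ≡ 6
    two with ∞ false ∈ᵇ B in e | ∞ true ∈ᵇ B in e′
    ... | true | true = λ _ → fibre-size {i} B∈′ e e′
    ... | false | false = λ ()
    ... | true | false = λ ()
    ... | false | true = λ ()

  InS∞ : Fin N → Set
  InS∞ = InS (∞ false) (∞ true)

  InS⇒ : ∀ {k} → InS∞ k → proj₁ (point k) ≢ x∞
  InS⇒ {k} (≢₁ , ≢₂) e = split (proj₂ (point k)) refl
    where
    at : ∀ b → proj₂ (point k) ≡ b → k ≡ ∞ b
    at b e′ = trans (sym (code-point k)) (cong code (cong₂ _,_ e e′))
    split : ∀ b → proj₂ (point k) ≢ b
    split false e′ = ≢₁ (at false e′)
    split true  e′ = ≢₂ (at true e′)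

  ⇒InS : ∀ {k} → proj₁ (point k) ≢ x∞ → InS∞ k
  ⇒InS ne = (λ { refl → ne (cong proj₁ (point-code _)) }) , (λ { refl → ne (cong proj₁ (point-code _)) })

  Adj : R → X → X → Set
  Adj r y z = y ≢ x∞ × z ≢ x∞ × ¬ Parallel r y z × third r y z ≡ x∞

  Adj? : ∀ r y z → Dec (Adj r y z)
  Adj? r y z = ¬? (y ≟ x∞) ×-dec ¬? (z ≟ x∞) ×-dec ¬? (parallel? r y z) ×-dec (third r y z ≟ x∞)

  Adj-sym : ∀ {r y z} → Adj r y z → Adj r z y
  Adj-sym {r} {y} {z} (y≢ , z≢ , ¬h , e) = z≢ , y≢ , ¬h ∘ ∥-sym , trans (third-comm r z y) e

  Adj⇒≢ : ∀ {r y z} → Adj r y z → y ≢ z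
  Adj⇒≢ {r} (_ , _ , ¬h , _) refl = ¬h (∥-refl r _)

  -- So `Adj r` is a partial matching of `X`: the partner of `y` is the third point of the block
  -- through `y` and `x∞`.
  Adj-functional : ∀ {r y z} → Adj r y z → z ≡ third r y x∞
  Adj-functional {r} (_ , _ , _ , e) = sym (third-swap r e)

  -- An arbitrary linear order of the points, taken from their numbering. It serves to break the
  -- symmetry between the two ends of an edge, so that the same parity condition read from the other
  -- end gives the complementary set of arcs.
  before : X → X → Bool
  before y z = does (Inverse.to points y Fin.<? Inverse.to points z)

  before-flip : ∀ {y z} → y ≢ z → before z y ≡ not (before y z)
  before-flip {y} {z} y≢z with Fin.<-cmp (Inverse.to points y) (Inverse.to points z)
  ... | tri< a _ c = trans (dec-false (_ Fin.<? _) c) (cong not (sym (dec-true (_ Fin.<? _) a)))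
  ... | tri≈ _ b _ = contradiction (to-injective points b) y≢z
  ... | tri> a _ c = trans (dec-true (_ Fin.<? _) c) (cong not (sym (dec-false (_ Fin.<? _) a)))

  -- The four edges {(y,b),(z,c)} over an edge {y,z} form a 4-cycle, which is directed one way for ε = 0 and
  -- the other way for ε = 1.
  Arc : Index → Point → Point → Set
  Arc (r , ε) (y , b) (z , c) = Adj r y z × b xor c ≡ before y z xor ε

  Arc? : ∀ i p q → Dec (Arc i p q)
  Arc? (r , ε) (y , b) (z , c) = Adj? r y z ×-dec (b xor c 𝔹.≟ before y z xor ε)

  Arc-total : ∀ i p q → Adj (proj₁ i) (proj₁ p) (proj₁ q) → Arc i p q ⊎ Arc i q p
  Arc-total (r , ε) (y , b) (z , c) adj with b xor c 𝔹.≟ before y z xor ε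
  ... | yes e = inj₁ (adj , e)
  ... | no ne = inj₂ (Adj-sym adj , trans (𝔹.xor-comm c b) (trans (𝔹.¬-not ne) (trans
    (𝔹.not-distribˡ-xor (before y z) ε) (cong (_xor ε) (sym (before-flip (Adj⇒≢ adj)))))))

  apex : Index → Point → Point → Fin N
  apex (_ , ε) (_ , b) (_ , c) = ∞ ((b xor c) xor ε)

  apex-triple : ∀ {i x y} → Adj (proj₁ i) (proj₁ (point x)) (proj₁ (point y)) →
    triple (apex i (point x) (point y)) x y ∈ design i
  apex-triple {i} {x} {y} adj@(_ , _ , ¬h , e) = subst (_∈ design i) (block-ext from to) (block∈ i p≢q)
    where
    p = point x
    q = point y
    p≢q : p ≢ q
    p≢q e′ = Adj⇒≢ adj (cong proj₁ e′)
    c = apex i p q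
    s≡ : code (third² i p q) ≡ c
    s≡ = cong (λ z → code (z , proj₂ (third² i p q))) e
    code≡ : ∀ {k l} → point k ≡ point l → k ≡ l
    code≡ = from-injective Point↔Fin
    from : ∀ k → k ∈ᵇ block i p q ≡ true → k ∈ᵇ triple c x y ≡ true
    from k k∈ with ∈block⁻ {i} {p} {q} {k} k∈
    ... | inj₁ (h , _) = contradiction h ¬h
    ... | inj₂ (_ , inj₁ e′) = ∈-triple⁺ {a = c} {x} {y} (inj₂ (inj₁ (code≡ e′)))
    ... | inj₂ (_ , inj₂ (inj₁ e′)) = ∈-triple⁺ {a = c} {x} {y} (inj₂ (inj₂ (code≡ e′)))
    ... | inj₂ (_ , inj₂ (inj₂ e′)) =
      ∈-triple⁺ {a = c} {x} {y} (inj₁ (trans (sym (code-point k)) (trans (cong code e′) s≡)))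
    to : ∀ k → k ∈ᵇ triple c x y ≡ true → k ∈ᵇ block i p q ≡ true
    to k k∈ with ∈-triple⁻ {a = c} {x} {y} k∈
    ... | inj₁ refl = subst (λ z → z ∈ᵇ block i p q ≡ true) s≡
          (∈block-code⁺ {i} {p} {q} (triangle-vertex {i} {p} {q} (△ ¬h refl)))
    ... | inj₂ (inj₁ refl) = ∈block⁺ {i} {p} {q} {x} (Mem-left i p q)
    ... | inj₂ (inj₂ refl) = ∈block⁺ {i} {p} {q} {y} (Mem-right i p q)

  triple-adj : ∀ {i b x y} → InS∞ x → InS∞ y → x ≢ y → triple (∞ b) x y ∈ design i →
    Adj (proj₁ i) (proj₁ (point x)) (proj₁ (point y))
  triple-adj {i@(r , ε)} {b} {x} {y} x∈S y∈S x≢y T∈ = y≢ , z≢ , ¬h , third≡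
    where
    T = triple (∞ b) x y
    p = point x
    q = point y
    y≢ = InS⇒ x∈S
    z≢ = InS⇒ y∈S
    T≡ : T ≡ block i p q
    T≡ = throughᶠ T∈ x≢y (∈-triple⁺ {a = ∞ b} {x} {y} (inj₂ (inj₁ refl))) (∈-triple⁺ {a = ∞ b} {x} {y} (inj₂ (inj₂ refl)))
    ∞∈ : Mem i p q (x∞ , b)
    ∞∈ = ∈block-code⁻ {i} {p} {q} (subst (λ B → ∞ b ∈ᵇ B ≡ true) T≡ (∈-triple⁺ {a = ∞ b} {x} {y} (inj₁ refl)))
    -- A parallel block meeting the fibre of `x∞` contains all of it, whereas the triple contains
    -- just one of ∞₁, ∞₂. Hence its block is non-parallel.
    ¬∞not∈ : ¬ Mem i p q (x∞ , not b)
    ¬∞not∈ h with ∈-triple⁻ {a = ∞ b} {x} {y} (subst (λ B → ∞ (not b) ∈ᵇ B ≡ true) (sym T≡) (∈block-code⁺ {i} {p} {q} h))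
    ... | inj₁ e = 𝔹.not-¬ refl (sym (cong proj₂ (to-injective Point↔Fin e)))
    ... | inj₂ (inj₁ e) = y≢ (trans (cong (proj₁ ∘ point) (sym e)) (cong proj₁ (point-code _)))
    ... | inj₂ (inj₂ e) = z≢ (trans (cong (proj₁ ∘ point) (sym e)) (cong proj₁ (point-code _)))
    ¬h : ¬ p ∥[ r ] q
    ¬h h with ∞∈
    ... | inj₁ (_ , h′) = ¬∞not∈ (inj₁ (h , h′))
    ... | inj₂ (¬h′ , _) = ¬h′ h
    third≡ : third r (proj₁ p) (proj₁ q) ≡ x∞
    third≡ with ∞∈
    ... | inj₁ (h , _) = contradiction h ¬h
    ... | inj₂ (_ , inj₁ e) = contradiction (sym (cong proj₁ e)) y≢
    ... | inj₂ (_ , inj₂ (inj₁ e)) = contradiction (sym (cong proj₁ e)) z≢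
    ... | inj₂ (_ , inj₂ (inj₂ e)) = sym (cong proj₁ e)

  either : ∀ b {x y} {Bs : List (Block N)} → triple (∞ b) x y ∈ Bs → triple (∞ false) x y ∈ Bs ⊎ triple (∞ true) x y ∈ Bs
  either false = inj₁
  either true = inj₂

  Uncovered : X → X → Set
  Uncovered y z = ∀ r → Parallel r x∞ y → ¬ Parallel r x∞ z

  uncovered : ∀ {U : Block N → Set} → (∀ {B} → InDesign B → U B) → ∀ {x y} →
    ¬ (∃ λ B → U B × (∞ false ∈ᵇ B ≡ true) × (∞ true ∈ᵇ B ≡ true) × (x ∈ᵇ B ≡ true) × (y ∈ᵇ B ≡ true)) →
    Uncovered (proj₁ (point x)) (proj₁ (point y))
  uncovered ⇒U {x} {y} ¬∃ r hy hz = ¬∃ (block i p q , ⇒U (i , block∈ i (λ ())) ,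
    ∈block-code⁺ {i} {p} {q} (Mem-left i p q) , ∈block-code⁺ {i} {p} {q} (Mem-right i p q) ,
    ∈block⁺ {i} {p} {q} {x} (inj₁ (∥-refl r x∞ , hy)) , ∈block⁺ {i} {p} {q} {y} (inj₁ (∥-refl r x∞ , hz)))
    where
    i = r , false
    p = x∞ , false
    q = x∞ , true

  -- `cover` puts `y`, `z`, `x∞` in a block of some system. Were that block parallel, `y` and `z`
  -- would lie in the class of `x∞`, against `Uncovered`. For a non-parallel block
  -- `third-determines` leaves one index.
  adj-unique : ∀ {y z} → y ≢ x∞ → z ≢ x∞ → Uncovered y z → ∃ λ r → Adj r y z × (∀ r′ → Adj r′ y z → r′ ≡ r)
  adj-unique {y} {z} y≢ z≢ unc = r , (y≢ , z≢ , ¬∥ , e) ,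
    λ { r′ (_ , _ , ¬h , e′) → [ id , (λ (h , _) → contradiction h ¬h) ]′ (third-determines y≢z (trans e′ (sym e))) }
    where
    y≢z : y ≢ z
    y≢z refl = let r , h = link x∞ y in unc r h h
    r = proj₁ (cover y≢z y≢ z≢)
    e = proj₂ (cover y≢z y≢ z≢)
    ¬∥ : ¬ Parallel r y z
    ¬∥ h = let h′ = ∥-sym (subst (Parallel r y) e (∥-third h)) in unc r h′ (∥-trans h′ h)

  -- λ = 1: one design for each (r , ε).

  private
    index : Fin (m * 2) → Index
    index = Inverse.from Index↔Fin

    code-index : Index → Fin (m * 2)
    code-index = Inverse.to Index↔Fin

    index-code : ∀ i → index (code-index i) ≡ i
    index-code = Inverse.strictlyInverseʳ Index↔Fin

    design₁ : Fin (m * 2) → List (Block N)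
    design₁ k = design (index k)

    U₁⇒ : ∀ {B} → InU design₁ B → InDesign B
    U₁⇒ (k , h) = index k , h

    ⇒U₁ : ∀ {B} → InDesign B → InU design₁ B
    ⇒U₁ {B} (i , h) = code-index i , subst (λ j → B ∈ design j) (sym (index-code i)) h

    total₁ : ∀ B → InU design₁ B → totalOcc design₁ B ≡ ∣ B ∣ ∸ 2
    total₁ B B∈ with occurrences (proj₂ (U₁⇒ B∈))
    ... | three i size≡ i∈ only = trans
      (totalOcc-unique design₁ B (λ k → design-unique (index k)) {code-index i ∷ []} ([] ∷ [])
        (λ { (here refl) → subst (λ j → B ∈ design j) (sym (index-code i)) i∈ })
        (λ k h → here (trans (sym (Inverse.strictlyInverseˡ Index↔Fin k)) (cong code-index (only _ h)))))
      (cong (_∸ 2) (sym size≡))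
    ... | six r₁ r₂ r₁≢r₂ size≡ ∈₁ ∈₂ only = trans
      (totalOcc-unique design₁ B (λ k → design-unique (index k))
        {map code-index (cartesianProduct (r₁ ∷ r₂ ∷ []) (false ∷ true ∷ []))}
        (Unique.map⁺ (to-injective Index↔Fin) (Unique.cartesianProduct⁺
          ((r₁≢r₂ ∷ []) ∷ [] ∷ []) (((λ ()) ∷ []) ∷ [] ∷ [])))
        (λ h → let i , i∈ , e = ∈-map⁻ code-index h in
           subst (λ j → B ∈ design j) (sym (trans (cong index e) (index-code i)))
             (into (proj₁ (∈-cartesianProduct⁻ (r₁ ∷ r₂ ∷ []) (false ∷ true ∷ []) i∈))))
        (λ k h → subst (_∈ _) (Inverse.strictlyInverseˡ Index↔Fin k)
          (∈-map⁺ code-index (∈-cartesianProduct⁺ (out (only _ _ h)) (bool _)))))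
      (cong (_∸ 2) (sym size≡))
      where
      into : ∀ {r ε} → r ∈ (r₁ ∷ r₂ ∷ []) → B ∈ design (r , ε)
      into (here refl) = ∈₁ _
      into (there (here refl)) = ∈₂ _
      out : ∀ {r} → r ≡ r₁ ⊎ r ≡ r₂ → r ∈ (r₁ ∷ r₂ ∷ [])
      out (inj₁ e) = here e
      out (inj₂ e) = there (here e)
      bool : ∀ b → b ∈ (false ∷ true ∷ [])
      bool false = here refl
      bool true = there (here refl)

    arcs₁ : Fin (m * 2) → Fin N → Fin N → Bool
    arcs₁ k x y = does (Arc? (index k) (point x) (point y))

    arc : ∀ {i x y} → does (Arc? i (point x) (point y)) ≡ true → Arc i (point x) (point y)
    arc {i} {x} {y} = does-true⇒ (Arc? i (point x) (point y))

    -- If the point under `x` has a partner in the matching `Adj r`, the neighbours of `x` are the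
    -- two points over the partner, and the parity condition makes one the successor and the other
    -- the predecessor. Otherwise both degrees are 0.
    degree : ∀ i x → (∃ λ y → countB (λ y → does (Arc? i (point x) (point y))) (allFin N) ≡ y
                            × countB (λ y → does (Arc? i (point y) (point x))) (allFin N) ≡ y)
    degree i@(r , ε) x with Adj? r (proj₁ (point x)) (third r (proj₁ (point x)) x∞)
    ... | no ¬adj = 0 ,
      countB-allFin (λ y → does (Arc? i (point x) (point y))) {[]} [] (λ ())
        (λ y e → contradiction (adj-at (proj₁ (arc {i} {x} {y} e))) ¬adj) ,
      countB-allFin (λ y → does (Arc? i (point y) (point x))) {[]} [] (λ ())
        (λ y e → contradiction (adj-at (Adj-sym (proj₁ (arc {i} {y} {x} e)))) ¬adj)
      where
      adj-at : ∀ {z} → Adj r (proj₁ (point x)) z → Adj r (proj₁ (point x)) (third r (proj₁ (point x)) x∞)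
      adj-at adj = subst (Adj r _) (Adj-functional adj) adj
    ... | yes adj = 1 ,
      countB-allFin (λ y → does (Arc? i (point x) (point y))) {code (z , b xor (before y₀ z xor ε)) ∷ []} ([] ∷ [])
        (λ { (here refl) → dec-true (Arc? i (point x) (point _)) (subst (Arc i (point x)) (sym (point-code _))
               (adj , xor-invol b _)) })
        (λ k e → here (at k _ (Adj-functional (proj₁ (arc {i} {x} {k} e)))
          (λ eq → trans (sym (xor-invol b _)) (cong (b xor_) (trans (proj₂ (arc {i} {x} {k} e)) (cong (λ w → before y₀ w xor ε) eq)))))) ,
      countB-allFin (λ y → does (Arc? i (point y) (point x))) {code (z , b xor (before z y₀ xor ε)) ∷ []} ([] ∷ [])
        (λ { (here refl) → dec-true (Arc? i (point _) (point x)) (subst (λ p → Arc i p (point x)) (sym (point-code _))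
               (Adj-sym adj , trans (𝔹.xor-comm _ b) (xor-invol b _))) })
        (λ k e → here (at k _ (Adj-functional (Adj-sym (proj₁ (arc {i} {k} {x} e))))
          (λ eq → trans (sym (xor-invol b _)) (cong (b xor_) (trans (𝔹.xor-comm b _)
            (trans (proj₂ (arc {i} {k} {x} e)) (cong (λ w → before w y₀ xor ε) eq)))))))
      where
      y₀ = proj₁ (point x)
      b = proj₂ (point x)
      z = third r y₀ x∞
      at : ∀ k c → proj₁ (point k) ≡ z → (proj₁ (point k) ≡ z → proj₂ (point k) ≡ c) → k ≡ code (z , c)
      at k c e f = trans (sym (code-point k)) (cong code (cong₂ _,_ e (f e)))

    good₁ : ∀ k → IsGood (∞ false) (∞ true) (design₁ k) (arcs₁ k)
    good₁ k =
      (λ x y e → let adj@(y≢ , z≢ , _) , _ = arc {i} {x} {y} e in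
        ⇒InS y≢ , ⇒InS z≢ , λ x≡y → Adj⇒≢ adj (cong (proj₁ ∘ point) x≡y)) ,
      (λ x y x∈S y∈S x≢y →
        (λ h → either _ (apex-triple {i} {x} {y} ([ (λ e → proj₁ (arc {i} {x} {y} e)) , (λ e → Adj-sym (proj₁ (arc {i} {y} {x} e))) ]′ h))) ,
        (λ h → map⊎ (dec-true (Arc? i (point x) (point y))) (dec-true (Arc? i (point y) (point x)))
          (Arc-total i (point x) (point y)
            ([ triple-adj {i} {false} x∈S y∈S x≢y , triple-adj {i} {true} x∈S y∈S x≢y ]′ h)))) ,
      (λ x _ → let _ , e , e′ = degree i x in trans e (sym e′))
      where i = index k

    arcCover₁ : ∀ x y → InS∞ x → InS∞ y → Uncovered (proj₁ (point x)) (proj₁ (point y)) →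
      countB (λ k → arcs₁ k x y) (allFin (m * 2)) ≡ 1
    arcCover₁ x y x∈S y∈S unc with adj-unique (InS⇒ x∈S) (InS⇒ y∈S) unc
    ... | r , adj , only = countB-allFin (λ k → arcs₁ k x y) {code-index i ∷ []} ([] ∷ [])
        (λ { (here refl) → dec-true (Arc? (index (code-index i)) p q) (subst (λ j → Arc j p q) (sym (index-code i))
               (adj , sym (trans (cong (b₁ xor_) (𝔹.xor-comm b₀ b₁)) (xor-invol b₁ b₀)))) })
        (λ k e → here (trans (sym (Inverse.strictlyInverseˡ Index↔Fin k)) (cong code-index (determined _ (arc {index k} {x} {y} e)))))
      where
      p = point x
      q = point y
      b₀ = proj₂ p xor proj₂ q
      b₁ = before (proj₁ p) (proj₁ q)
      i : Index
      -- The parity condition `b₀ ≡ b₁ xor ε` has a single solution ε, which selects one of the two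
      -- orientations of the 4-cycle.
      i = r , b₀ xor b₁
      determined : ∀ j → Arc j p q → j ≡ i
      determined (r′ , ε) (adj′ , e) = cong₂ _,_ (only r′ adj′)
        (trans (sym (xor-invol b₁ ε)) (trans (cong (b₁ xor_) (sym e)) (𝔹.xor-comm b₁ b₀)))

  gls₁ : GLS 1 K36 K3 K6 N
  gls₁ = record
    { m = m * 2
    ; blocks = design₁
    ; arcs = arcs₁
    ; ∞₁ = ∞ false
    ; ∞₂ = ∞ true
    ; ∞₁≢∞₂ = ∞₁≢∞₂′
    ; sizes = λ k → sizeCond (index k ,_)
    ; isLS = (λ k → (λ B B∈ → inj₁ (block-size B∈)) , design-pairCount (index k)) , isS3 U₁⇒ ⇒U₁ , total₁
    ; good = good₁
    ; arcCover = λ x y x∈S y∈S _ ¬B → arcCover₁ x y x∈S y∈S (uncovered ⇒U₁ ¬B)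
    }

  -- λ = 2: both parities in one design.

  private
    system : Fin m → R
    system = Inverse.from indices

    design₂ : Fin m → List (Block N)
    design₂ k = design (system k , false) ++ design (system k , true)

    split₂ : ∀ {k B} → B ∈ design₂ k → ∃ λ ε → B ∈ design (system k , ε)
    split₂ {k} B∈ = [ (false ,_) , (true ,_) ]′ (∈-++⁻ (design (system k , false)) B∈)

    merge₂ : ∀ {k B} ε → B ∈ design (system k , ε) → B ∈ design₂ k
    merge₂ {k} false B∈ = ∈-++⁺ˡ B∈
    merge₂ {k} true B∈ = ∈-++⁺ʳ (design (system k , false)) B∈

    U₂⇒ : ∀ {B} → InU design₂ B → InDesign B
    U₂⇒ (k , h) = let ε , h′ = split₂ h in _ , h′

    ⇒U₂ : ∀ {B} → InDesign B → InU design₂ B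
    ⇒U₂ {B} ((r , ε) , h) = Inverse.to indices r ,
      merge₂ ε (subst (λ r → B ∈ design (r , ε)) (sym (Inverse.strictlyInverseʳ indices r)) h)

    half : Bool → Fin m → List (Block N)
    half ε k = design (system k , ε)

    total₂-split : ∀ B → totalOcc design₂ B ≡ totalOcc (half false) B + totalOcc (half true) B
    total₂-split B = trans
      (cong sum (map-cong (λ k → countB-++ (eqB B) (half false k) (half true k)) (allFin m)))
      (sum-map-+ (λ k → occ B (half false k)) (λ k → occ B (half true k)) (allFin m))

    half-total : ∀ ε B {rs} → Unique rs → (∀ {r} → r ∈ rs → B ∈ design (r , ε)) →
      (∀ r → B ∈ design (r , ε) → r ∈ rs) → totalOcc (half ε) B ≡ length (map (Inverse.to indices) rs)
    half-total ε B {rs} u f g = totalOcc-unique (half ε) B (λ k → design-unique (system k , ε))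
      (Unique.map⁺ (to-injective indices) u)
      (λ h → let r , r∈ , e = ∈-map⁻ (Inverse.to indices) h in
        subst (λ r → B ∈ design (r , ε)) (sym (trans (cong system e) (Inverse.strictlyInverseʳ indices r))) (f r∈))
      (λ k h → subst (_∈ _) (Inverse.strictlyInverseˡ indices k) (∈-map⁺ (Inverse.to indices) (g _ h)))

    total₂ : ∀ B → InU design₂ B → totalOcc design₂ B ≡ ∣ B ∣ ∸ 2
    total₂ B B∈ with occurrences (proj₂ (U₂⇒ B∈))
    ... | six r₁ r₂ r₁≢r₂ size≡ ∈₁ ∈₂ only =
      trans (total₂-split B) (trans (cong₂ _+_ (two false) (two true)) (cong (_∸ 2) (sym size≡)))
      where
      two : ∀ ε → totalOcc (half ε) B ≡ 2
      two ε = half-total ε B {r₁ ∷ r₂ ∷ []} ((r₁≢r₂ ∷ []) ∷ [] ∷ [])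
        (λ { (here refl) → ∈₁ ε ; (there (here refl)) → ∈₂ ε })
        (λ r h → [ here , (λ e → there (here e)) ]′ (only r ε h))
    ... | three (r , ε) size≡ i∈ only = trans (total₂-split B) (trans (sum≡ ε i∈ only) (cong (_∸ 2) (sym size≡)))
      where
      one : ∀ ε → B ∈ design (r , ε) → (∀ j → B ∈ design j → j ≡ (r , ε)) → totalOcc (half ε) B ≡ 1
      one ε i∈ only = half-total ε B {r ∷ []} ([] ∷ []) (λ { (here refl) → i∈ }) (λ r′ h → here (cong proj₁ (only _ h)))
      none : ∀ ε ε′ → ε′ ≢ ε → (∀ j → B ∈ design j → j ≡ (r , ε)) → totalOcc (half ε′) B ≡ 0
      none ε ε′ ne only = half-total ε′ B {[]} [] (λ ()) (λ r′ h → contradiction (cong proj₂ (only _ h)) ne)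
      sum≡ : ∀ ε → B ∈ design (r , ε) → (∀ j → B ∈ design j → j ≡ (r , ε)) →
        totalOcc (half false) B + totalOcc (half true) B ≡ 1
      sum≡ false i∈ only = cong₂ _+_ (one false i∈ only) (none false true (λ ()) only)
      sum≡ true i∈ only = cong₂ _+_ (none true false (λ ()) only) (one true i∈ only)

    -- With both parities present, each of the four edges over a matched pair forms blocks with ∞₁
    -- and with ∞₂. Both directions of every edge are taken: the digraph is symmetric, hence
    -- Eulerian, and since no ε is left in the index each arc is still used once.
    arcs₂ : Fin m → Fin N → Fin N → Bool
    arcs₂ k x y = does (Adj? (system k) (proj₁ (point x)) (proj₁ (point y)))

    adj₂ : ∀ k {x y} → arcs₂ k x y ≡ true → Adj (system k) (proj₁ (point x)) (proj₁ (point y))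
    adj₂ k {x} {y} = does-true⇒ (Adj? (system k) (proj₁ (point x)) (proj₁ (point y)))

    good₂ : ∀ k → IsGood (∞ false) (∞ true) (design₂ k) (arcs₂ k)
    good₂ k =
      (λ x y e → let adj@(y≢ , z≢ , _) = adj₂ k {x} {y} e in
        ⇒InS y≢ , ⇒InS z≢ , λ x≡y → Adj⇒≢ adj (cong (proj₁ ∘ point) x≡y)) ,
      (λ x y x∈S y∈S x≢y →
        (λ h → either _ (merge₂ false (apex-triple {system k , false} {x} {y} ([ adj₂ k , Adj-sym ∘ adj₂ k ]′ h)))) ,
        (λ h → inj₁ (dec-true (Adj? (system k) (proj₁ (point x)) (proj₁ (point y)))
          ([ back x∈S y∈S x≢y false , back x∈S y∈S x≢y true ]′ h)))) ,
      (λ x _ → countB-cong (λ y → does-⇔ (mk⇔ Adj-sym Adj-sym) (Adj? (system k) (proj₁ (point x)) (proj₁ (point y)))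
        (Adj? (system k) (proj₁ (point y)) (proj₁ (point x)))) (allFin N))
      where
      back : ∀ {x y} → InS∞ x → InS∞ y → x ≢ y → ∀ b → triple (∞ b) x y ∈ design₂ k →
        Adj (system k) (proj₁ (point x)) (proj₁ (point y))
      back x∈S y∈S x≢y b T∈ = let ε , T∈′ = split₂ T∈ in triple-adj {system k , ε} {b} x∈S y∈S x≢y T∈′

    arcCover₂ : ∀ x y → InS∞ x → InS∞ y → Uncovered (proj₁ (point x)) (proj₁ (point y)) →
      countB (λ k → arcs₂ k x y) (allFin m) ≡ 1
    arcCover₂ x y x∈S y∈S unc with adj-unique (InS⇒ x∈S) (InS⇒ y∈S) unc
    ... | r , adj , only = countB-allFin (λ k → arcs₂ k x y) {Inverse.to indices r ∷ []} ([] ∷ [])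
        (λ { (here refl) → dec-true (Adj? (system (Inverse.to indices r)) _ _)
               (subst (λ r → Adj r _ _) (sym (Inverse.strictlyInverseʳ indices r)) adj) })
        (λ k e → here (trans (sym (Inverse.strictlyInverseˡ indices k))
          (cong (Inverse.to indices) (only _ (adj₂ k {x} {y} e)))))

    -- A block of size at least 4 is a doubled class. It does not depend on ε, so each of the two
    -- halves contains it once.
    star : IsLSStar 2 N m design₂
    star k B B∈ 4≤ = trans (countB-++ (eqB B) (half false k) (half true k))
      (cong₂ _+_ (occ≡1 false) (occ≡1 true))
      where
      everywhere : ∀ ε → B ∈ design (system k , ε)
      everywhere ε with occurrences (proj₂ (split₂ B∈))
      ... | three _ size≡ _ _ = contradiction (subst (4 ≤_) size≡ 4≤) (λ { (s≤s (s≤s (s≤s ()))) })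
      ... | six r₁ r₂ _ _ ∈₁ ∈₂ only with only _ _ (proj₂ (split₂ B∈))
      ... | inj₁ e = subst (λ r → B ∈ design (r , ε)) (sym e) (∈₁ ε)
      ... | inj₂ e = subst (λ r → B ∈ design (r , ε)) (sym e) (∈₂ ε)
      occ≡1 : ∀ ε → occ B (half ε k) ≡ 1
      occ≡1 ε = occ-unique-∈ (design-unique (system k , ε)) (everywhere ε)

  gls₂ : Σ (GLS 2 K36 K3 K6 N) IsGLSStar
  gls₂ = record
    { m = m
    ; blocks = design₂
    ; arcs = arcs₂
    ; ∞₁ = ∞ false
    ; ∞₂ = ∞ true
    ; ∞₁≢∞₂ = ∞₁≢∞₂′
    ; sizes = λ k → sizeCond (λ B∈ → _ , proj₂ (split₂ B∈))
    ; isLS = (λ k → (λ B B∈ → inj₁ (block-size (proj₂ (split₂ B∈)))) ,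
                    (λ x y x≢y → trans (countB-++ _ (half false k) (half true k))
                      (cong₂ _+_ (design-pairCount (system k , false) x y x≢y) (design-pairCount (system k , true) x y x≢y)))) ,
             isS3 U₂⇒ ⇒U₂ , total₂
    ; good = good₂
    ; arcCover = λ x y x∈S y∈S _ ¬B → arcCover₂ x y x∈S y∈S (uncovered ⇒U₂ ¬B)
    } , star

-- Arithmetic modulo q and coordinate vectors.

Vec↔Fin : ∀ q n → Vec (Fin q) n ↔ Fin (q ^ n)
Vec↔Fin q zero = mk↔ₛ′ (λ _ → zero) (λ _ → []) (λ { zero → refl ; (suc ()) }) (λ { [] → refl })
Vec↔Fin q (suc n) = ↔-trans uncons↔ (↔-trans (↔-id (Fin q) ×-↔ Vec↔Fin q n) (↔-sym Fin.*↔×))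
  where
  uncons↔ : Vec (Fin q) (suc n) ↔ (Fin q × Vec (Fin q) n)
  uncons↔ = mk↔ₛ′ (λ { (a ∷ w) → a , w }) (λ { (a , w) → a ∷ w }) (λ _ → refl) (λ { (_ ∷ _) → refl })

module Residues (q : ℕ) .{{_ : NonZero q}} where

  infixl 6 _⊕_
  infixl 7 _⊗_
  infix 8 ⊖_

  0# : Fin q
  0# = 0 mod q

  _⊕_ _⊗_ : Fin q → Fin q → Fin q
  a ⊕ b = (toℕ a + toℕ b) mod q
  a ⊗ b = (toℕ a * toℕ b) mod q

  ⊖_ : Fin q → Fin q
  ⊖ a = (q ∸ toℕ a) mod q

  toℕ-mod : ∀ m → toℕ (m mod q) ≡ m % q
  toℕ-mod m = Fin.toℕ-fromℕ< (m%n<n m q)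

  toℕ-% : ∀ (a : Fin q) → toℕ a % q ≡ toℕ a
  toℕ-% a = m<n⇒m%n≡m (Fin.toℕ<n a)

  mod-cong : ∀ {m n} → m % q ≡ n % q → m mod q ≡ n mod q
  mod-cong {m} {n} e = Fin.toℕ-injective (trans (toℕ-mod m) (trans e (sym (toℕ-mod n))))

  mod-toℕ : ∀ a → toℕ a mod q ≡ a
  mod-toℕ a = Fin.toℕ-injective (trans (toℕ-mod (toℕ a)) (toℕ-% a))

  mod-⊕ : ∀ m n → (m mod q) ⊕ (n mod q) ≡ (m + n) mod q
  mod-⊕ m n = mod-cong (trans (cong₂ (λ i j → (i + j) % q) (toℕ-mod m) (toℕ-mod n)) (sym (%-distribˡ-+ m n q)))

  mod-⊗ : ∀ m n → (m mod q) ⊗ (n mod q) ≡ (m * n) mod q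
  mod-⊗ m n = mod-cong (trans (cong₂ (λ i j → (i * j) % q) (toℕ-mod m) (toℕ-mod n)) (sym (%-distribˡ-* m n q)))

  ⊕-comm : ∀ a b → a ⊕ b ≡ b ⊕ a
  ⊕-comm a b = cong (_mod q) (ℕ.+-comm (toℕ a) (toℕ b))

  ⊕-assoc : ∀ a b c → (a ⊕ b) ⊕ c ≡ a ⊕ (b ⊕ c)
  ⊕-assoc a b c = begin
    (a ⊕ b) ⊕ c                                  ≡⟨ cong ((a ⊕ b) ⊕_) (sym (mod-toℕ c)) ⟩
    (a ⊕ b) ⊕ (toℕ c mod q)                      ≡⟨ mod-⊕ (toℕ a + toℕ b) (toℕ c) ⟩
    (toℕ a + toℕ b + toℕ c) mod q                ≡⟨ cong (_mod q) (ℕ.+-assoc (toℕ a) (toℕ b) (toℕ c)) ⟩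
    (toℕ a + (toℕ b + toℕ c)) mod q              ≡⟨ sym (mod-⊕ (toℕ a) (toℕ b + toℕ c)) ⟩
    (toℕ a mod q) ⊕ (b ⊕ c)                      ≡⟨ cong (_⊕ (b ⊕ c)) (mod-toℕ a) ⟩
    a ⊕ (b ⊕ c)                                  ∎
    where open ≡-Reasoning

  ⊕-identityˡ : ∀ a → 0# ⊕ a ≡ a
  ⊕-identityˡ a = begin
    0# ⊕ a             ≡⟨ cong (0# ⊕_) (sym (mod-toℕ a)) ⟩
    0# ⊕ (toℕ a mod q) ≡⟨ mod-⊕ 0 (toℕ a) ⟩
    toℕ a mod q        ≡⟨ mod-toℕ a ⟩
    a                  ∎
    where open ≡-Reasoning

  ⊖-inverseˡ : ∀ a → ⊖ a ⊕ a ≡ 0#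
  ⊖-inverseˡ a = begin
    ⊖ a ⊕ a                        ≡⟨ cong (⊖ a ⊕_) (sym (mod-toℕ a)) ⟩
    ⊖ a ⊕ (toℕ a mod q)            ≡⟨ mod-⊕ (q ∸ toℕ a) (toℕ a) ⟩
    (q ∸ toℕ a + toℕ a) mod q      ≡⟨ cong (_mod q) (ℕ.m∸n+n≡m (ℕ.<⇒≤ (Fin.toℕ<n a))) ⟩
    q mod q                        ≡⟨ mod-cong (trans (n%n≡0 q) (sym (m*n%n≡0 0 q))) ⟩
    0#                             ∎
    where open ≡-Reasoning

  ⊗-distribʳ-⊕ : ∀ c a b → (a ⊕ b) ⊗ c ≡ a ⊗ c ⊕ b ⊗ c
  ⊗-distribʳ-⊕ c a b = begin
    (a ⊕ b) ⊗ c                                    ≡⟨ cong ((a ⊕ b) ⊗_) (sym (mod-toℕ c)) ⟩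
    (a ⊕ b) ⊗ (toℕ c mod q)                        ≡⟨ mod-⊗ (toℕ a + toℕ b) (toℕ c) ⟩
    ((toℕ a + toℕ b) * toℕ c) mod q                ≡⟨ cong (_mod q) (ℕ.*-distribʳ-+ (toℕ c) (toℕ a) (toℕ b)) ⟩
    (toℕ a * toℕ c + toℕ b * toℕ c) mod q          ≡⟨ sym (mod-⊕ (toℕ a * toℕ c) (toℕ b * toℕ c)) ⟩
    a ⊗ c ⊕ b ⊗ c                                  ∎
    where open ≡-Reasoning

  0⊗ : ∀ a → 0# ⊗ a ≡ 0#
  0⊗ a = trans (cong (0# ⊗_) (sym (mod-toℕ a))) (mod-⊗ 0 (toℕ a))

  ⊕-isAbelianGroup : IsAbelianGroup _≡_ _⊕_ 0# ⊖_
  ⊕-isAbelianGroup = record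
    { isGroup = record
      { isMonoid = record
        { isSemigroup = record
          { isMagma = record { isEquivalence = isEquivalence ; ∙-cong = cong₂ _⊕_ }
          ; assoc = ⊕-assoc }
        ; identity = ⊕-identityˡ , λ a → trans (⊕-comm a 0#) (⊕-identityˡ a) }
      ; inverse = ⊖-inverseˡ , λ a → trans (⊕-comm a (⊖ a)) (⊖-inverseˡ a)
      ; ⁻¹-cong = cong ⊖_ }
    ; comm = ⊕-comm }

  infixl 6 _+ⱽ_
  infixr 7 _·_

  _+ⱽ_ : ∀ {n} → Vec (Fin q) n → Vec (Fin q) n → Vec (Fin q) n
  _+ⱽ_ = zipWith _⊕_

  -ⱽ_ : ∀ {n} → Vec (Fin q) n → Vec (Fin q) n
  -ⱽ_ = mapⱽ ⊖_

  0ⱽ : ∀ {n} → Vec (Fin q) n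
  0ⱽ = replicate _ 0#

  _·_ : ∀ {n} → Fin q → Vec (Fin q) n → Vec (Fin q) n
  c · x = mapⱽ (c ⊗_) x

  +ⱽ-isAbelianGroup : ∀ n → IsAbelianGroup _≡_ (_+ⱽ_ {n}) 0ⱽ -ⱽ_
  +ⱽ-isAbelianGroup n = record
    { isGroup = record
      { isMonoid = record
        { isSemigroup = record
          { isMagma = record { isEquivalence = isEquivalence ; ∙-cong = cong₂ _+ⱽ_ }
          ; assoc = Vec.zipWith-assoc ⊕-assoc }
        ; identity = Vec.zipWith-identityˡ ⊕-identityˡ , Vec.zipWith-identityʳ (IsAbelianGroup.identityʳ ⊕-isAbelianGroup) }
      ; inverse = Vec.zipWith-inverseˡ ⊖-inverseˡ , Vec.zipWith-inverseʳ (IsAbelianGroup.inverseʳ ⊕-isAbelianGroup)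
      ; ⁻¹-cong = cong -ⱽ_ }
    ; comm = Vec.zipWith-comm ⊕-comm }

  ·-distribʳ-⊕ : ∀ {n} a b (x : Vec (Fin q) n) → (a ⊕ b) · x ≡ a · x +ⱽ b · x
  ·-distribʳ-⊕ a b [] = refl
  ·-distribʳ-⊕ a b (x ∷ xs) = cong₂ _∷_ (⊗-distribʳ-⊕ x a b) (·-distribʳ-⊕ a b xs)

  0· : ∀ {n} (x : Vec (Fin q) n) → 0# · x ≡ 0ⱽ
  0· [] = refl
  0· (x ∷ xs) = cong₂ _∷_ (0⊗ x) (0· xs)

-- Lines through the origin.

-- A direction is a nonzero vector with first nonzero entry 1, so that the lines through 0 correspond
-- to directions; `lead w` is 1 ∷ w.
module Lines (q : ℕ) .{{_ : NonZero q}} (inv : Fin q → Fin q)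
  (inv-left : ∀ a b → a ≢ Residues.0# q → Residues._⊗_ q (inv a) (Residues._⊗_ q a b) ≡ b)
  (inv-right : ∀ a b → a ≢ Residues.0# q → Residues._⊗_ q a (Residues._⊗_ q (inv a) b) ≡ b) where
  open Residues q

  data Direction : ℕ → Set where
    lead : ∀ {n} → Vec (Fin q) n → Direction (suc n)
    skip : ∀ {n} → Direction n → Direction (suc n)

  _≟ᴰ_ : ∀ {n} → DecidableEquality (Direction n)
  lead w ≟ᴰ lead w′ = map′ (cong lead) (λ { refl → refl }) (Vec.≡-dec Fin._≟_ w w′)
  lead _ ≟ᴰ skip _ = no λ ()
  skip _ ≟ᴰ lead _ = no λ ()
  skip g ≟ᴰ skip h = map′ (cong skip) (λ { refl → refl }) (g ≟ᴰ h)

  ray : ∀ {n} → Fin q → Direction n → Vec (Fin q) n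
  ray a (lead w) = a ∷ a · w
  ray a (skip g) = 0# ∷ ray a g

  ray-⊕ : ∀ {n} a b (g : Direction n) → ray (a ⊕ b) g ≡ ray a g +ⱽ ray b g
  ray-⊕ a b (lead w) = cong (_ ∷_) (·-distribʳ-⊕ a b w)
  ray-⊕ a b (skip g) = cong₂ _∷_ (sym (⊕-identityˡ 0#)) (ray-⊕ a b g)

  ray-0 : ∀ {n} (g : Direction n) → ray 0# g ≡ 0ⱽ
  ray-0 (lead w) = cong (0# ∷_) (0· w)
  ray-0 (skip g) = cong (0# ∷_) (ray-0 g)

  ray≡0 : ∀ {n a} (g : Direction n) → ray a g ≡ 0ⱽ → a ≡ 0#
  ray≡0 (lead w) e = Vec.∷-injectiveˡ e
  ray≡0 (skip g) e = ray≡0 g (Vec.∷-injectiveʳ e)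

  ·-inv-left : ∀ {n a} → a ≢ 0# → (x : Vec (Fin q) n) → inv a · a · x ≡ x
  ·-inv-left a≢0 [] = refl
  ·-inv-left a≢0 (x ∷ xs) = cong₂ _∷_ (inv-left _ x a≢0) (·-inv-left a≢0 xs)

  ·-inv-right : ∀ {n a} → a ≢ 0# → (x : Vec (Fin q) n) → a · inv a · x ≡ x
  ·-inv-right a≢0 [] = refl
  ·-inv-right a≢0 (x ∷ xs) = cong₂ _∷_ (inv-right _ x a≢0) (·-inv-right a≢0 xs)

  -- Distinct lines through 0 meet in 0 only: the normalised direction is recovered by dividing by
  -- the multiplier, when that is nonzero.
  ray-injective : ∀ {n a b} (g h : Direction n) → ray a g ≡ ray b h → a ≡ b × (g ≡ h ⊎ a ≡ 0#)
  ray-injective {a = a} (lead w) (lead w′) e with Vec.∷-injectiveˡ e | a Fin.≟ 0#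
  ... | refl | yes a≡0 = refl , inj₂ a≡0
  ... | refl | no a≢0 = refl , inj₁ (cong lead (trans (sym (·-inv-left a≢0 w))
        (trans (cong (inv a ·_) (Vec.∷-injectiveʳ e)) (·-inv-left a≢0 w′))))
  ray-injective (lead w) (skip h) e with Vec.∷-injectiveˡ e
  ... | refl = sym (ray≡0 h (trans (sym (Vec.∷-injectiveʳ e)) (0· w))) , inj₂ refl
  ray-injective (skip g) (lead w) e with Vec.∷-injectiveˡ e
  ... | refl = ray≡0 g (trans (Vec.∷-injectiveʳ e) (0· w)) , inj₂ (ray≡0 g (trans (Vec.∷-injectiveʳ e) (0· w)))
  ray-injective (skip g) (skip h) e with ray-injective g h (Vec.∷-injectiveʳ e)
  ... | a≡b , inj₁ refl = a≡b , inj₁ refl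
  ... | a≡b , inj₂ a≡0 = a≡b , inj₂ a≡0

  -- The multiplier is the first nonzero entry, which is then divided out. The zero vector is the
  -- multiple 0 of some direction; the length is positive because otherwise no direction exists.
  coordinates : ∀ {n} (x : Vec (Fin q) (suc n)) → ∃₂ λ a g → x ≡ ray a g
  coordinates {n} (a ∷ w) with a Fin.≟ 0#
  ... | no a≢0 = a , lead (inv a · w) , cong (a ∷_) (sym (·-inv-right a≢0 w))
  coordinates {zero} (a ∷ []) | yes _ = a , lead [] , refl
  coordinates {suc n} (a ∷ w) | yes refl with coordinates w
  ... | b , g , refl = b , skip g , refl

-- The systems of order 3^n in affine space over 𝔽₃.

module TernaryAffine (n : ℕ) where
  open Residues 3

  V : Set
  V = Vec (Fin 3) n

  private
    infixl 6 _:+_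
    infixr 7 _:·_
    infix 8 :-_

    -- Identities between vector expressions hold coordinate by coordinate, so they can be proved by
    -- trying all assignments of elements of `Fin 3` to the variables. This replaces every
    -- calculation modulo 3 by `valid?`.
    data Expr (k : ℕ) : Set where
      var  : Fin k → Expr k
      _:+_ : Expr k → Expr k → Expr k
      :-_  : Expr k → Expr k
      _:·_ : Fin 3 → Expr k → Expr k

    eval : ∀ {k} → Expr k → Vec (Fin 3) k → Fin 3
    eval (var i) ρ = lookup ρ i
    eval (e :+ e′) ρ = eval e ρ ⊕ eval e′ ρ
    eval (:- e) ρ = ⊖ eval e ρ
    eval (c :· e) ρ = c ⊗ eval e ρ

    evalⱽ : ∀ {k} → Expr k → Vec V k → V
    evalⱽ (var i) ρ = lookup ρ i
    evalⱽ (e :+ e′) ρ = evalⱽ e ρ +ⱽ evalⱽ e′ ρ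
    evalⱽ (:- e) ρ = -ⱽ evalⱽ e ρ
    evalⱽ (c :· e) ρ = c · evalⱽ e ρ

    coordinate : ∀ {k} (e : Expr k) (ρ : Vec V k) i → lookup (evalⱽ e ρ) i ≡ eval e (mapⱽ (λ x → lookup x i) ρ)
    coordinate (var j) ρ i = sym (Vec.lookup-map j (λ x → lookup x i) ρ)
    coordinate (e :+ e′) ρ i = trans (Vec.lookup-zipWith _⊕_ i (evalⱽ e ρ) (evalⱽ e′ ρ))
      (cong₂ _⊕_ (coordinate e ρ i) (coordinate e′ ρ i))
    coordinate (:- e) ρ i = trans (Vec.lookup-map i ⊖_ (evalⱽ e ρ)) (cong ⊖_ (coordinate e ρ i))
    coordinate (c :· e) ρ i = trans (Vec.lookup-map i (c ⊗_) (evalⱽ e ρ)) (cong (c ⊗_) (coordinate e ρ i))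

    lookup-ext : ∀ {n} {x y : Vec (Fin 3) n} → (∀ i → lookup x i ≡ lookup y i) → x ≡ y
    lookup-ext {x = x} {y} f = trans (sym (Vec.tabulate∘lookup x)) (trans (Vec.tabulate-cong f) (Vec.tabulate∘lookup y))

    allEnv? : ∀ k {P : Vec (Fin 3) k → Set} → (∀ ρ → Dec (P ρ)) → Dec (∀ ρ → P ρ)
    allEnv? zero P? = map′ (λ { p [] → p }) (λ f → f []) (P? [])
    allEnv? (suc k) P? = map′ (λ { f (a ∷ ρ) → f a ρ }) (λ f a ρ → f (a ∷ ρ)) (Fin.all? λ a → allEnv? k λ ρ → P? (a ∷ ρ))

    Valid : ∀ {k} → Expr k → Expr k → Set
    Valid e e′ = ∀ ρ → eval e ρ ≡ eval e′ ρ

    valid? : ∀ {k} (e e′ : Expr k) → Dec (Valid e e′)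
    valid? e e′ = allEnv? _ λ ρ → eval e ρ Fin.≟ eval e′ ρ

    identity : ∀ {k} (e e′ : Expr k) → Valid e e′ → ∀ ρ → evalⱽ e ρ ≡ evalⱽ e′ ρ
    identity e e′ v ρ = lookup-ext λ i → trans (coordinate e ρ i) (trans (v _) (sym (coordinate e′ ρ i)))

    X Y Z : ∀ {k} → Expr (suc (suc (suc k)))
    X = var 0F
    Y = var 1F
    Z = var 2F

  -- Three distinct points x, y, z lie on a line iff x + y + z = 0.
  collinear : V → V → V
  collinear x y = -ⱽ (x +ⱽ y)

  onLine : Fin 3 → V → V → V
  onLine c d x = x +ⱽ c · d

  withSum : V → V → V → V
  withSum d x y = d +ⱽ -ⱽ (x +ⱽ y)

  private
    C : Expr 3 → Expr 3 → Expr 3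
    C x y = :- (x :+ y)
    L : Fin 3 → Expr 3 → Expr 3 → Expr 3
    L c d x = x :+ c :· d
    S : Expr 3 → Expr 3 → Expr 3 → Expr 3
    S d x y = d :+ :- (x :+ y)

  collinear-idem : ∀ x → collinear x x ≡ x
  collinear-idem x = identity (C X X) X (from-yes (valid? (C X X) X)) (x ∷ x ∷ x ∷ [])

  collinear-invol : ∀ x y → collinear x (collinear x y) ≡ y
  collinear-invol x y = identity (C X (C X Y)) Y (from-yes (valid? (C X (C X Y)) Y)) (x ∷ y ∷ x ∷ [])

  collinear-onLine : ∀ c d x → collinear x (onLine c d x) ≡ onLine (⊖ c) d x
  collinear-onLine c d x = identity (C X (L c Y X)) (L (⊖ c) Y X)
    (from-yes (Fin.all? λ c → valid? (C X (L c Y X)) (L (⊖ c) Y X)) c) (x ∷ d ∷ d ∷ [])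

  onLine-0 : ∀ d x → onLine 0F d x ≡ x
  onLine-0 d x = identity (L 0F Y X) X (from-yes (valid? (L 0F Y X) X)) (x ∷ d ∷ d ∷ [])

  onLine-onLine : ∀ c c′ d x → onLine c′ d (onLine c d x) ≡ onLine (c ⊕ c′) d x
  onLine-onLine c c′ d x = identity (L c′ Y (L c Y X)) (L (c ⊕ c′) Y X)
    (from-yes (Fin.all? λ c → Fin.all? λ c′ → valid? (L c′ Y (L c Y X)) (L (c ⊕ c′) Y X)) c c′) (x ∷ d ∷ d ∷ [])

  onLine-⊖ : ∀ c d x → onLine (⊖ c) d (onLine c d x) ≡ x
  onLine-⊖ c d x = identity (L (⊖ c) Y (L c Y X)) X
    (from-yes (Fin.all? λ c → valid? (L (⊖ c) Y (L c Y X)) X) c) (x ∷ d ∷ d ∷ [])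

  onLine-difference : ∀ x y → onLine 1F (y +ⱽ -ⱽ x) x ≡ y
  onLine-difference x y = identity (L 1F (Y :+ :- X) X) Y (from-yes (valid? (L 1F (Y :+ :- X) X) Y)) (x ∷ y ∷ x ∷ [])

  onLine-opposite : ∀ x y → onLine 2F (x +ⱽ -ⱽ y) x ≡ y
  onLine-opposite x y = identity (L 2F (X :+ :- Y) X) Y (from-yes (valid? (L 2F (X :+ :- Y) X) Y)) (x ∷ y ∷ x ∷ [])

  withSum-invol : ∀ d x y → withSum d x (withSum d x y) ≡ y
  withSum-invol d x y = identity (S Z X (S Z X Y)) Y (from-yes (valid? (S Z X (S Z X Y)) Y)) (x ∷ y ∷ d ∷ [])

  -- Modulo 3, -2 = 1, so d - x - (x + cd) = x + (1 - c)d. Thus if two points of a triple of sum `d`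
  -- lie on a line of direction `d`, so does the third, and the two rules defining `thirdPoint`
  -- never interfere.
  withSum-onLine : ∀ c d x → withSum d x (onLine c d x) ≡ onLine (1F ⊕ ⊖ c) d x
  withSum-onLine c d x = identity (S Y X (L c Y X)) (L (1F ⊕ ⊖ c) Y X)
    (from-yes (Fin.all? λ c → valid? (S Y X (L c Y X)) (L (1F ⊕ ⊖ c) Y X)) c) (x ∷ d ∷ d ∷ [])

  withSum-sum : ∀ x y z → withSum (x +ⱽ y +ⱽ z) x y ≡ z
  withSum-sum x y z = identity (S (X :+ Y :+ Z) X Y) Z (from-yes (valid? (S (X :+ Y :+ Z) X Y) Z)) (x ∷ y ∷ z ∷ [])

  collinear-sum : ∀ x y z → x +ⱽ y +ⱽ z +ⱽ collinear x y ≡ z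
  collinear-sum x y z = identity (X :+ Y :+ Z :+ C X Y) Z (from-yes (valid? (X :+ Y :+ Z :+ C X Y) Z)) (x ∷ y ∷ z ∷ [])

  -- As -2 = 1, the left end y - 2(x - y) of the chain is x. The lemma makes y - x and x - y two
  -- different indices for the line through distinct points.
  difference-symmetric⇒≡ : ∀ x y → x +ⱽ -ⱽ y ≡ y +ⱽ -ⱽ x → x ≡ y
  difference-symmetric⇒≡ x y e = begin
    x                                           ≡⟨ sym (identity E X (from-yes (valid? E X)) (x ∷ y ∷ x ∷ [])) ⟩
    y +ⱽ -ⱽ ((x +ⱽ -ⱽ y) +ⱽ (x +ⱽ -ⱽ y))        ≡⟨ cong (λ u → y +ⱽ -ⱽ ((x +ⱽ -ⱽ y) +ⱽ u)) e ⟩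
    y +ⱽ -ⱽ ((x +ⱽ -ⱽ y) +ⱽ (y +ⱽ -ⱽ x))        ≡⟨ identity E′ Y (from-yes (valid? E′ Y)) (x ∷ y ∷ x ∷ []) ⟩
    y                                           ∎
    where
    open ≡-Reasoning
    E E′ : Expr 3
    E = Y :+ :- ((X :+ :- Y) :+ (X :+ :- Y))
    E′ = Y :+ :- ((X :+ :- Y) :+ (Y :+ :- X))

  SameLine : V → V → V → Set
  SameLine d x y = ∃ λ c → onLine c d x ≡ y

  sameLine? : ∀ d x y → Dec (SameLine d x y)
  sameLine? d x y = Fin.any? λ c → Vec.≡-dec Fin._≟_ (onLine c d x) y

  thirdPoint : V → V → V → V
  thirdPoint d x y with sameLine? d x y
  ... | yes _ = collinear x y
  ... | no _ = withSum d x y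

  thirdPoint-line : ∀ {d x y} → SameLine d x y → thirdPoint d x y ≡ collinear x y
  thirdPoint-line {d} {x} {y} h with sameLine? d x y
  ... | yes _ = refl
  ... | no ¬h = contradiction h ¬h

  thirdPoint-off : ∀ {d x y} → ¬ SameLine d x y → thirdPoint d x y ≡ withSum d x y
  thirdPoint-off {d} {x} {y} ¬h with sameLine? d x y
  ... | yes h = contradiction h ¬h
  ... | no _ = refl

  sameLine-refl : ∀ d x → SameLine d x x
  sameLine-refl d x = 0F , onLine-0 d x

  sameLine-sym : ∀ {d x y} → SameLine d x y → SameLine d y x
  sameLine-sym {d} {x} (c , refl) = ⊖ c , onLine-⊖ c d x

  sameLine-trans : ∀ {d x y z} → SameLine d x y → SameLine d y z → SameLine d x z
  sameLine-trans {d} {x} (c , refl) (c′ , refl) = c ⊕ c′ , sym (onLine-onLine c c′ d x)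

  sameLine-collinear : ∀ {d x y} → SameLine d x y → SameLine d x (collinear x y)
  sameLine-collinear {d} {x} (c , refl) = ⊖ c , sym (collinear-onLine c d x)

  +ⱽ-comm : ∀ x y → x +ⱽ y ≡ y +ⱽ x
  +ⱽ-comm = IsAbelianGroup.comm (+ⱽ-isAbelianGroup n)

  thirdPoint-comm : ∀ d x y → thirdPoint d x y ≡ thirdPoint d y x
  thirdPoint-comm d x y with sameLine? d x y
  ... | yes h = trans (cong -ⱽ_ (+ⱽ-comm x y)) (sym (thirdPoint-line (sameLine-sym h)))
  ... | no ¬h = trans (cong (λ u → d +ⱽ -ⱽ u) (+ⱽ-comm x y)) (sym (thirdPoint-off (¬h ∘ sameLine-sym)))

  thirdPoint-invol : ∀ d x y → thirdPoint d x (thirdPoint d x y) ≡ y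
  thirdPoint-invol d x y with sameLine? d x y
  ... | yes h = trans (thirdPoint-line (sameLine-collinear h)) (collinear-invol x y)
  ... | no ¬h = trans (thirdPoint-off λ { (c , e) → ¬h (1F ⊕ ⊖ c ,
          trans (sym (withSum-onLine c d x)) (trans (cong (withSum d x) e) (withSum-invol d x y))) })
        (withSum-invol d x y)

  collinear-three : ∀ {d x y z} → x ≢ y → x ≢ z → y ≢ z → SameLine d x y → SameLine d x z → collinear x y ≡ z
  collinear-three {d} {x} x≢y x≢z y≢z (c , refl) (c′ , refl) = trans (collinear-onLine c d x) (go c c′ x≢y x≢z y≢z)
    where
    go : ∀ c c′ → x ≢ onLine c d x → x ≢ onLine c′ d x → onLine c d x ≢ onLine c′ d x → onLine (⊖ c) d x ≡ onLine c′ d x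
    go 0F _ p _ _ = contradiction (sym (onLine-0 d x)) p
    go 1F 0F _ p _ = contradiction (sym (onLine-0 d x)) p
    go 1F 1F _ _ p = contradiction refl p
    go 1F 2F _ _ _ = refl
    go 2F 0F _ p _ = contradiction (sym (onLine-0 d x)) p
    go 2F 1F _ _ _ = refl
    go 2F 2F _ _ p = contradiction refl p

  -- If the line xy had direction x + y + z, then z would be x or y.
  thirdPoint-sum : ∀ {x y z} → x ≢ y → x ≢ z → y ≢ z → thirdPoint (x +ⱽ y +ⱽ z) x y ≡ z
  thirdPoint-sum {x} {y} {z} x≢y x≢z y≢z with sameLine? (x +ⱽ y +ⱽ z) x y
  ... | no _ = withSum-sum x y z
  ... | yes (c , e) = contradiction
    (trans (cong (withSum d x) e) (withSum-sum x y z))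
    (go c (λ e′ → x≢y (trans (sym e′) e)) (λ e′ → y≢z (trans (sym e) e′)))
    where
    d = x +ⱽ y +ⱽ z
    go : ∀ c → onLine c d x ≢ x → onLine c d x ≢ z → withSum d x (onLine c d x) ≢ z
    go 0F p _ _ = p (onLine-0 d x)
    go 1F _ _ e = x≢z (trans (sym (onLine-0 d x)) (trans (sym (withSum-onLine 1F d x)) e))
    go 2F _ p e = p (trans (sym (withSum-onLine 2F d x)) e)

  lrDesign : ∀ {m} → suc (suc m) ≡ 3 ^ n → LRDesign V (Fin (suc m)) (suc m)
  lrDesign {m} size = record
    { points = points
    ; indices = ↔-id (Fin (suc m))
    ; index₀ = zero
    ; third = λ r → thirdPoint (dir r)
    ; third-idem = λ r x → trans (thirdPoint-line (sameLine-refl (dir r) x)) (collinear-idem x)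
    ; third-comm = λ r → thirdPoint-comm (dir r)
    ; third-invol = λ r → thirdPoint-invol (dir r)
    ; Parallel = λ r → SameLine (dir r)
    ; parallel? = λ r → sameLine? (dir r)
    ; ∥-refl = λ r → sameLine-refl (dir r)
    ; ∥-sym = sameLine-sym
    ; ∥-trans = sameLine-trans
    ; ∥-third = λ {r} {x} h → subst (SameLine (dir r) x) (sym (thirdPoint-line h)) (sameLine-collinear h)
    ; ∥-other = λ r x → onLine 1F (dir r) x ,
        (λ e → dir≢0 r (trans (sym (onLine-difference′ (dir r) x)) (trans (cong (_+ⱽ -ⱽ x) (sym e)) (x-x≡0 x)))) ,
        (1F , refl)
    ; ∥-three = λ x≢y x≢z y≢z h h′ → trans (thirdPoint-line h) (collinear-three x≢y x≢z y≢z h h′)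
    ; coherent = λ _ h h′ → trans (thirdPoint-line h) (sym (thirdPoint-line h′))
    ; cover∥ = cover∥
    ; cover = λ {x} {y} {z} x≢y x≢z y≢z → cover x≢y x≢z y≢z
    }
    where
    points : V ↔ Fin (suc (suc m))
    points = subst (λ k → V ↔ Fin k) (sym size) (Vec↔Fin 3 n)
    zeroIndex : Fin (suc (suc m))
    zeroIndex = Inverse.to points 0ⱽ
    -- Skipping the number of `0ⱽ` enumerates the nonzero vectors.
    dir : Fin (suc m) → V
    dir r = Inverse.from points (punchIn zeroIndex r)
    dir≢0 : ∀ r → dir r ≢ 0ⱽ
    dir≢0 r e = Fin.punchInᵢ≢i zeroIndex r (trans (sym (Inverse.strictlyInverseˡ points _)) (cong (Inverse.to points) e))
    dir-surjective : ∀ {d} → d ≢ 0ⱽ → ∃ λ r → dir r ≡ d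
    dir-surjective {d} d≢0 = punchOut ne , trans (cong (Inverse.from points) (Fin.punchIn-punchOut ne)) (Inverse.strictlyInverseʳ points d)
      where
      ne : zeroIndex ≢ Inverse.to points d
      ne e = d≢0 (sym (to-injective points e))
    onLine-difference′ : ∀ d x → onLine 1F d x +ⱽ -ⱽ x ≡ d
    onLine-difference′ d x = identity (L 1F Y X :+ :- X) Y (from-yes (valid? (L 1F Y X :+ :- X) Y)) (x ∷ d ∷ d ∷ [])
    x-x≡0 : ∀ x → x +ⱽ -ⱽ x ≡ 0ⱽ
    x-x≡0 = IsAbelianGroup.inverseʳ (+ⱽ-isAbelianGroup n)
    difference≢0 : ∀ {x y} → x ≢ y → y +ⱽ -ⱽ x ≢ 0ⱽ
    difference≢0 {x} {y} x≢y e = x≢y (trans (sym (onLine-0ⱽ x)) (trans (cong (λ d → onLine 1F d x) (sym e)) (onLine-difference x y)))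
      where
      onLine-0ⱽ : ∀ x → onLine 1F 0ⱽ x ≡ x
      onLine-0ⱽ x = trans (cong (λ d → onLine 1F d x) (sym (x-x≡0 x))) (onLine-difference x x)
    cover∥ : ∀ {x y} → x ≢ y → ∃₂ λ r r′ → r ≢ r′ × SameLine (dir r) x y × SameLine (dir r′) x y
    -- The line has two direction vectors: y = x + 1(y - x) = x + 2(x - y).
    cover∥ {x} {y} x≢y =
      let r , e = dir-surjective (difference≢0 x≢y)
          r′ , e′ = dir-surjective (difference≢0 (x≢y ∘ sym)) in
      r , r′ , (λ r≡r′ → x≢y (difference-symmetric⇒≡ x y (trans (sym e′) (trans (cong dir (sym r≡r′)) e)))) ,
      (1F , trans (cong (λ d → onLine 1F d x) e) (onLine-difference x y)) ,
      (2F , trans (cong (λ d → onLine 2F d x) e′) (onLine-opposite x y))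
    cover : ∀ {x y z} → x ≢ y → x ≢ z → y ≢ z → ∃ λ r → thirdPoint (dir r) x y ≡ z
    cover {x} {y} {z} x≢y x≢z y≢z with Vec.≡-dec Fin._≟_ (x +ⱽ y +ⱽ z) 0ⱽ
    ... | no d≢0 = let r , e = dir-surjective d≢0 in
      r , trans (cong (λ d → thirdPoint d x y) e) (thirdPoint-sum x≢y x≢z y≢z)
    -- Sum zero gives no direction, but then the three points are collinear and form a parallel
    -- block for the direction of their line.
    ... | yes d≡0 = let r , _ , _ , h , _ = cover∥ x≢y in
      r , trans (thirdPoint-line h) (trans (sym (IsAbelianGroup.identityˡ (+ⱽ-isAbelianGroup n) _))
        (trans (cong (_+ⱽ collinear x y) (sym d≡0)) (collinear-sum x y z)))

-- Translations, and the conditions on the base systems.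

-- The point set {∞} ∪ A × {0,1} of the designs of order 2|A| + 1; A acts on it by translations fixing ∞.
Pt : Set → Set
Pt A = Maybe (A × Bool)

pattern ∞ = nothing
pattern _﹫_ x i = just (x , i)

module Translation {A : Set} {_∙_ : A → A → A} {ε : A} {_⁻¹ : A → A} (isGroup : IsAbelianGroup _≡_ _∙_ ε _⁻¹) where
  private
    G : AbelianGroup 0ℓ 0ℓ
    G = record { isAbelianGroup = isGroup }
    module P = Algebra.Properties.AbelianGroup G
    open AbelianGroup G using (assoc; comm; identityˡ; identityʳ; inverseˡ; inverseʳ; commutativeMonoid)
    open ≡-Reasoning

  infixl 6 _−_ _◁_ _▷_

  _−_ : A → A → A
  x − y = x ∙ (y ⁻¹)

  −-∙ : ∀ x y → (x − y) ∙ y ≡ x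
  −-∙ x y = P.//-rightDividesˡ y x

  ∙-− : ∀ x y → (x ∙ y) − y ≡ x
  ∙-− x y = P.//-rightDividesʳ y x

  x−x : ∀ x → x − x ≡ ε
  x−x = inverseʳ

  −-−-∙ : ∀ x y z → x − (y ∙ z) ≡ x − y − z
  −-−-∙ x y z = trans (cong (x ∙_) (sym (P.⁻¹-∙-comm y z))) (sym (assoc x (y ⁻¹) (z ⁻¹)))

  ∙-∙-− : ∀ x y → x ∙ (y − x) ≡ y
  ∙-∙-− x y = trans (comm x (y − x)) (−-∙ y x)

  −-cancel : ∀ x y z → (x − z) − (y − z) ≡ x − y
  −-cancel x y z = begin
    (x − z) − (y − z)           ≡⟨ cong ((x − z) ∙_) (P.⁻¹-anti-homo-// y z) ⟩
    (x − z) ∙ (z − y)           ≡⟨ assoc x (z ⁻¹) (z − y) ⟩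
    x ∙ ((z ⁻¹) ∙ (z − y))      ≡⟨ cong (x ∙_) (sym (assoc (z ⁻¹) z (y ⁻¹))) ⟩
    x ∙ (((z ⁻¹) ∙ z) − y)      ≡⟨ cong (λ e → x ∙ (e − y)) (inverseˡ z) ⟩
    x ∙ (ε − y)                 ≡⟨ cong (x ∙_) (identityˡ (y ⁻¹)) ⟩
    x − y                       ∎

  −≡ε⇒≡ : ∀ x y → x − y ≡ ε → x ≡ y
  −≡ε⇒≡ = P.x∙y⁻¹≈ε⇒x≈y

  inverseˡ-unique : ∀ x y → x ∙ y ≡ ε → x ≡ y ⁻¹
  inverseˡ-unique = P.inverseˡ-unique

  zeroSum : A → A → A
  zeroSum x y = (x ∙ y) ⁻¹

  zeroSum-comm : ∀ x y → zeroSum x y ≡ zeroSum y x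
  zeroSum-comm x y = cong _⁻¹ (comm x y)

  zeroSum-unique : ∀ {x y z} → (x ∙ y) ∙ z ≡ ε → zeroSum x y ≡ z
  zeroSum-unique {x} {y} {z} e = sym (P.inverseʳ-unique (x ∙ y) z e)

  zeroSum-invol : ∀ x y → zeroSum x (zeroSum x y) ≡ y
  zeroSum-invol x y = zeroSum-unique (begin
    (x ∙ zeroSum x y) ∙ y   ≡⟨ assoc x (zeroSum x y) y ⟩
    x ∙ (zeroSum x y ∙ y)   ≡⟨ cong (x ∙_) (comm (zeroSum x y) y) ⟩
    x ∙ (y ∙ zeroSum x y)   ≡⟨ sym (assoc x y (zeroSum x y)) ⟩
    (x ∙ y) ∙ zeroSum x y   ≡⟨ inverseʳ (x ∙ y) ⟩
    ε                       ∎)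

  -- Here `f` is the centroid: (x - f) + (y - f) + (z - f) = (x + y + z) - 3f = 0.
  zeroSum-centroid : ∀ {x y z f} → (f ∙ f) ∙ f ≡ (x ∙ y) ∙ z → zeroSum (x − f) (y − f) ≡ z − f
  zeroSum-centroid {x} {y} {z} {f} e = zeroSum-unique (begin
    ((x − f) ∙ (y − f)) ∙ (z − f)                              ≡⟨ collect x y z (f ⁻¹) ⟩
    ((x ∙ y) ∙ z) ∙ (((f ⁻¹) ∙ (f ⁻¹)) ∙ (f ⁻¹))               ≡⟨ cong (_∙ (((f ⁻¹) ∙ (f ⁻¹)) ∙ (f ⁻¹))) (sym e) ⟩
    ((f ∙ f) ∙ f) ∙ (((f ⁻¹) ∙ (f ⁻¹)) ∙ (f ⁻¹))               ≡⟨ sym (collect f f f (f ⁻¹)) ⟩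
    ((f − f) ∙ (f − f)) ∙ (f − f)                              ≡⟨ cong (λ u → (u ∙ u) ∙ u) (x−x f) ⟩
    (ε ∙ ε) ∙ ε                                                ≡⟨ identityʳ (ε ∙ ε) ⟩
    ε ∙ ε                                                      ≡⟨ identityʳ ε ⟩
    ε                                                          ∎)
    where
    open Algebra.Solver.CommutativeMonoid commutativeMonoid using (prove; var; _⊕_)
    open import Data.Fin.Patterns using (0F; 1F; 2F; 3F)
    collect : ∀ x y z u → ((x ∙ u) ∙ (y ∙ u)) ∙ (z ∙ u) ≡ ((x ∙ y) ∙ z) ∙ ((u ∙ u) ∙ u)
    collect x y z u = prove 4 (((x′ ⊕ u′) ⊕ (y′ ⊕ u′)) ⊕ (z′ ⊕ u′)) (((x′ ⊕ y′) ⊕ z′) ⊕ ((u′ ⊕ u′) ⊕ u′)) (x ∷ y ∷ z ∷ u ∷ [])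
      where
      x′ = var 0F
      y′ = var 1F
      z′ = var 2F
      u′ = var 3F

  _◁_ _▷_ : Pt A → A → Pt A
  p ◁ f = mapᴹ (λ (x , i) → x − f , i) p
  p ▷ f = mapᴹ (λ (x , i) → x ∙ f , i) p

  ◁-▷ : ∀ p f → p ◁ f ▷ f ≡ p
  ◁-▷ ∞ f = refl
  ◁-▷ (x ﹫ i) f = cong (_﹫ i) (−-∙ x f)

  ▷-◁ : ∀ p f → p ▷ f ◁ f ≡ p
  ▷-◁ ∞ f = refl
  ▷-◁ (x ﹫ i) f = cong (_﹫ i) (∙-− x f)

  ▷-▷ : ∀ p f g → p ▷ f ▷ g ≡ p ▷ (f ∙ g)
  ▷-▷ ∞ f g = refl
  ▷-▷ (x ﹫ i) f g = cong (_﹫ i) (assoc x f g)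

  ◁-∙ : ∀ p f g → p ◁ (f ∙ g) ≡ p ◁ f ◁ g
  ◁-∙ ∞ f g = refl
  ◁-∙ (x ﹫ i) f g = cong (_﹫ i) (−-−-∙ x f g)

  ◁-injective : ∀ {p q} f → p ◁ f ≡ q ◁ f → p ≡ q
  ◁-injective {p} {q} f e = trans (sym (◁-▷ p f)) (trans (cong (_▷ f) e) (◁-▷ q f))

-- For z = 0 these are the points common to the copies of a base system on different lines through
-- 0.
data Special {A : Set} (z : A) : Pt A → Set where
  at∞ : Special z ∞
  at0 : ∀ i → Special z (z ﹫ i)

-- Two Steiner triple systems of order 2q + 1 on Pt (Fin q) whose translates cover all triples. Each has a
-- parallel class (the fibres of `class j`) containing the block {∞, (0,0), (0,1)}.
record BaseDesign (q : ℕ) .{{_ : NonZero q}} : Set where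
  open Residues q public
  open Translation ⊕-isAbelianGroup public
  field
    τ : Bool → Pt (Fin q) → Pt (Fin q) → Pt (Fin q)
    class : Bool → Pt (Fin q) → ℕ
    τ-idem : ∀ j α → τ j α α ≡ α
    τ-comm : ∀ j α β → τ j α β ≡ τ j β α
    τ-invol : ∀ j α β → τ j α (τ j α β) ≡ β
    class-τ : ∀ j α β → class j α ≡ class j β → class j α ≡ class j (τ j α β)
    class-other : ∀ j α → ∃ λ β → α ≢ β × class j α ≡ class j β
    class-three : ∀ j α β γ → α ≢ β → α ≢ γ → β ≢ γ → class j α ≡ class j β → class j α ≡ class j γ → τ j α β ≡ γ
    class-special : ∀ j i → class j ∞ ≡ class j (0# ﹫ i)
    special-class : ∀ j α → class j ∞ ≡ class j α → Special 0# α
    class-∞ : ∀ j a i → class j (a ﹫ i) ≡ class j ∞ → τ j (a ﹫ i) ∞ ≡ a ﹫ not i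
    class-vertical : ∀ j a i → class j (a ﹫ i) ≡ class j (a ﹫ not i) → τ j (a ﹫ i) (a ﹫ not i) ≡ ∞
    -- Up to translation, the block of a parallel class through two points depends on their difference only.
    coherentᴮ : ∀ i c k → ∃ λ γ → ∀ j a → class j (a ﹫ i) ≡ class j ((a ⊕ c) ﹫ k) → τ j (a ﹫ i) ((a ⊕ c) ﹫ k) ≡ γ ▷ a
    -- A translation takes the first point to (0 , i), and `d` then runs over the translates of the
    -- base systems. As the condition holds for each `j`, every pair gets two indices.
    cover∥ᴮ : ∀ j i β → ∃ λ d → class j ((0# ﹫ i) ◁ d) ≡ class j (β ◁ d)
    coverᴮ : ∀ i β γ → 0# ﹫ i ≢ β → 0# ﹫ i ≢ γ → β ≢ γ → ∃₂ λ j d → τ j ((0# ﹫ i) ◁ d) (β ◁ d) ≡ γ ◁ d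
    inv : Fin q → Fin q
    inv-left : ∀ a b → a ≢ 0# → inv a ⊗ (a ⊗ b) ≡ b
    inv-right : ∀ a b → a ≢ 0# → a ⊗ (inv a ⊗ b) ≡ b
    ⅓ : Fin q → Fin q
    ⅓-law : ∀ a → ⅓ a ⊕ ⅓ a ⊕ ⅓ a ≡ a

Maybe↔Fin : ∀ {A : Set} {m} → A ↔ Fin m → Maybe A ↔ Fin (suc m)
Maybe↔Fin {A} {m} iso = mk↔ₛ′ f g f∘g g∘f
  where
  f : Maybe A → Fin (suc m)
  f ∞ = zero
  f (just a) = suc (Inverse.to iso a)
  g : Fin (suc m) → Maybe A
  g zero = ∞
  g (suc i) = just (Inverse.from iso i)
  f∘g : ∀ i → f (g i) ≡ i
  f∘g zero = refl
  f∘g (suc i) = cong suc (Inverse.strictlyInverseˡ iso i)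
  g∘f : ∀ a → g (f a) ≡ a
  g∘f ∞ = refl
  g∘f (just a) = cong just (Inverse.strictlyInverseʳ iso a)

-- The systems of order 2 q^n + 1 from a base design.

module Inflation {q : ℕ} .{{_ : NonZero q}} (base : BaseDesign q) (n : ℕ) where
  open BaseDesign base
  open Lines q inv inv-left inv-right

  V : Set
  V = Vec (Fin q) (suc n)

  private module T = Translation (+ⱽ-isAbelianGroup (suc n))

  _≟ⱽ_ : DecidableEquality V
  _≟ⱽ_ = Vec.≡-dec Fin._≟_

  ray-− : ∀ a b (g : Direction (suc n)) → ray (a − b) g ≡ ray a g T.− ray b g
  ray-− a b g = trans (ray-⊕ a (⊖ b) g) (cong (ray a g +ⱽ_) (T.inverseˡ-unique _ _
    (trans (sym (ray-⊕ (⊖ b) b g)) (trans (cong (λ c → ray c g) (⊖-inverseˡ b)) (ray-0 g)))))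

  ray-zeroSum : ∀ a b (g : Direction (suc n)) → ray (zeroSum a b) g ≡ T.zeroSum (ray a g) (ray b g)
  ray-zeroSum a b g = sym (T.zeroSum-unique (begin
    (ray a g +ⱽ ray b g) +ⱽ ray (zeroSum a b) g ≡⟨ cong (_+ⱽ ray (zeroSum a b) g) (sym (ray-⊕ a b g)) ⟩
    ray (a ⊕ b) g +ⱽ ray (⊖ (a ⊕ b)) g          ≡⟨ sym (ray-⊕ (a ⊕ b) (⊖ (a ⊕ b)) g) ⟩
    ray ((a ⊕ b) − (a ⊕ b)) g                   ≡⟨ cong (λ c → ray c g) (x−x (a ⊕ b)) ⟩
    ray 0# g                                    ≡⟨ ray-0 g ⟩
    0ⱽ                                          ∎))
    where open ≡-Reasoning

  ι : Direction (suc n) → Pt (Fin q) → Pt V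
  ι g = mapᴹ (λ (a , i) → ray a g , i)

  ι-◁ : ∀ g α d → ι g (α ◁ d) ≡ ι g α T.◁ ray d g
  ι-◁ g ∞ d = refl
  ι-◁ g (a ﹫ i) d = cong (_﹫ i) (ray-− a d g)

  ι-▷ : ∀ g α d → ι g (α ▷ d) ≡ ι g α T.▷ ray d g
  ι-▷ g ∞ d = refl
  ι-▷ g (a ﹫ i) d = cong (_﹫ i) (ray-⊕ a d g)

  ι-special : ∀ {α} g h → Special 0# α → ι g α ≡ ι h α
  ι-special g h at∞ = refl
  ι-special g h (at0 i) = cong (_﹫ i) (trans (ray-0 g) (sym (ray-0 h)))

  ι-injective : ∀ g h α β → ι g α ≡ ι h β → α ≡ β × (g ≡ h ⊎ Special 0# α)
  ι-injective g h ∞ ∞ e = refl , inj₂ at∞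
  ι-injective g h (a ﹫ i) (b ﹫ k) e with ray-injective g h (cong proj₁ (Maybe.just-injective e)) | cong proj₂ (Maybe.just-injective e)
  ... | refl , inj₁ g≡h | refl = refl , inj₁ g≡h
  ... | refl , inj₂ refl | refl = refl , inj₂ (at0 i)

  on-some-line : ∀ p → ∃₂ λ g α → p ≡ ι g α
  on-some-line ∞ = proj₁ (proj₂ (coordinates 0ⱽ)) , ∞ , refl
  on-some-line (x ﹫ i) = let a , g , e = coordinates x in g , a ﹫ i , cong (_﹫ i) e

  class-of-special : ∀ {j α} → Special 0# α → class j ∞ ≡ class j α
  class-of-special at∞ = refl
  class-of-special {j} (at0 i) = class-special j i

  special-closed : ∀ {j α β} → class j α ≡ class j β → Special 0# α → Special 0# β
  special-closed {j} e sp = special-class j _ (trans (class-of-special sp) e)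

  -- The special points are exactly the class of ∞, and classes are closed under `τ`.
  τ-special : ∀ {j α β} → Special 0# α → Special 0# β → Special 0# (τ j α β)
  τ-special {j} sα sβ = special-closed (class-τ j _ _ (trans (sym (class-of-special sα)) (class-of-special sβ))) sα

  Dependent : V → V → Set
  Dependent x y = ∃ λ g → ∃₂ λ a b → x ≡ ray a g × y ≡ ray b g

  data View : Pt V → Pt V → Set where
    line : ∀ g α β → View (ι g α) (ι g β)
    independent : ∀ {x y} i k → ¬ Dependent x y → View (x ﹫ i) (y ﹫ k)

  view : ∀ p q → View p q
  view ∞ q with on-some-line q
  ... | g , β , refl = line g ∞ β
  view (x ﹫ i) ∞ with on-some-line (x ﹫ i)
  ... | g , α , e = subst (λ p → View p ∞) (sym e) (line g α ∞)
  view (x ﹫ i) (y ﹫ k) with coordinates x | coordinates y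
  ... | a , g , refl | b , h , refl with g ≟ᴰ h | a Fin.≟ 0# | b Fin.≟ 0#
  ... | yes refl | _ | _ = line g (a ﹫ i) (b ﹫ k)
  -- The zero vector lies on every line, so it is moved to the line of the other point.
  ... | no _ | yes refl | _ = subst (λ p → View p (ray b h ﹫ k)) (ι-special h g (at0 i)) (line h (0# ﹫ i) (b ﹫ k))
  ... | no _ | no _ | yes refl = subst (View (ray a g ﹫ i)) (ι-special g h (at0 k)) (line g (a ﹫ i) (0# ﹫ k))
  ... | no g≢h | no a≢0 | no b≢0 = independent i k λ { (g′ , a′ , b′ , e , e′) →
    case ray-injective g g′ e , ray-injective h g′ e′ of λ
      { ((_ , inj₁ g≡g′) , (_ , inj₁ h≡g′)) → g≢h (trans g≡g′ (sym h≡g′))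
      ; ((_ , inj₂ a≡0) , _) → a≢0 a≡0
      ; (_ , (_ , inj₂ b≡0)) → b≢0 b≡0 } }

  dependent-points : ∀ {x y i k} g α β → x ﹫ i ≡ ι g α → y ﹫ k ≡ ι g β → Dependent x y
  dependent-points g (a ﹫ _) (b ﹫ _) refl refl = g , a , b , refl , refl

  third₀′ : Bool → ∀ {p q} → View p q → Pt V
  third₀′ j (line g α β) = ι g (τ j α β)
  third₀′ j (independent {x} {y} i k _) = T.zeroSum x y ﹫ ((i xor k) xor j)

  third₀ : Bool → Pt V → Pt V → Pt V
  third₀ j p q = third₀′ j (view p q)

  -- The system is well defined although `view` chooses a line: two points lie on two different
  -- lines only if both are special. Then their third point is special too and has the same image on
  -- both lines.
  third₀-line′ : ∀ j {p q} (v : View p q) g α β → p ≡ ι g α → q ≡ ι g β → third₀′ j v ≡ ι g (τ j α β)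
  third₀-line′ j (independent i k ¬d) g α β e e′ = contradiction (dependent-points g α β e e′) ¬d
  third₀-line′ j (line g′ α′ β′) g α β e e′ with ι-injective g′ g α′ α e | ι-injective g′ g β′ β e′
  ... | refl , inj₁ refl | refl , _ = refl
  ... | refl , inj₂ _ | refl , inj₁ refl = refl
  ... | refl , inj₂ sα | refl , inj₂ sβ = ι-special g′ g (τ-special sα sβ)

  third₀-line : ∀ j g α β → third₀ j (ι g α) (ι g β) ≡ ι g (τ j α β)
  third₀-line j g α β = third₀-line′ j (view (ι g α) (ι g β)) g α β refl refl

  third₀-independent : ∀ j {x y} i k → ¬ Dependent x y → third₀ j (x ﹫ i) (y ﹫ k) ≡ T.zeroSum x y ﹫ ((i xor k) xor j)
  third₀-independent j {x} {y} i k ¬d = go (view (x ﹫ i) (y ﹫ k)) refl refl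
    where
    go : ∀ {p q} (v : View p q) → p ≡ x ﹫ i → q ≡ y ﹫ k → third₀′ j v ≡ T.zeroSum x y ﹫ ((i xor k) xor j)
    go (line g α β) e e′ = contradiction (dependent-points g α β (sym e) (sym e′)) ¬d
    go (independent _ _ _) refl refl = refl

  dependent-sym : ∀ {x y} → Dependent x y → Dependent y x
  dependent-sym (g , a , b , e , e′) = g , b , a , e′ , e

  dependent-zeroSum : ∀ {x y} → Dependent x (T.zeroSum x y) → Dependent x y
  dependent-zeroSum {x} {y} (g , a , b , refl , e) = g , a , zeroSum a b , refl ,
    trans (sym (T.zeroSum-invol x y)) (trans (cong (T.zeroSum x) e) (sym (ray-zeroSum a b g)))

  third₀-idem : ∀ j p → third₀ j p p ≡ p
  third₀-idem j p with on-some-line p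
  ... | g , α , refl = trans (third₀-line j g α α) (cong (ι g) (τ-idem j α))

  third₀-comm : ∀ j p q → third₀ j p q ≡ third₀ j q p
  third₀-comm j p q with view p q
  ... | line g α β = trans (cong (ι g) (τ-comm j α β)) (sym (third₀-line j g β α))
  ... | independent {x} {y} i k ¬d = trans (cong₂ _﹫_ (T.zeroSum-comm x y) (cong (_xor j) (𝔹.xor-comm i k)))
        (sym (third₀-independent j k i (¬d ∘ dependent-sym)))

  third₀-invol : ∀ j p q → third₀ j p (third₀ j p q) ≡ q
  third₀-invol j p q with view p q
  ... | line g α β = trans (third₀-line j g α (τ j α β)) (cong (ι g) (τ-invol j α β))
  ... | independent {x} {y} i k ¬d = trans (third₀-independent j i ((i xor k) xor j) (¬d ∘ dependent-zeroSum))
        (cong₂ _﹫_ (T.zeroSum-invol x y) (begin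
          (i xor ((i xor k) xor j)) xor j ≡⟨ cong (λ c → (i xor c) xor j) (𝔹.xor-assoc i k j) ⟩
          (i xor (i xor (k xor j))) xor j ≡⟨ cong (_xor j) (xor-invol i (k xor j)) ⟩
          (k xor j) xor j                 ≡⟨ 𝔹.xor-comm (k xor j) j ⟩
          j xor (k xor j)                 ≡⟨ cong (j xor_) (𝔹.xor-comm k j) ⟩
          j xor (j xor k)                 ≡⟨ xor-invol j k ⟩
          k                               ∎))
    where open ≡-Reasoning

  record Parallel₀ (j : Bool) (p u : Pt V) : Set where
    constructor parallel
    field
      {direction} : Direction (suc n)
      {left right} : Pt (Fin q)
      left≡ : p ≡ ι direction left
      right≡ : u ≡ ι direction right
      same-class : class j left ≡ class j right

  -- Parallelism may be tested on any line through `p`. If the given line is not `g`, then `p` is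
  -- special, hence so is its whole class, which lies on every line. This is what gives
  -- transitivity.
  parallel-along : ∀ {j p u} g α → Parallel₀ j p u → p ≡ ι g α → ∃ λ β → u ≡ ι g β × class j α ≡ class j β
  parallel-along g α′ (parallel {h} {α} {β} refl refl e) p≡ with ι-injective h g α α′ p≡
  ... | refl , inj₁ refl = β , refl , e
  ... | refl , inj₂ sp = β , ι-special h g (special-closed e sp) , e

  parallel₀? : ∀ j p u → Dec (Parallel₀ j p u)
  parallel₀? j p u with view p u
  ... | independent i k ¬d = no λ { (parallel {g} {α} {β} e e′ _) → ¬d (dependent-points g α β e e′) }
  ... | line g α β = map′ (parallel refl refl) from (class j α ℕ.≟ class j β)
    where
    from : Parallel₀ j (ι g α) (ι g β) → class j α ≡ class j β
    from (parallel {h} {α′} {β′} e e′ c) with ι-injective g h α α′ e | ι-injective g h β β′ e′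
    ... | refl , _ | refl , _ = c

  parallel₀-refl : ∀ j p → Parallel₀ j p p
  parallel₀-refl j p = let g , α , e = on-some-line p in parallel {direction = g} {α} {α} e e refl

  parallel₀-sym : ∀ {j p u} → Parallel₀ j p u → Parallel₀ j u p
  parallel₀-sym (parallel e e′ c) = parallel e′ e (sym c)

  parallel₀-trans : ∀ {j p u w} → Parallel₀ j p u → Parallel₀ j u w → Parallel₀ j p w
  parallel₀-trans (parallel {g} {_} {β} e e′ c) h with parallel-along g β h e′
  ... | _ , e″ , c′ = parallel e e″ (trans c c′)

  parallel₀-third : ∀ {j p u} → Parallel₀ j p u → Parallel₀ j p (third₀ j p u)
  parallel₀-third {j} (parallel {g} {α} {β} refl refl c) = parallel refl (third₀-line j g α β) (class-τ j α β c)

  parallel₀-other : ∀ j p → ∃ λ u → p ≢ u × Parallel₀ j p u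
  parallel₀-other j p with on-some-line p
  ... | g , α , refl = let β , α≢β , c = class-other j α in
    ι g β , (λ e → α≢β (proj₁ (ι-injective g g α β e))) , parallel refl refl c

  parallel₀-three : ∀ {j p u w} → p ≢ u → p ≢ w → u ≢ w → Parallel₀ j p u → Parallel₀ j p w → third₀ j p u ≡ w
  parallel₀-three {j} p≢u p≢w u≢w (parallel {g} {α} {β} refl refl c) h with parallel-along g α h refl
  ... | γ , refl , c′ = trans (third₀-line j g α β)
    (cong (ι g) (class-three j α β γ (p≢u ∘ cong (ι g)) (p≢w ∘ cong (ι g)) (u≢w ∘ cong (ι g)) c c′))

  third : V × Bool → Pt V → Pt V → Pt V
  third (f , j) p u = third₀ j (p T.◁ f) (u T.◁ f) T.▷ f

  third-◁ : ∀ f j p u → third (f , j) p u T.◁ f ≡ third₀ j (p T.◁ f) (u T.◁ f)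
  third-◁ f j p u = T.▷-◁ _ f

  Parallel : V × Bool → Pt V → Pt V → Set
  Parallel (f , j) p u = Parallel₀ j (p T.◁ f) (u T.◁ f)

  origin : ∀ x i g → (x ﹫ i) T.◁ x ≡ ι g (0# ﹫ i)
  origin x i g = cong (_﹫ i) (trans (T.x−x x) (sym (ray-0 g)))

  along : ∀ p x g α d → p T.◁ x ≡ ι g α → p T.◁ (x +ⱽ ray d g) ≡ ι g (α ◁ d)
  along p x g α d e = trans (T.◁-∙ p x (ray d g)) (trans (cong (T._◁ ray d g) e) (sym (ι-◁ g α d)))

  -- After translating `x` to 0 the point `u` lies on some line through 0, so a further shift along
  -- that line reduces the claim to the base system.
  cover∥-from : ∀ j x i u → ∃ λ f → Parallel (f , j) (x ﹫ i) u
  cover∥-from j x i u with on-some-line (u T.◁ x)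
  ... | g , β , e = let d , c = cover∥ᴮ j i β in
    x +ⱽ ray d g , parallel (along (x ﹫ i) x g (0# ﹫ i) d (origin x i g)) (along u x g β d e) c

  cover∥ : ∀ j p u → p ≢ u → ∃ λ f → Parallel (f , j) p u
  cover∥ j (x ﹫ i) u _ = cover∥-from j x i u
  cover∥ j ∞ (y ﹫ k) _ = let f , h = cover∥-from j y k ∞ in f , parallel₀-sym h
  cover∥ j ∞ ∞ p≢u = contradiction refl p≢u

  ⅓ⱽ : ∀ {k} → Vec (Fin q) k → Vec (Fin q) k
  ⅓ⱽ = mapⱽ ⅓

  ⅓ⱽ-law : ∀ {k} (x : Vec (Fin q) k) → ⅓ⱽ x +ⱽ ⅓ⱽ x +ⱽ ⅓ⱽ x ≡ x
  ⅓ⱽ-law [] = refl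
  ⅓ⱽ-law (a ∷ x) = cong₂ _∷_ (⅓-law a) (⅓ⱽ-law x)

  -- The vectors x - f, y - f, z - f have sum zero, so if two lie on a line through 0 all three do,
  -- and so do their differences. By contraposition, independent differences at `x` put the
  -- translated triple under the zero-sum rule.
  dependent-centroid : ∀ {x y z f} → (f +ⱽ f) +ⱽ f ≡ (x +ⱽ y) +ⱽ z → Dependent (x T.− f) (y T.− f) →
    Dependent (y T.− x) (z T.− x)
  dependent-centroid {x} {y} {z} {f} e (g , a , b , ea , eb) =
    g , b − a , zeroSum a b − a , difference eb , difference ec
    where
    ec : z T.− f ≡ ray (zeroSum a b) g
    ec = trans (sym (T.zeroSum-centroid e)) (trans (cong₂ T.zeroSum ea eb) (sym (ray-zeroSum a b g)))
    difference : ∀ {w c} → w T.− f ≡ ray c g → w T.− x ≡ ray (c − a) g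
    difference {w} {c} e = trans (sym (T.−-cancel w x f)) (trans (cong₂ T._−_ e ea) (sym (ray-− c a g)))

  cover-independent : ∀ {x y z} i k l → ¬ Dependent (y T.− x) (z T.− x) → ∃ λ fj → third fj (x ﹫ i) (y ﹫ k) ≡ z ﹫ l
  cover-independent {x} {y} {z} i k l ¬d = (f , j) , T.◁-injective f (begin
    third (f , j) (x ﹫ i) (y ﹫ k) T.◁ f              ≡⟨ third-◁ f j (x ﹫ i) (y ﹫ k) ⟩
    third₀ j ((x T.− f) ﹫ i) ((y T.− f) ﹫ k)         ≡⟨ third₀-independent j i k (¬d ∘ dependent-centroid centroid) ⟩
    T.zeroSum (x T.− f) (y T.− f) ﹫ ((i xor k) xor j) ≡⟨ cong₂ _﹫_ (T.zeroSum-centroid centroid) (xor-invol (i xor k) l) ⟩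
    (z T.− f) ﹫ l                                     ∎)
    where
    open ≡-Reasoning
    f = ⅓ⱽ (x +ⱽ y +ⱽ z)
    j = (i xor k) xor l
    centroid : (f +ⱽ f) +ⱽ f ≡ (x +ⱽ y) +ⱽ z
    centroid = ⅓ⱽ-law (x +ⱽ y +ⱽ z)

  untranslate : ∀ {x s k} u → s ﹫ k ≡ u T.◁ x → ∃ λ y → u ≡ y ﹫ k × s ≡ y T.− x
  untranslate (y ﹫ _) refl = y , refl , refl

  -- Translate `x` to 0. If the other two points then share a line through 0, the base design covers
  -- the triple with a shift along the line; if not, the centroid does.
  cover-from : ∀ {x i u w} → x ﹫ i ≢ u → x ﹫ i ≢ w → u ≢ w → ∃ λ fj → third fj (x ﹫ i) u ≡ w
  cover-from {x} {i} {u} {w} p≢u p≢w u≢w = go (view (u T.◁ x) (w T.◁ x)) refl refl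
    where
    go : ∀ {s t} → View s t → s ≡ u T.◁ x → t ≡ w T.◁ x → ∃ λ fj → third fj (x ﹫ i) u ≡ w
    go (line g β γ) eu ew = f , T.◁-injective (proj₁ f) (begin
      third f (x ﹫ i) u T.◁ proj₁ f                                 ≡⟨ third-◁ (proj₁ f) j (x ﹫ i) u ⟩
      third₀ j ((x ﹫ i) T.◁ proj₁ f) (u T.◁ proj₁ f)                ≡⟨ cong₂ (third₀ j) (along (x ﹫ i) x g (0# ﹫ i) d (origin x i g)) (along u x g β d (sym eu)) ⟩
      third₀ j (ι g ((0# ﹫ i) ◁ d)) (ι g (β ◁ d))                   ≡⟨ third₀-line j g _ _ ⟩
      ι g (τ j ((0# ﹫ i) ◁ d) (β ◁ d))                              ≡⟨ cong (ι g) (proj₂ (proj₂ found)) ⟩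
      ι g (γ ◁ d)                                                    ≡⟨ sym (along w x g γ d (sym ew)) ⟩
      w T.◁ proj₁ f                                                  ∎)
      where
      open ≡-Reasoning
      found = coverᴮ i β γ
        (λ e → p≢u (T.◁-injective x (trans (origin x i g) (trans (cong (ι g) e) eu))))
        (λ e → p≢w (T.◁-injective x (trans (origin x i g) (trans (cong (ι g) e) ew))))
        (λ e → u≢w (T.◁-injective x (trans (sym eu) (trans (cong (ι g) e) ew))))
      j = proj₁ found
      d = proj₁ (proj₂ found)
      f = x +ⱽ ray d g , j
    go (independent k l ¬d) eu ew with untranslate u eu | untranslate w ew
    ... | y , refl , refl | z , refl , refl = cover-independent i k l ¬d

  third-comm : ∀ w p u → third w p u ≡ third w u p
  third-comm (f , j) p u = cong (T._▷ f) (third₀-comm j (p T.◁ f) (u T.◁ f))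

  cover : ∀ {p u w} → p ≢ u → p ≢ w → u ≢ w → ∃ λ fj → third fj p u ≡ w
  cover {x ﹫ i} p≢u p≢w u≢w = cover-from p≢u p≢w u≢w
  cover {∞} {y ﹫ k} p≢u p≢w u≢w = let fj , e = cover-from {y} {k} (p≢u ∘ sym) u≢w p≢w in fj , trans (third-comm fj ∞ (y ﹫ k)) e
  cover {∞} {∞} p≢u _ _ = contradiction refl p≢u

  parallel-∞ : ∀ f j x i → Parallel (f , j) (x ﹫ i) ∞ → third (f , j) (x ﹫ i) ∞ ≡ x ﹫ not i
  parallel-∞ f j x i h = go (on-some-line ((x ﹫ i) T.◁ f))
    where
    go : (∃₂ λ g α → (x T.− f) ﹫ i ≡ ι g α) → _
    go (g , (a ﹫ _) , e) with refl ← cong proj₂ (Maybe.just-injective e) with parallel-along g (a ﹫ i) h e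
    ... | ∞ , _ , c = begin
      third₀ j ((x ﹫ i) T.◁ f) ∞ T.▷ f   ≡⟨ cong (λ s → third₀ j s ∞ T.▷ f) e ⟩
      third₀ j (ι g (a ﹫ i)) (ι g ∞) T.▷ f ≡⟨ cong (T._▷ f) (third₀-line j g (a ﹫ i) ∞) ⟩
      ι g (τ j (a ﹫ i) ∞) T.▷ f         ≡⟨ cong (λ α → ι g α T.▷ f) (class-∞ j a i c) ⟩
      (ray a g ﹫ not i) T.▷ f           ≡⟨ cong (λ v → (v ﹫ not i) T.▷ f) (sym (cong proj₁ (Maybe.just-injective e))) ⟩
      (x ﹫ not i) T.◁ f T.▷ f           ≡⟨ T.◁-▷ (x ﹫ not i) f ⟩
      x ﹫ not i                         ∎
      where open ≡-Reasoning

  parallel-vertical : ∀ f j x i → Parallel (f , j) (x ﹫ i) (x ﹫ not i) → third (f , j) (x ﹫ i) (x ﹫ not i) ≡ ∞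
  parallel-vertical f j x i h = go (on-some-line ((x ﹫ i) T.◁ f))
    where
    go : (∃₂ λ g α → (x T.− f) ﹫ i ≡ ι g α) → _
    go (g , (a ﹫ _) , e) with refl ← cong proj₂ (Maybe.just-injective e) with parallel-along g (a ﹫ i) h e
    ... | β , e′ , c with ι-injective g g (a ﹫ not i) β (trans (cong (_﹫ not i) (cong proj₁ (Maybe.just-injective (sym e)))) e′)
    ... | refl , _ = cong (T._▷ f) (begin
      third₀ j ((x ﹫ i) T.◁ f) ((x ﹫ not i) T.◁ f) ≡⟨ cong₂ (third₀ j) e e′ ⟩
      third₀ j (ι g (a ﹫ i)) (ι g (a ﹫ not i))     ≡⟨ third₀-line j g (a ﹫ i) (a ﹫ not i) ⟩
      ι g (τ j (a ﹫ i) (a ﹫ not i))                ≡⟨ cong (ι g) (class-vertical j a i c) ⟩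
      ∞                                             ∎)
      where open ≡-Reasoning

  -- Neither the translation nor `j` enters here, so agreement with this point, shown in
  -- `parallel-third`, is coherence for pairs with x ≠ y.
  parallelThird : V → Bool → V → Bool → Pt V
  parallelThird x i y k =
    let c , g , _ = coordinates (y T.− x) in ι g (proj₁ (coherentᴮ i c k)) T.▷ x

  parallel-third : ∀ {f j x i y k} → x ≢ y → Parallel (f , j) (x ﹫ i) (y ﹫ k) →
    third (f , j) (x ﹫ i) (y ﹫ k) ≡ parallelThird x i y k
  parallel-third {f} {j} {x} {i} {y} {k} x≢y (parallel {g} {a ﹫ _} {b ﹫ _} e e′ cl)
    with coordinates (y T.− x)
  ... | c , g₀ , ec with refl ← cong proj₂ (Maybe.just-injective e) | refl ← cong proj₂ (Maybe.just-injective e′)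
      | ray-injective g g₀ (trans (ray-− b a g) (trans (cong₂ T._−_ (sym y-f) (sym x-f)) (trans (T.−-cancel y x f) ec)))
    where
    x-f : x T.− f ≡ ray a g
    x-f = cong proj₁ (Maybe.just-injective e)
    y-f : y T.− f ≡ ray b g
    y-f = cong proj₁ (Maybe.just-injective e′)
  -- Both `ray (b − a) g` and `ray c g₀` equal y - x, so the lines `g` and `g₀` agree unless this
  -- vector is zero.
  ... | refl , inj₂ b−a≡0 = contradiction (sym (T.−≡ε⇒≡ y x (trans ec (trans (cong (λ c → ray c g₀) b−a≡0) (ray-0 g₀))))) x≢y
  ... | refl , inj₁ refl = begin
    third₀ j ((x ﹫ i) T.◁ f) ((y ﹫ k) T.◁ f) T.▷ f  ≡⟨ cong (T._▷ f) (trans (cong₂ (third₀ j) e e′) (third₀-line j g _ _)) ⟩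
    ι g (τ j (a ﹫ i) (b ﹫ k)) T.▷ f                 ≡⟨ cong (λ α → ι g α T.▷ f) third≡ ⟩
    ι g (γ ▷ a) T.▷ f                                 ≡⟨ cong (T._▷ f) (ι-▷ g γ a) ⟩
    ι g γ T.▷ ray a g T.▷ f                           ≡⟨ T.▷-▷ (ι g γ) (ray a g) f ⟩
    ι g γ T.▷ (ray a g +ⱽ f)                          ≡⟨ cong (λ v → ι g γ T.▷ (v +ⱽ f)) (sym (cong proj₁ (Maybe.just-injective e))) ⟩
    ι g γ T.▷ ((x T.− f) +ⱽ f)                        ≡⟨ cong (ι g γ T.▷_) (T.−-∙ x f) ⟩
    ι g γ T.▷ x                                       ∎
    where
    open ≡-Reasoning
    γ = proj₁ (coherentᴮ i (b − a) k)
    third≡ : τ j (a ﹫ i) (b ﹫ k) ≡ γ ▷ a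
    third≡ = subst (λ b → class j (a ﹫ i) ≡ class j (b ﹫ k) → τ j (a ﹫ i) (b ﹫ k) ≡ γ ▷ a) (∙-∙-− a b)
      (proj₂ (coherentᴮ i (b − a) k) j a) cl

  coherent-from : ∀ {r r′ x i u} → x ﹫ i ≢ u → Parallel r (x ﹫ i) u → Parallel r′ (x ﹫ i) u →
    third r (x ﹫ i) u ≡ third r′ (x ﹫ i) u
  coherent-from {f , j} {f′ , j′} {x} {i} {∞} _ h h′ = trans (parallel-∞ f j x i h) (sym (parallel-∞ f′ j′ x i h′))
  coherent-from {f , j} {f′ , j′} {x} {i} {y ﹫ k} p≢u h h′ with x ≟ⱽ y
  ... | no x≢y = trans (parallel-third x≢y h) (sym (parallel-third x≢y h′))
  ... | yes refl with refl ← 𝔹.¬-not (p≢u ∘ cong (x ﹫_) ∘ sym) =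
    trans (parallel-vertical f j x i h) (sym (parallel-vertical f′ j′ x i h′))

  coherent : ∀ {r r′ p u} → p ≢ u → Parallel r p u → Parallel r′ p u → third r p u ≡ third r′ p u
  coherent {p = x ﹫ i} p≢u h h′ = coherent-from p≢u h h′
  coherent {r} {r′} {∞} {y ﹫ k} p≢u h h′ = trans (third-comm r ∞ (y ﹫ k))
    (trans (coherent-from (p≢u ∘ sym) (parallel₀-sym h) (parallel₀-sym h′)) (third-comm r′ (y ﹫ k) ∞))
  coherent {p = ∞} {∞} p≢u _ _ = contradiction refl p≢u

  ◁-≢ : ∀ {p u} f → p ≢ u → p T.◁ f ≢ u T.◁ f
  ◁-≢ f p≢u e = p≢u (T.◁-injective f e)

  V×Bool↔Fin : (V × Bool) ↔ Fin (q ^ suc n * 2)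
  V×Bool↔Fin = ↔-trans (Vec↔Fin q (suc n) ×-↔ ↔-sym Fin.2↔Bool) (↔-sym Fin.*↔×)

  lrDesign : LRDesign (Pt V) (V × Bool) (q ^ suc n * 2)
  lrDesign = record
    { points = Maybe↔Fin V×Bool↔Fin
    ; indices = V×Bool↔Fin
    ; index₀ = 0ⱽ , false
    ; third = third
    ; third-idem = λ { (f , j) p → trans (cong (T._▷ f) (third₀-idem j (p T.◁ f))) (T.◁-▷ p f) }
    ; third-comm = third-comm
    ; third-invol = λ { (f , j) p u → trans (cong (λ w → third₀ j (p T.◁ f) w T.▷ f) (third-◁ f j p u))
        (trans (cong (T._▷ f) (third₀-invol j (p T.◁ f) (u T.◁ f))) (T.◁-▷ u f)) }
    ; Parallel = Parallel
    ; parallel? = λ { (f , j) p u → parallel₀? j _ _ }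
    ; ∥-refl = λ { (f , j) p → parallel₀-refl j _ }
    ; ∥-sym = parallel₀-sym
    ; ∥-trans = parallel₀-trans
    ; ∥-third = λ { {f , j} {p} {u} h → subst (Parallel₀ j (p T.◁ f)) (sym (third-◁ f j p u)) (parallel₀-third h) }
    ; ∥-other = λ { (f , j) p → let u , p≢u , h = parallel₀-other j (p T.◁ f) in
        u T.▷ f , (λ e → p≢u (trans (cong (T._◁ f) e) (T.▷-◁ u f))) , subst (Parallel₀ j (p T.◁ f)) (sym (T.▷-◁ u f)) h }
    ; ∥-three = λ { {f , j} {p} {u} {w} p≢u p≢w u≢w h h′ → trans
        (cong (T._▷ f) (parallel₀-three (◁-≢ f p≢u) (◁-≢ f p≢w) (◁-≢ f u≢w) h h′)) (T.◁-▷ w f) }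
    ; coherent = coherent
    ; cover∥ = λ {p} {u} p≢u → let f , h = cover∥ false p u p≢u ; f′ , h′ = cover∥ true p u p≢u in
        (f , false) , (f′ , true) , (λ ()) , h , h′
    ; cover = cover
    }

-- Finite verification of a base design given by tables.

-- Points are encoded as (a , i) ↦ 2a + i and ∞ ↦ 2q.
module FromTable (q : ℕ) .{{_ : NonZero q}} (thirdCode : Bool → ℕ → ℕ → ℕ) (classCode : Bool → ℕ → ℕ) where
  open Residues q
  open Translation ⊕-isAbelianGroup

  encode : Pt (Fin q) → ℕ
  encode ∞ = 2 * q
  encode (a ﹫ i) = 2 * toℕ a + (if i then 1 else 0)

  decode : ℕ → Pt (Fin q)
  decode c = if c ≡ᵇ 2 * q then ∞ else (((c / 2) mod q) ﹫ (c % 2 ≡ᵇ 1))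

  τ : Bool → Pt (Fin q) → Pt (Fin q) → Pt (Fin q)
  τ j α β = decode (thirdCode j (encode α) (encode β))

  class : Bool → Pt (Fin q) → ℕ
  class j α = classCode j (encode α)

  -- Fermat: a^(q−2) is inverse to a for prime q.
  inv : Fin q → Fin q
  inv a = (toℕ a ^ (q ∸ 2)) mod q

  ⅓ : Fin q → Fin q
  ⅓ a = inv (3 mod q) ⊗ a

  _≟ᴾ_ : DecidableEquality (Pt (Fin q))
  _≟ᴾ_ = Maybe.≡-dec (Prod.≡-dec Fin._≟_ 𝔹._≟_)

  allBool? : ∀ {P : Bool → Set} → (∀ b → Dec (P b)) → Dec (∀ b → P b)
  allBool? P? = map′ (λ { (f , t) false → f ; (f , t) true → t }) (λ h → h false , h true) (P? false ×-dec P? true)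

  anyBool? : ∀ {P : Bool → Set} → (∀ b → Dec (P b)) → Dec (∃ P)
  anyBool? P? = map′ [ (false ,_) , (true ,_) ]′ (λ { (false , p) → inj₁ p ; (true , p) → inj₂ p }) (P? false ⊎-dec P? true)

  allPt? : ∀ {P : Pt (Fin q) → Set} → (∀ α → Dec (P α)) → Dec (∀ α → P α)
  allPt? P? = map′ (λ { (p , f) ∞ → p ; (p , f) (a ﹫ i) → f a i }) (λ h → h ∞ , λ a i → h (a ﹫ i))
    (P? ∞ ×-dec Fin.all? λ a → allBool? λ i → P? (a ﹫ i))

  anyPt? : ∀ {P : Pt (Fin q) → Set} → (∀ α → Dec (P α)) → Dec (∃ P)
  anyPt? P? = map′ [ (∞ ,_) , (λ { (a , i , p) → a ﹫ i , p }) ]′ (λ { (∞ , p) → inj₁ p ; (a ﹫ i , p) → inj₂ (a , i , p) })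
    (P? ∞ ⊎-dec Fin.any? λ a → anyBool? λ i → P? (a ﹫ i))

  Same : Bool → Pt (Fin q) → Pt (Fin q) → Set
  Same j α β = class j α ≡ class j β

  same? : ∀ j α β → Dec (Same j α β)
  same? j α β = class j α ℕ.≟ class j β

  special? : ∀ α → Dec (Special 0# α)
  special? ∞ = yes at∞
  special? (a ﹫ i) = map′ (λ { refl → at0 i }) (λ { (at0 _) → refl }) (a Fin.≟ 0#)

  τ-Laws : Set
  τ-Laws = ∀ j α → τ j α α ≡ α × ∀ β → τ j α β ≡ τ j β α × τ j α (τ j α β) ≡ β

  τ-laws? : Dec τ-Laws
  τ-laws? = allBool? λ j → allPt? λ α → (τ j α α ≟ᴾ α) ×-dec
    allPt? λ β → (τ j α β ≟ᴾ τ j β α) ×-dec (τ j α (τ j α β) ≟ᴾ β)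

  -- The premise on β stands before the quantifier over γ, so that the exhaustive check runs over γ
  -- only when β lies in the class of α.
  Class-Laws : Set
  Class-Laws = ∀ j α → (∃ λ β → α ≢ β × Same j α β) ×
    (∀ β → Same j α β → Same j α (τ j α β) × (α ≢ β → ∀ γ → Same j α γ → α ≢ γ → β ≢ γ → τ j α β ≡ γ))

  class-laws? : Dec Class-Laws
  class-laws? = allBool? λ j → allPt? λ α → (anyPt? λ β → ¬? (α ≟ᴾ β) ×-dec same? j α β) ×-dec
    allPt? λ β → same? j α β →-dec (same? j α (τ j α β) ×-dec (¬? (α ≟ᴾ β) →-dec
      allPt? λ γ → same? j α γ →-dec ¬? (α ≟ᴾ γ) →-dec ¬? (β ≟ᴾ γ) →-dec τ j α β ≟ᴾ γ))

  Special-Laws : Set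
  Special-Laws = ∀ j → (∀ i → Same j ∞ (0# ﹫ i)) × (∀ α → Same j ∞ α → Special 0# α) × (∀ a i →
    (Same j (a ﹫ i) ∞ → τ j (a ﹫ i) ∞ ≡ a ﹫ not i) ×
    (Same j (a ﹫ i) (a ﹫ not i) → τ j (a ﹫ i) (a ﹫ not i) ≡ ∞))

  special-laws? : Dec Special-Laws
  special-laws? = allBool? λ j → (allBool? λ i → same? j ∞ (0# ﹫ i)) ×-dec
    (allPt? λ α → same? j ∞ α →-dec special? α) ×-dec
    Fin.all? λ a → allBool? λ i → (same? j (a ﹫ i) ∞ →-dec τ j (a ﹫ i) ∞ ≟ᴾ (a ﹫ not i)) ×-dec
      (same? j (a ﹫ i) (a ﹫ not i) →-dec τ j (a ﹫ i) (a ﹫ not i) ≟ᴾ ∞)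

  Coherent : Set
  Coherent = ∀ i c k → ∃ λ γ → ∀ j a → Same j (a ﹫ i) ((a ⊕ c) ﹫ k) → τ j (a ﹫ i) ((a ⊕ c) ﹫ k) ≡ γ ▷ a

  coherent? : Dec Coherent
  coherent? = allBool? λ i → Fin.all? λ c → allBool? λ k → anyPt? λ γ → allBool? λ j → Fin.all? λ a →
    same? j (a ﹫ i) ((a ⊕ c) ﹫ k) →-dec τ j (a ﹫ i) ((a ⊕ c) ﹫ k) ≟ᴾ (γ ▷ a)

  Cover∥ : Set
  Cover∥ = ∀ j i β → ∃ λ d → Same j ((0# ﹫ i) ◁ d) (β ◁ d)

  cover∥? : Dec Cover∥
  cover∥? = allBool? λ j → allBool? λ i → allPt? λ β → Fin.any? λ d → same? j ((0# ﹫ i) ◁ d) (β ◁ d)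

  Cover : Set
  Cover = ∀ i β → 0# ﹫ i ≢ β → ∀ γ → 0# ﹫ i ≢ γ → β ≢ γ → ∃₂ λ j d → τ j ((0# ﹫ i) ◁ d) (β ◁ d) ≡ γ ◁ d

  cover? : Dec Cover
  cover? = allBool? λ i → allPt? λ β → ¬? ((0# ﹫ i) ≟ᴾ β) →-dec allPt? λ γ →
    ¬? ((0# ﹫ i) ≟ᴾ γ) →-dec ¬? (β ≟ᴾ γ) →-dec
    anyBool? λ j → Fin.any? λ d → τ j ((0# ﹫ i) ◁ d) (β ◁ d) ≟ᴾ (γ ◁ d)

  Field-Laws : Set
  Field-Laws = ∀ a → ⅓ a ⊕ ⅓ a ⊕ ⅓ a ≡ a × (a ≢ 0# → ∀ b → inv a ⊗ (a ⊗ b) ≡ b × a ⊗ (inv a ⊗ b) ≡ b)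

  field-laws? : Dec Field-Laws
  field-laws? = Fin.all? λ a → (⅓ a ⊕ ⅓ a ⊕ ⅓ a Fin.≟ a) ×-dec (¬? (a Fin.≟ 0#) →-dec
    Fin.all? λ b → (inv a ⊗ (a ⊗ b) Fin.≟ b) ×-dec (a ⊗ (inv a ⊗ b) Fin.≟ b))

  baseDesign : τ-Laws → Class-Laws → Special-Laws → Coherent → Cover∥ → Cover → Field-Laws → BaseDesign q
  baseDesign τ-laws class-laws special-laws coherent cover∥ cover field-laws = record
    { τ = τ
    ; class = class
    ; τ-idem = λ j α → proj₁ (τ-laws j α)
    ; τ-comm = λ j α β → proj₁ (proj₂ (τ-laws j α) β)
    ; τ-invol = λ j α β → proj₂ (proj₂ (τ-laws j α) β)
    ; class-τ = λ j α β h → proj₁ (proj₂ (class-laws j α) β h)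
    ; class-other = λ j α → proj₁ (class-laws j α)
    ; class-three = λ j α β γ α≢β α≢γ β≢γ h h′ → proj₂ (proj₂ (class-laws j α) β h) α≢β γ h′ α≢γ β≢γ
    ; class-special = λ j → proj₁ (special-laws j)
    ; special-class = λ j → proj₁ (proj₂ (special-laws j))
    ; class-∞ = λ j a i → proj₁ (proj₂ (proj₂ (special-laws j)) a i)
    ; class-vertical = λ j a i → proj₂ (proj₂ (proj₂ (special-laws j)) a i)
    ; coherentᴮ = coherent
    ; cover∥ᴮ = cover∥
    ; coverᴮ = λ i β γ p≢q p≢r q≢r → cover i β p≢q γ p≢r q≢r
    ; inv = inv
    ; inv-left = λ a b a≢0 → proj₁ (proj₂ (field-laws a) a≢0 b)
    ; inv-right = λ a b a≢0 → proj₂ (proj₂ (field-laws a) a≢0 b)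
    ; ⅓ = ⅓
    ; ⅓-law = λ a → proj₁ (field-laws a)
    }

nth : ∀ {A : Set} → A → List A → ℕ → A
nth a [] _ = a
nth _ (x ∷ xs) zero = x
nth a (x ∷ xs) (suc k) = nth a xs k

-- The base systems of orders 15 and 27.

tables7 : Bool → List (List ℕ)
tables7 false =
  (0 ∷ 14 ∷ 13 ∷ 12 ∷ 11 ∷ 10 ∷ 9 ∷ 8 ∷ 7 ∷ 6 ∷ 5 ∷ 4 ∷ 3 ∷ 2 ∷ 1 ∷ []) ∷
  (14 ∷ 1 ∷ 3 ∷ 2 ∷ 5 ∷ 4 ∷ 7 ∷ 6 ∷ 9 ∷ 8 ∷ 11 ∷ 10 ∷ 13 ∷ 12 ∷ 0 ∷ []) ∷
  (13 ∷ 3 ∷ 2 ∷ 1 ∷ 8 ∷ 9 ∷ 10 ∷ 14 ∷ 4 ∷ 5 ∷ 6 ∷ 12 ∷ 11 ∷ 0 ∷ 7 ∷ []) ∷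
  (12 ∷ 2 ∷ 1 ∷ 3 ∷ 9 ∷ 8 ∷ 11 ∷ 13 ∷ 5 ∷ 4 ∷ 14 ∷ 6 ∷ 0 ∷ 7 ∷ 10 ∷ []) ∷
  (11 ∷ 5 ∷ 8 ∷ 9 ∷ 4 ∷ 1 ∷ 12 ∷ 10 ∷ 2 ∷ 3 ∷ 7 ∷ 0 ∷ 6 ∷ 14 ∷ 13 ∷ []) ∷
  (10 ∷ 4 ∷ 9 ∷ 8 ∷ 1 ∷ 5 ∷ 14 ∷ 12 ∷ 3 ∷ 2 ∷ 0 ∷ 13 ∷ 7 ∷ 11 ∷ 6 ∷ []) ∷
  (9 ∷ 7 ∷ 10 ∷ 11 ∷ 12 ∷ 14 ∷ 6 ∷ 1 ∷ 13 ∷ 0 ∷ 2 ∷ 3 ∷ 4 ∷ 8 ∷ 5 ∷ []) ∷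
  (8 ∷ 6 ∷ 14 ∷ 13 ∷ 10 ∷ 12 ∷ 1 ∷ 7 ∷ 0 ∷ 11 ∷ 4 ∷ 9 ∷ 5 ∷ 3 ∷ 2 ∷ []) ∷
  (7 ∷ 9 ∷ 4 ∷ 5 ∷ 2 ∷ 3 ∷ 13 ∷ 0 ∷ 8 ∷ 1 ∷ 12 ∷ 14 ∷ 10 ∷ 6 ∷ 11 ∷ []) ∷
  (6 ∷ 8 ∷ 5 ∷ 4 ∷ 3 ∷ 2 ∷ 0 ∷ 11 ∷ 1 ∷ 9 ∷ 13 ∷ 7 ∷ 14 ∷ 10 ∷ 12 ∷ []) ∷
  (5 ∷ 11 ∷ 6 ∷ 14 ∷ 7 ∷ 0 ∷ 2 ∷ 4 ∷ 12 ∷ 13 ∷ 10 ∷ 1 ∷ 8 ∷ 9 ∷ 3 ∷ []) ∷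
  (4 ∷ 10 ∷ 12 ∷ 6 ∷ 0 ∷ 13 ∷ 3 ∷ 9 ∷ 14 ∷ 7 ∷ 1 ∷ 11 ∷ 2 ∷ 5 ∷ 8 ∷ []) ∷
  (3 ∷ 13 ∷ 11 ∷ 0 ∷ 6 ∷ 7 ∷ 4 ∷ 5 ∷ 10 ∷ 14 ∷ 8 ∷ 2 ∷ 12 ∷ 1 ∷ 9 ∷ []) ∷
  (2 ∷ 12 ∷ 0 ∷ 7 ∷ 14 ∷ 11 ∷ 8 ∷ 3 ∷ 6 ∷ 10 ∷ 9 ∷ 5 ∷ 1 ∷ 13 ∷ 4 ∷ []) ∷
  (1 ∷ 0 ∷ 7 ∷ 10 ∷ 13 ∷ 6 ∷ 5 ∷ 2 ∷ 11 ∷ 12 ∷ 3 ∷ 8 ∷ 9 ∷ 4 ∷ 14 ∷ []) ∷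
  []
tables7 true =
  (0 ∷ 14 ∷ 3 ∷ 2 ∷ 5 ∷ 4 ∷ 7 ∷ 6 ∷ 9 ∷ 8 ∷ 11 ∷ 10 ∷ 13 ∷ 12 ∷ 1 ∷ []) ∷
  (14 ∷ 1 ∷ 13 ∷ 10 ∷ 11 ∷ 6 ∷ 5 ∷ 8 ∷ 7 ∷ 12 ∷ 3 ∷ 4 ∷ 9 ∷ 2 ∷ 0 ∷ []) ∷
  (3 ∷ 13 ∷ 2 ∷ 0 ∷ 8 ∷ 11 ∷ 9 ∷ 10 ∷ 4 ∷ 6 ∷ 7 ∷ 5 ∷ 14 ∷ 1 ∷ 12 ∷ []) ∷
  (2 ∷ 10 ∷ 0 ∷ 3 ∷ 12 ∷ 9 ∷ 11 ∷ 14 ∷ 13 ∷ 5 ∷ 1 ∷ 6 ∷ 4 ∷ 8 ∷ 7 ∷ []) ∷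
  (5 ∷ 11 ∷ 8 ∷ 12 ∷ 4 ∷ 0 ∷ 13 ∷ 9 ∷ 2 ∷ 7 ∷ 14 ∷ 1 ∷ 3 ∷ 6 ∷ 10 ∷ []) ∷
  (4 ∷ 6 ∷ 11 ∷ 9 ∷ 0 ∷ 5 ∷ 1 ∷ 12 ∷ 10 ∷ 3 ∷ 8 ∷ 2 ∷ 7 ∷ 14 ∷ 13 ∷ []) ∷
  (7 ∷ 5 ∷ 9 ∷ 11 ∷ 13 ∷ 1 ∷ 6 ∷ 0 ∷ 14 ∷ 2 ∷ 12 ∷ 3 ∷ 10 ∷ 4 ∷ 8 ∷ []) ∷
  (6 ∷ 8 ∷ 10 ∷ 14 ∷ 9 ∷ 12 ∷ 0 ∷ 7 ∷ 1 ∷ 4 ∷ 2 ∷ 13 ∷ 5 ∷ 11 ∷ 3 ∷ []) ∷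
  (9 ∷ 7 ∷ 4 ∷ 13 ∷ 2 ∷ 10 ∷ 14 ∷ 1 ∷ 8 ∷ 0 ∷ 5 ∷ 12 ∷ 11 ∷ 3 ∷ 6 ∷ []) ∷
  (8 ∷ 12 ∷ 6 ∷ 5 ∷ 7 ∷ 3 ∷ 2 ∷ 4 ∷ 0 ∷ 9 ∷ 13 ∷ 14 ∷ 1 ∷ 10 ∷ 11 ∷ []) ∷
  (11 ∷ 3 ∷ 7 ∷ 1 ∷ 14 ∷ 8 ∷ 12 ∷ 2 ∷ 5 ∷ 13 ∷ 10 ∷ 0 ∷ 6 ∷ 9 ∷ 4 ∷ []) ∷
  (10 ∷ 4 ∷ 5 ∷ 6 ∷ 1 ∷ 2 ∷ 3 ∷ 13 ∷ 12 ∷ 14 ∷ 0 ∷ 11 ∷ 8 ∷ 7 ∷ 9 ∷ []) ∷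
  (13 ∷ 9 ∷ 14 ∷ 4 ∷ 3 ∷ 7 ∷ 10 ∷ 5 ∷ 11 ∷ 1 ∷ 6 ∷ 8 ∷ 12 ∷ 0 ∷ 2 ∷ []) ∷
  (12 ∷ 2 ∷ 1 ∷ 8 ∷ 6 ∷ 14 ∷ 4 ∷ 11 ∷ 3 ∷ 10 ∷ 9 ∷ 7 ∷ 0 ∷ 13 ∷ 5 ∷ []) ∷
  (1 ∷ 0 ∷ 12 ∷ 7 ∷ 10 ∷ 13 ∷ 8 ∷ 3 ∷ 6 ∷ 11 ∷ 4 ∷ 9 ∷ 2 ∷ 5 ∷ 14 ∷ []) ∷
  []

-- Common to both systems: {∞, (0,0), (0,1)}, {(1,0), (2,0), (4,0)} and the orbit of {(1,1), (3,0),
-- (5,1)} under the multiplier 2. Every pure or mixed difference occurs once, so the 35 translates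
-- form a single Steiner triple system.
classes7 : List ℕ
classes7 = 0 ∷ 0 ∷ 4 ∷ 1 ∷ 4 ∷ 2 ∷ 1 ∷ 2 ∷ 4 ∷ 3 ∷ 3 ∷ 1 ∷ 2 ∷ 3 ∷ 0 ∷ []

table13 : List (List ℕ)
table13 =
  (0 ∷ 26 ∷ 17 ∷ 8 ∷ 25 ∷ 16 ∷ 23 ∷ 24 ∷ 3 ∷ 10 ∷ 9 ∷ 14 ∷ 21 ∷ 22 ∷ 11 ∷ 18 ∷ 5 ∷ 2 ∷ 15 ∷ 20 ∷ 19 ∷ 12 ∷ 13 ∷ 6 ∷ 7 ∷ 4 ∷ 1 ∷ []) ∷
  (26 ∷ 1 ∷ 23 ∷ 10 ∷ 7 ∷ 25 ∷ 15 ∷ 4 ∷ 22 ∷ 11 ∷ 3 ∷ 9 ∷ 19 ∷ 21 ∷ 24 ∷ 6 ∷ 20 ∷ 18 ∷ 17 ∷ 12 ∷ 16 ∷ 13 ∷ 8 ∷ 2 ∷ 14 ∷ 5 ∷ 0 ∷ []) ∷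
  (17 ∷ 23 ∷ 2 ∷ 9 ∷ 26 ∷ 19 ∷ 18 ∷ 16 ∷ 12 ∷ 3 ∷ 13 ∷ 20 ∷ 8 ∷ 10 ∷ 15 ∷ 14 ∷ 7 ∷ 0 ∷ 6 ∷ 5 ∷ 11 ∷ 24 ∷ 25 ∷ 1 ∷ 21 ∷ 22 ∷ 4 ∷ []) ∷
  (8 ∷ 10 ∷ 9 ∷ 3 ∷ 15 ∷ 17 ∷ 13 ∷ 19 ∷ 0 ∷ 2 ∷ 1 ∷ 25 ∷ 23 ∷ 6 ∷ 18 ∷ 4 ∷ 22 ∷ 5 ∷ 14 ∷ 7 ∷ 21 ∷ 20 ∷ 16 ∷ 12 ∷ 26 ∷ 11 ∷ 24 ∷ []) ∷
  (25 ∷ 7 ∷ 26 ∷ 15 ∷ 4 ∷ 9 ∷ 11 ∷ 1 ∷ 10 ∷ 5 ∷ 8 ∷ 6 ∷ 24 ∷ 16 ∷ 23 ∷ 3 ∷ 13 ∷ 19 ∷ 20 ∷ 17 ∷ 18 ∷ 22 ∷ 21 ∷ 14 ∷ 12 ∷ 0 ∷ 2 ∷ []) ∷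
  (16 ∷ 25 ∷ 19 ∷ 17 ∷ 9 ∷ 5 ∷ 8 ∷ 21 ∷ 6 ∷ 4 ∷ 14 ∷ 13 ∷ 18 ∷ 11 ∷ 10 ∷ 24 ∷ 0 ∷ 3 ∷ 12 ∷ 2 ∷ 23 ∷ 7 ∷ 26 ∷ 20 ∷ 15 ∷ 1 ∷ 22 ∷ []) ∷
  (23 ∷ 15 ∷ 18 ∷ 13 ∷ 11 ∷ 8 ∷ 6 ∷ 25 ∷ 5 ∷ 20 ∷ 24 ∷ 4 ∷ 26 ∷ 3 ∷ 21 ∷ 1 ∷ 17 ∷ 16 ∷ 2 ∷ 22 ∷ 9 ∷ 14 ∷ 19 ∷ 0 ∷ 10 ∷ 7 ∷ 12 ∷ []) ∷
  (24 ∷ 4 ∷ 16 ∷ 19 ∷ 1 ∷ 21 ∷ 25 ∷ 7 ∷ 9 ∷ 8 ∷ 15 ∷ 18 ∷ 17 ∷ 23 ∷ 22 ∷ 10 ∷ 2 ∷ 12 ∷ 11 ∷ 3 ∷ 26 ∷ 5 ∷ 14 ∷ 13 ∷ 0 ∷ 6 ∷ 20 ∷ []) ∷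
  (3 ∷ 22 ∷ 12 ∷ 0 ∷ 10 ∷ 6 ∷ 5 ∷ 9 ∷ 8 ∷ 7 ∷ 4 ∷ 23 ∷ 2 ∷ 15 ∷ 17 ∷ 13 ∷ 21 ∷ 14 ∷ 25 ∷ 26 ∷ 24 ∷ 16 ∷ 1 ∷ 11 ∷ 20 ∷ 18 ∷ 19 ∷ []) ∷
  (10 ∷ 11 ∷ 3 ∷ 2 ∷ 5 ∷ 4 ∷ 20 ∷ 8 ∷ 7 ∷ 9 ∷ 0 ∷ 1 ∷ 14 ∷ 19 ∷ 12 ∷ 21 ∷ 18 ∷ 25 ∷ 16 ∷ 13 ∷ 6 ∷ 15 ∷ 24 ∷ 26 ∷ 22 ∷ 17 ∷ 23 ∷ []) ∷
  (9 ∷ 3 ∷ 13 ∷ 1 ∷ 8 ∷ 14 ∷ 24 ∷ 15 ∷ 4 ∷ 0 ∷ 10 ∷ 21 ∷ 20 ∷ 2 ∷ 5 ∷ 7 ∷ 25 ∷ 22 ∷ 26 ∷ 23 ∷ 12 ∷ 11 ∷ 17 ∷ 19 ∷ 6 ∷ 16 ∷ 18 ∷ []) ∷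
  (14 ∷ 9 ∷ 20 ∷ 25 ∷ 6 ∷ 13 ∷ 4 ∷ 18 ∷ 23 ∷ 1 ∷ 21 ∷ 11 ∷ 22 ∷ 5 ∷ 0 ∷ 19 ∷ 26 ∷ 24 ∷ 7 ∷ 15 ∷ 2 ∷ 10 ∷ 12 ∷ 8 ∷ 17 ∷ 3 ∷ 16 ∷ []) ∷
  (21 ∷ 19 ∷ 8 ∷ 23 ∷ 24 ∷ 18 ∷ 26 ∷ 17 ∷ 2 ∷ 14 ∷ 20 ∷ 22 ∷ 12 ∷ 25 ∷ 9 ∷ 16 ∷ 15 ∷ 7 ∷ 5 ∷ 1 ∷ 10 ∷ 0 ∷ 11 ∷ 3 ∷ 4 ∷ 13 ∷ 6 ∷ []) ∷
  (22 ∷ 21 ∷ 10 ∷ 6 ∷ 16 ∷ 11 ∷ 3 ∷ 23 ∷ 15 ∷ 19 ∷ 2 ∷ 5 ∷ 25 ∷ 13 ∷ 26 ∷ 8 ∷ 4 ∷ 20 ∷ 24 ∷ 9 ∷ 17 ∷ 1 ∷ 0 ∷ 7 ∷ 18 ∷ 12 ∷ 14 ∷ []) ∷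
  (11 ∷ 24 ∷ 15 ∷ 18 ∷ 23 ∷ 10 ∷ 21 ∷ 22 ∷ 17 ∷ 12 ∷ 5 ∷ 0 ∷ 9 ∷ 26 ∷ 14 ∷ 2 ∷ 19 ∷ 8 ∷ 3 ∷ 16 ∷ 25 ∷ 6 ∷ 7 ∷ 4 ∷ 1 ∷ 20 ∷ 13 ∷ []) ∷
  (18 ∷ 6 ∷ 14 ∷ 4 ∷ 3 ∷ 24 ∷ 1 ∷ 10 ∷ 13 ∷ 21 ∷ 7 ∷ 19 ∷ 16 ∷ 8 ∷ 2 ∷ 15 ∷ 12 ∷ 23 ∷ 0 ∷ 11 ∷ 22 ∷ 9 ∷ 20 ∷ 17 ∷ 5 ∷ 26 ∷ 25 ∷ []) ∷
  (5 ∷ 20 ∷ 7 ∷ 22 ∷ 13 ∷ 0 ∷ 17 ∷ 2 ∷ 21 ∷ 18 ∷ 25 ∷ 26 ∷ 15 ∷ 4 ∷ 19 ∷ 12 ∷ 16 ∷ 6 ∷ 9 ∷ 14 ∷ 1 ∷ 8 ∷ 3 ∷ 24 ∷ 23 ∷ 10 ∷ 11 ∷ []) ∷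
  (2 ∷ 18 ∷ 0 ∷ 5 ∷ 19 ∷ 3 ∷ 16 ∷ 12 ∷ 14 ∷ 25 ∷ 22 ∷ 24 ∷ 7 ∷ 20 ∷ 8 ∷ 23 ∷ 6 ∷ 17 ∷ 1 ∷ 4 ∷ 13 ∷ 26 ∷ 10 ∷ 15 ∷ 11 ∷ 9 ∷ 21 ∷ []) ∷
  (15 ∷ 17 ∷ 6 ∷ 14 ∷ 20 ∷ 12 ∷ 2 ∷ 11 ∷ 25 ∷ 16 ∷ 26 ∷ 7 ∷ 5 ∷ 24 ∷ 3 ∷ 0 ∷ 9 ∷ 1 ∷ 18 ∷ 21 ∷ 4 ∷ 19 ∷ 23 ∷ 22 ∷ 13 ∷ 8 ∷ 10 ∷ []) ∷
  (20 ∷ 12 ∷ 5 ∷ 7 ∷ 17 ∷ 2 ∷ 22 ∷ 3 ∷ 26 ∷ 13 ∷ 23 ∷ 15 ∷ 1 ∷ 9 ∷ 16 ∷ 11 ∷ 14 ∷ 4 ∷ 21 ∷ 19 ∷ 0 ∷ 18 ∷ 6 ∷ 10 ∷ 25 ∷ 24 ∷ 8 ∷ []) ∷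
  (19 ∷ 16 ∷ 11 ∷ 21 ∷ 18 ∷ 23 ∷ 9 ∷ 26 ∷ 24 ∷ 6 ∷ 12 ∷ 2 ∷ 10 ∷ 17 ∷ 25 ∷ 22 ∷ 1 ∷ 13 ∷ 4 ∷ 0 ∷ 20 ∷ 3 ∷ 15 ∷ 5 ∷ 8 ∷ 14 ∷ 7 ∷ []) ∷
  (12 ∷ 13 ∷ 24 ∷ 20 ∷ 22 ∷ 7 ∷ 14 ∷ 5 ∷ 16 ∷ 15 ∷ 11 ∷ 10 ∷ 0 ∷ 1 ∷ 6 ∷ 9 ∷ 8 ∷ 26 ∷ 19 ∷ 18 ∷ 3 ∷ 21 ∷ 4 ∷ 25 ∷ 2 ∷ 23 ∷ 17 ∷ []) ∷
  (13 ∷ 8 ∷ 25 ∷ 16 ∷ 21 ∷ 26 ∷ 19 ∷ 14 ∷ 1 ∷ 24 ∷ 17 ∷ 12 ∷ 11 ∷ 0 ∷ 7 ∷ 20 ∷ 3 ∷ 10 ∷ 23 ∷ 6 ∷ 15 ∷ 4 ∷ 22 ∷ 18 ∷ 9 ∷ 2 ∷ 5 ∷ []) ∷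
  (6 ∷ 2 ∷ 1 ∷ 12 ∷ 14 ∷ 20 ∷ 0 ∷ 13 ∷ 11 ∷ 26 ∷ 19 ∷ 8 ∷ 3 ∷ 7 ∷ 4 ∷ 17 ∷ 24 ∷ 15 ∷ 22 ∷ 10 ∷ 5 ∷ 25 ∷ 18 ∷ 23 ∷ 16 ∷ 21 ∷ 9 ∷ []) ∷
  (7 ∷ 14 ∷ 21 ∷ 26 ∷ 12 ∷ 15 ∷ 10 ∷ 0 ∷ 20 ∷ 22 ∷ 6 ∷ 17 ∷ 4 ∷ 18 ∷ 1 ∷ 5 ∷ 23 ∷ 11 ∷ 13 ∷ 25 ∷ 8 ∷ 2 ∷ 9 ∷ 16 ∷ 24 ∷ 19 ∷ 3 ∷ []) ∷
  (4 ∷ 5 ∷ 22 ∷ 11 ∷ 0 ∷ 1 ∷ 7 ∷ 6 ∷ 18 ∷ 17 ∷ 16 ∷ 3 ∷ 13 ∷ 12 ∷ 20 ∷ 26 ∷ 10 ∷ 9 ∷ 8 ∷ 24 ∷ 14 ∷ 23 ∷ 2 ∷ 21 ∷ 19 ∷ 25 ∷ 15 ∷ []) ∷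
  (1 ∷ 0 ∷ 4 ∷ 24 ∷ 2 ∷ 22 ∷ 12 ∷ 20 ∷ 19 ∷ 23 ∷ 18 ∷ 16 ∷ 6 ∷ 14 ∷ 13 ∷ 25 ∷ 11 ∷ 21 ∷ 10 ∷ 8 ∷ 7 ∷ 17 ∷ 5 ∷ 9 ∷ 3 ∷ 15 ∷ 26 ∷ []) ∷
  []

-- The blocks are {∞, (0,0), (0,1)}, {1,3,9} on either side, and the orbit of {(2,0), (11,0),
-- (10,1)} under the multiplier 3 with its mirror image. The partition is invariant under exchanging
-- the sides, so `class13 true` has the same blocks.
classes13 : List ℕ
classes13 = 0 ∷ 0 ∷ 1 ∷ 2 ∷ 3 ∷ 6 ∷ 1 ∷ 2 ∷ 7 ∷ 4 ∷ 5 ∷ 8 ∷ 4 ∷ 7 ∷ 4 ∷ 7 ∷ 5 ∷ 8 ∷ 1 ∷ 2 ∷ 6 ∷ 3 ∷ 3 ∷ 6 ∷ 8 ∷ 5 ∷ 0 ∷ []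

third7 : Bool → ℕ → ℕ → ℕ
third7 j c d = nth 0 (nth [] (tables7 j) c) d

class7 : Bool → ℕ → ℕ
class7 _ = nth 0 classes7

-- On codes, the involution (a , i) ↦ (a , 1 - i) fixing ∞. For q = 13 it carries B₀ to B₁.
swapSides : ℕ → ℕ
swapSides c = if c ≡ᵇ 26 then 26 else if c % 2 ≡ᵇ 0 then suc c else c ∸ 1

third13 : Bool → ℕ → ℕ → ℕ
third13 false c d = nth 0 (nth [] table13 c) d
third13 true c d = swapSides (third13 false (swapSides c) (swapSides d))

class13 : Bool → ℕ → ℕ
class13 false = nth 0 classes13
class13 true c = class13 false (swapSides c)

module Base7 = FromTable 7 third7 class7

abstract
  base7 : BaseDesign 7
  base7 = Base7.baseDesign
    (from-yes Base7.τ-laws?) (from-yes Base7.class-laws?) (from-yes Base7.special-laws?)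
    (from-yes Base7.coherent?) (from-yes Base7.cover∥?) (from-yes Base7.cover?) (from-yes Base7.field-laws?)

module Base13 = FromTable 13 third13 class13

abstract
  base13 : BaseDesign 13
  base13 = Base13.baseDesign
    (from-yes Base13.τ-laws?) (from-yes Base13.class-laws?) (from-yes Base13.special-laws?)
    (from-yes Base13.coherent?) (from-yes Base13.cover∥?) (from-yes Base13.cover?) (from-yes Base13.field-laws?)

gls-from : ∀ {X R m v} → LRDesign X R m → v ≡ suc m →
  GLS 1 K36 K3 K6 (2 * v) × Σ (GLS 2 K36 K3 K6 (2 * v)) IsGLSStar
gls-from L refl = GLSConstruction.gls₁ L , GLSConstruction.gls₂ L

2q+1≡ : ∀ k → 2 * k + 1 ≡ suc (k * 2)
2q+1≡ k = trans (ℕ.+-comm (2 * k) 1) (cong suc (ℕ.*-comm 2 k))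

theorem3p3 : ∀ (v : ℕ) → AdmissibleV v →
    GLS 1 K36 K3 K6 (2 * v) × Σ (GLS 2 K36 K3 K6 (2 * v)) IsGLSStar
theorem3p3 _ (n@(suc _) , 1≤n , inj₁ refl) = gls-from (TernaryAffine.lrDesign n 3^n≡) (sym 3^n≡)
  where
  3^n≡ : suc (suc (3 ^ n ∸ 2)) ≡ 3 ^ n
  3^n≡ = ℕ.m+[n∸m]≡n (ℕ.≤-trans (s≤s (s≤s z≤n)) (ℕ.^-monoʳ-≤ 3 1≤n))
theorem3p3 _ (suc n , _ , inj₂ (inj₁ refl)) = gls-from (Inflation.lrDesign base7 n) (2q+1≡ (7 ^ suc n))
theorem3p3 _ (suc n , _ , inj₂ (inj₂ refl)) = gls-from (Inflation.lrDesign base13 n) (2q+1≡ (13 ^ suc n))
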